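{- Let $L$ be a geometric lattice of rank $r+1$ with $n$ atoms, and let $P$ be the rank $r+1$ near pencil on $n$ atoms. Then $h_S(L)\ge h_S(P)$ for every $S\subseteq[r]$.
   Context: A geometric lattice is a finite graded atomic lattice whose rank function $\rho$ satisfies $\rho(x\vee y)+\rho(x\wedge y)\le \rho(x)+\rho(y)$. The rank $r+1$ near pencil on $n$ atoms (with $n\ge r+1$) is the lattice of flats of the simple matroid on $n$ elements which is the direct sum of $r-1$ coloops and the rank-2 uniform matroid on the remaining $n-r+1$ elements (equivalently, the lattice of affine flats of $n$ points in $r$-dimensional space, $n-r+1$ of which lie on a line and the remaining $r-1$ are in general position). For a graded poset $Q$ of rank $r+1$ with $\hat0,\hat1$ and $T\subseteq[r]$, $f_T(Q)$ is the number of chains of $Q$ consisting of exactly one element of each rank in $T$; the flag $h$-vector is $h_S(Q)=\sum_{T\subseteq S}(-1)^{|S|-|T|}f_T(Q)$. -}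

module Defs where

open import Data.Nat as ℕ using (ℕ; zero; suc; _+_; _∸_; _⊔_; _⊓_; _≡ᵇ_; _≤ᵇ_)
open import Data.Bool using (Bool; true; false; _∧_; _∨_; not; if_then_else_)
open import Data.Fin as Fin using (Fin; toℕ)
open import Data.Fin.Subset using (Subset)
open import Data.Vec using (Vec; []; _∷_; lookup; zipWith; replicate)
open import Data.List as List using (List; []; _∷_; map; filter; allFin; foldr; length; _++_)
open import Data.Maybe using (Maybe; just; nothing)
open import Data.Product using (Σ; _×_; _,_; ∃)
open import Data.Sum using (_⊎_)
open import Data.Integer as ℤ using (ℤ)
open import Data.List.Relation.Unary.All using (All)
open import Relation.Nullary using (¬_)
open import Relation.Nullary.Decidable using (⌊_⌋)
open import Relation.Binary.PropositionalEquality using (_≡_; _≢_)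

-- A finite poset presented by: an exhaustive duplicate-free list of its
-- elements, a Boolean order relation and a rank function.
record FinRankedPoset : Set₁ where
  field
    Carrier : Set
    elems   : List Carrier
    leq     : Carrier → Carrier → Bool
    rk      : Carrier → ℕ

sumℕ : List ℕ → ℕ
sumℕ = foldr _+_ 0

allᵇ : ∀ {A : Set} → (A → Bool) → List A → Bool
allᵇ p = foldr (λ x b → p x ∧ b) true

countᵇ : ∀ {A : Set} → (A → Bool) → List A → ℕ
countᵇ p xs = length (filter (λ x → p x Data.Bool.≟ true) xs)

-- Number of chains x₁ < x₂ < … with rk xᵢ = tᵢ, for a strictly increasing
-- list of ranks t₁ < t₂ < … (the optional first argument is the previous
-- element of the chain, which must lie below the next one).
chainCount : (Q : FinRankedPoset) → Maybe (FinRankedPoset.Carrier Q) → List ℕ → ℕ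
chainCount Q p [] = 1
chainCount Q p (t ∷ ts) =
  sumℕ (map (λ x → if (rk x ≡ᵇ t) ∧ below p x then chainCount Q (just x) ts else 0) elems)
  where
    open FinRankedPoset Q
    below : Maybe Carrier → Carrier → Bool
    below nothing  x = true
    below (just y) x = leq y x

-- For a subset S of [r] = {1,…,r} (encoded as Subset r, index i ↦ rank i+1),
-- the increasing list of ranks in S.
ranks : ∀ {r} → Subset r → List ℕ
ranks {r} S = map (λ i → suc (toℕ i)) (filter (λ i → lookup S i Data.Bool.≟ true) (allFin r))

sublists : ∀ {A : Set} → List A → List (List A)
sublists [] = [] ∷ []
sublists (x ∷ xs) = sublists xs ++ map (x ∷_) (sublists xs)

fT : FinRankedPoset → List ℕ → ℕ
fT Q T = chainCount Q nothing T

sign : ℕ → ℤ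
sign zero = ℤ.+ 1
sign (suc k) = ℤ.- sign k

hS : ∀ {r} → FinRankedPoset → Subset r → ℤ
hS Q S = List.foldr ℤ._+_ (ℤ.+ 0)
  (map (λ T → sign (length (ranks S) ∸ length T) ℤ.* ℤ.+ (fT Q T)) (sublists (ranks S)))

record GeometricLattice (m : ℕ) : Set where
  field
    le : Fin m → Fin m → Bool
  _≤_ : Fin m → Fin m → Set
  x ≤ y = le x y ≡ true
  _⋖_ : Fin m → Fin m → Set
  x ⋖ y = x ≤ y × x ≢ y × (∀ z → x ≤ z → z ≤ y → z ≡ x ⊎ z ≡ y)
  field
    ≤-refl    : ∀ x → x ≤ x
    ≤-antisym : ∀ x y → x ≤ y → y ≤ x → x ≡ y
    ≤-trans   : ∀ x y z → x ≤ y → y ≤ z → x ≤ z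
    _⊔ₗ_ : Fin m → Fin m → Fin m
    _⊓ₗ_ : Fin m → Fin m → Fin m
    ⊔-ub₁ : ∀ x y → x ≤ (x ⊔ₗ y)
    ⊔-ub₂ : ∀ x y → y ≤ (x ⊔ₗ y)
    ⊔-least : ∀ x y z → x ≤ z → y ≤ z → (x ⊔ₗ y) ≤ z
    ⊓-lb₁ : ∀ x y → (x ⊓ₗ y) ≤ x
    ⊓-lb₂ : ∀ x y → (x ⊓ₗ y) ≤ y
    ⊓-greatest : ∀ x y z → z ≤ x → z ≤ y → z ≤ (x ⊓ₗ y)
    bot : Fin m
    bot-min : ∀ x → bot ≤ x
    top : Fin m
    top-max : ∀ x → x ≤ top
    ρ : Fin m → ℕ
    ρ-bot : ρ bot ≡ 0
    ρ-cover : ∀ x y → x ⋖ y → ρ y ≡ suc (ρ x)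
  Atom : Fin m → Set
  Atom a = bot ⋖ a
  field
    atomic : ∀ x → Σ (List (Fin m)) λ as → All Atom as × foldr _⊔ₗ_ bot as ≡ x
    semimodular : ∀ x y → ρ (x ⊔ₗ y) + ρ (x ⊓ₗ y) ℕ.≤ ρ x + ρ y

  isAtomᵇ : Fin m → Bool
  isAtomᵇ a = le bot a ∧ not ⌊ bot Fin.≟ a ⌋
    ∧ allᵇ (λ z → not (le bot z ∧ le z a) ∨ ⌊ z Fin.≟ bot ⌋ ∨ ⌊ z Fin.≟ a ⌋) (allFin m)

  numAtoms : ℕ
  numAtoms = countᵇ isAtomᵇ (allFin m)

  rank : ℕ
  rank = ρ top

  asPoset : FinRankedPoset
  asPoset = record { Carrier = Fin m ; elems = allFin m ; leq = le ; rk = ρ }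

-- The rank r+1 near pencil on n atoms, as the lattice of flats of the
-- matroid on ground set Fin n that is the direct sum of U_{2,n-r+1} on the
-- "line" elements {i | i ≤ n-r} and r-1 coloops on the other elements.

allSubsets : (n : ℕ) → List (Subset n)
allSubsets zero = [] ∷ []
allSubsets (suc n) = map (false ∷_) (allSubsets n) ++ map (true ∷_) (allSubsets n)

module NearPencil (r n : ℕ) where
  onLine : Fin n → Bool
  onLine i = toℕ i ≤ᵇ (n ∸ r)

  mrank : Subset n → ℕ
  mrank X = (countᵇ (λ i → lookup X i ∧ onLine i) (allFin n) ⊓ 2)
          + countᵇ (λ i → lookup X i ∧ not (onLine i)) (allFin n)

  insert : Subset n → Fin n → Subset n
  insert X i = zipWith _∨_ X (lookup (Data.Vec.tabulate (λ j → Data.Vec.tabulate (λ k → ⌊ j Fin.≟ k ⌋))) i)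

  isFlat : Subset n → Bool
  isFlat X = allᵇ (λ i → lookup X i ∨ not (mrank (insert X i) ≡ᵇ mrank X)) (allFin n)

  subsetᵇ : Subset n → Subset n → Bool
  subsetᵇ X Y = allᵇ (λ i → not (lookup X i) ∨ lookup Y i) (allFin n)

  nearPencil : FinRankedPoset
  nearPencil = record
    { Carrier = Subset n
    ; elems   = filter (λ X → isFlat X Data.Bool.≟ true) (allSubsets n)
    ; leq     = subsetᵇ
    ; rk      = mrank
    }

{-# OPTIONS --safe #-}
module Submission where

-- Choose an atom e of an interval [p, q] of L and sort the chains by their last member F not above e.  This gives
--   h_S[p, q] = Σ h_A[p, F] h_B[F ∨ e, q],
-- summed over the i in S ∪ {0} with i + 1 not in S and over the flats F of rank i avoiding e, where A consists of
-- the ranks of S below i and B of those above i + 1.  The flag h-number of the near pencil of rank d on n atoms is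
-- β_S + (n - d) γ_S with β_S, γ_S independent of n, and by induction the factors of the summands are bounded below by
-- such expressions.  What is left are lower bounds for sums over flats of given rank, all of which follow by induction
-- from one inequality: the number of hyperplanes avoiding e is at least 1 + Σ (|l| - 2), over the lines l through e.
-- This is a de Bruijn-Erdős inequality and is proved by linear algebra.  The near pencil attains equality both for
-- an atom e on its line and for a coloop e; accordingly γ_S splits in two ways, and the excess n - d of L is divided
-- between the two.

open import Defs
open import Data.Bool as Bool using (Bool; true; false; if_then_else_; _∧_; _∨_; not)
open import Data.Bool.Properties using (∧-zeroʳ; ∨-zeroʳ; ∨-identityʳ)
open import Data.Empty using (⊥; ⊥-elim)
open import Data.Fin as Fin using (Fin; zero; suc; toℕ)
open import Data.Fin.Induction using (po-wellFounded; po-noetherian)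
open import Data.Fin.Properties using (any?)
open import Data.Fin.Subset using (Subset)
open import Data.Integer using (ℤ; +_; 0ℤ; 1ℤ; _+_; _-_; _*_; -_; +≤+; +<+) renaming (_≤_ to _≤ℤ_; _<_ to _<ℤ_)
import Data.Integer.Properties as ℤ
open import Data.Integer.Properties using (≤-refl; ≤-trans; ≤-reflexive; +-mono-≤; +-identityˡ; +-identityʳ; *-identityˡ; *-identityʳ; *-zeroʳ; *-distribˡ-+; *-comm; i≤j⇒0≤j-i; 0≤i-j⇒j≤i; pos-*; drop‿+<+)
open import Data.Integer.Tactic.RingSolver using (solve-∀)
open import Data.List using (List; []; _∷_; length; map; foldr; filter; allFin; tabulate; _++_)
open import Data.List.Membership.Propositional.Properties using (∈-filter⁺; ∈-allFin)
open import Data.List.Properties using (length-map; length-++)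
open import Data.List.Relation.Unary.All as All using (All; []; _∷_)
import Data.List.Relation.Unary.All.Properties as All
open import Data.Maybe using (Maybe; just; nothing)
open import Data.Nat as ℕ using (ℕ; zero; suc; _≤_; _≡ᵇ_; _≤ᵇ_; _∸_)
import Data.Nat.Properties as ℕ
import Data.Nat.Tactic.RingSolver as ℕSolver
open import Data.Product using (_×_; _,_; proj₁; proj₂; ∃)
open import Data.Sum using (_⊎_; inj₁; inj₂; [_,_]′)
open import Data.Vec as Vec using (Vec; []; _∷_; lookup; toList)
open import Data.Vec.Properties using (lookup-zipWith; lookup∘tabulate; length-toList)
open import Function using (_∘_; case_of_)
open import Induction.WellFounded using (Acc; acc)
open import Relation.Binary.PropositionalEquality using (_≡_; _≢_; isEquivalence; refl; sym; trans; cong; cong₂; subst; subst₂; module ≡-Reasoning)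
open import Relation.Binary.Structures using (IsPartialOrder)
open import Relation.Nullary using (Dec; yes; no; ¬_)
open import Relation.Nullary.Decidable using (_×-dec_; _⊎-dec_; ¬?; ⌊_⌋)
open import Relation.Unary using (Decidable)

-- The obstacle is that both factors of a summand vary with F: the bounds for them contain the
-- numbers of atoms of [p, F] and [F ∨ e, q], so numbers of flats alone do not suffice. Grouping the
-- F by G = F ∨ e makes the second factor constant. The bound β + xγ for the first, x being the
-- excess of [p, F], is rewritten as (β - γ) + (x + 1)γ. Both coefficients are nonnegative because 0
-- ≤ γ ≤ β; the number of F over G bounds the sum of the first part, and a weighted count of
-- hyperplanes avoiding an atom bounds that of the second. The flats G are then counted with weight
-- 1, with a weight from the atoms below them and with one from the atoms above them, and each
-- weight has its own inequality. The excess is divided by sorting the atoms other than e by their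
-- line through e. It equals the sum of the |l| - 2 plus the excess of [e, q]; the first part is
-- matched with the formula for e on the line of a near pencil, the second with the formula for a
-- coloop e.

-- Integer inequalities and finite sums over decidable predicates

0≤+ : ∀ {a b} → 0ℤ ≤ℤ a → 0ℤ ≤ℤ b → 0ℤ ≤ℤ a + b
0≤+ = +-mono-≤

0≤* : ∀ {a b} → 0ℤ ≤ℤ a → 0ℤ ≤ℤ b → 0ℤ ≤ℤ a * b
0≤* {+ a} {+ b} _ _ = subst (0ℤ ≤ℤ_) (pos-* a b) (+≤+ ℕ.z≤n)

0≤pos : ∀ n → 0ℤ ≤ℤ + n
0≤pos n = +≤+ ℕ.z≤n

≤-by : ∀ {a b c} → 0ℤ ≤ℤ c → b - a ≡ c → a ≤ℤ b
≤-by 0≤c eq = 0≤i-j⇒j≤i (subst (0ℤ ≤ℤ_) (sym eq) 0≤c)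

x+y-x≡y : ∀ x y → x + y - x ≡ y
x+y-x≡y = solve-∀

1+x*0≡1 : ∀ x → 1ℤ + x * 0ℤ ≡ 1ℤ
1+x*0≡1 = solve-∀

+-interchange : ∀ a b c d → a + b + (c + d) ≡ a + c + (b + d)
+-interchange = solve-∀

*-monoˡ : ∀ {c a b} → 0ℤ ≤ℤ c → a ≤ℤ b → c * a ≤ℤ c * b
*-monoˡ {c} {a} {b} 0≤c a≤b = ≤-by (0≤* 0≤c (i≤j⇒0≤j-i a≤b)) (dist c a b)
  where
  dist : ∀ c a b → c * b - c * a ≡ c * (b - a)
  dist = solve-∀

opaque
  ∑F : ∀ {m} → (Fin m → ℤ) → ℤ
  ∑F {zero}  f = 0ℤ
  ∑F {suc m} f = f zero + ∑F (f ∘ suc)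

  ∑F-suc : ∀ {m} (f : Fin (suc m) → ℤ) → ∑F f ≡ f zero + ∑F (f ∘ suc)
  ∑F-suc f = refl

  ∑F-cong : ∀ {m} {f g : Fin m → ℤ} → (∀ x → f x ≡ g x) → ∑F f ≡ ∑F g
  ∑F-cong {zero}  eq = refl
  ∑F-cong {suc m} eq = cong₂ _+_ (eq zero) (∑F-cong (eq ∘ suc))

  ∑F-mono : ∀ {m} {f g : Fin m → ℤ} → (∀ x → f x ≤ℤ g x) → ∑F f ≤ℤ ∑F g
  ∑F-mono {zero}  le = ≤-refl
  ∑F-mono {suc m} le = +-mono-≤ (le zero) (∑F-mono (le ∘ suc))

  ∑F-zero : ∀ {m} {f : Fin m → ℤ} → (∀ x → f x ≡ 0ℤ) → ∑F f ≡ 0ℤ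
  ∑F-zero {zero}  eq = refl
  ∑F-zero {suc m} eq = cong₂ _+_ (eq zero) (∑F-zero (eq ∘ suc))

  ∑F-+ : ∀ {m} (f g : Fin m → ℤ) → ∑F (λ x → f x + g x) ≡ ∑F f + ∑F g
  ∑F-+ {zero}  f g = refl
  ∑F-+ {suc m} f g = trans (cong (λ z → (f zero + g zero) + z) (∑F-+ (f ∘ suc) (g ∘ suc)))
    (+-interchange (f zero) (g zero) (∑F (f ∘ suc)) (∑F (g ∘ suc)))

  ∑F-* : ∀ {m} c (f : Fin m → ℤ) → ∑F (λ x → c * f x) ≡ c * ∑F f
  ∑F-* {zero}  c f = sym (*-zeroʳ c)
  ∑F-* {suc m} c f = trans (cong (λ z → c * f zero + z) (∑F-* c (f ∘ suc))) (sym (*-distribˡ-+ c (f zero) _))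

  ∑F-swap : ∀ {m n} (f : Fin m → Fin n → ℤ) → ∑F (λ x → ∑F (f x)) ≡ ∑F (λ y → ∑F (λ x → f x y))
  ∑F-swap {zero} {n} f = sym (∑F-zero {n} {λ _ → 0ℤ} (λ _ → refl))
  ∑F-swap {suc m} f = trans (cong (λ z → ∑F (f zero) + z) (∑F-swap (f ∘ suc)))
    (sym (∑F-+ (f zero) (λ y → ∑F (λ x → f (suc x) y))))

  ∑F-single : ∀ {m} {f : Fin m → ℤ} a → (∀ x → ¬ x ≡ a → f x ≡ 0ℤ) → ∑F f ≡ f a
  ∑F-single {f = f} zero z = trans (cong (λ z → f zero + z) (∑F-zero (λ x → z (suc x) λ ()))) (+-identityʳ _)
  ∑F-single {f = f} (suc a) z = trans (cong₂ _+_ (z zero λ ()) (∑F-single a (λ x ne → z (suc x) λ { refl → ne refl })))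
    (+-identityˡ _)

when : {P : Set} → Dec P → ℤ → ℤ
when (yes _) v = v
when (no _)  v = 0ℤ

when-yes : {P : Set} (d : Dec P) {v : ℤ} → P → when d v ≡ v
when-yes (yes _) p = refl
when-yes (no ¬p) p = ⊥-elim (¬p p)

when-no : {P : Set} (d : Dec P) {v : ℤ} → ¬ P → when d v ≡ 0ℤ
when-no (yes p) ¬p = ⊥-elim (¬p p)
when-no (no _)  _  = refl

when-⇔ : {P Q : Set} (d : Dec P) (d′ : Dec Q) {u v : ℤ} → (P → Q) → (Q → P) → (P → u ≡ v) → when d u ≡ when d′ v
when-⇔ (yes p) d′ f g eq = trans (eq p) (sym (when-yes d′ (f p)))
when-⇔ (no ¬p) d′ f g eq = sym (when-no d′ (¬p ∘ g))

opaque
  ∑ : ∀ {m} {P : Fin m → Set} → Decidable P → (Fin m → ℤ) → ℤ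
  ∑ P? φ = ∑F (λ x → when (P? x) (φ x))

module _ {m : ℕ} {P : Fin m → Set} (P? : Decidable P) where

  opaque
    unfolding ∑

    ∑-mono : {φ ψ : Fin m → ℤ} → (∀ x → P x → φ x ≤ℤ ψ x) → ∑ P? φ ≤ℤ ∑ P? ψ
    ∑-mono {φ} {ψ} le = ∑F-mono go
      where
      go : ∀ x → when (P? x) (φ x) ≤ℤ when (P? x) (ψ x)
      go x with P? x
      ... | yes p = le x p
      ... | no _  = ≤-refl

    ∑-⇔ : {Q : Fin m → Set} (Q? : Decidable Q) {φ ψ : Fin m → ℤ}
      → (∀ x → P x → Q x) → (∀ x → Q x → P x) → (∀ x → P x → φ x ≡ ψ x) → ∑ P? φ ≡ ∑ Q? ψ
    ∑-⇔ Q? f g eq = ∑F-cong (λ x → when-⇔ (P? x) (Q? x) (f x) (g x) (eq x))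

    ∑-cong : {φ ψ : Fin m → ℤ} → (∀ x → P x → φ x ≡ ψ x) → ∑ P? φ ≡ ∑ P? ψ
    ∑-cong = ∑-⇔ P? (λ _ p → p) (λ _ p → p)

    ∑-+ : (φ ψ : Fin m → ℤ) → ∑ P? (λ x → φ x + ψ x) ≡ ∑ P? φ + ∑ P? ψ
    ∑-+ φ ψ = trans (∑F-cong go) (∑F-+ _ _)
      where
      go : ∀ x → when (P? x) (φ x + ψ x) ≡ when (P? x) (φ x) + when (P? x) (ψ x)
      go x with P? x
      ... | yes _ = refl
      ... | no _  = refl

    ∑-* : ∀ c (φ : Fin m → ℤ) → ∑ P? (λ x → c * φ x) ≡ c * ∑ P? φ
    ∑-* c φ = trans (∑F-cong go) (∑F-* c _)
      where
      go : ∀ x → when (P? x) (c * φ x) ≡ c * when (P? x) (φ x)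
      go x with P? x
      ... | yes _ = refl
      ... | no _  = sym (*-zeroʳ c)

    ∑-*ʳ : ∀ c (φ : Fin m → ℤ) → ∑ P? (λ x → φ x * c) ≡ ∑ P? φ * c
    ∑-*ʳ c φ = trans (∑-cong (λ x _ → comm (φ x) c)) (trans (∑-* c φ) (comm c _))
      where
      comm : ∀ a b → a * b ≡ b * a
      comm = solve-∀

    ∑-const : ∀ c → ∑ P? (λ _ → c) ≡ c * ∑ P? (λ _ → 1ℤ)
    ∑-const c = trans (∑-cong (λ _ _ → one c)) (∑-* c (λ _ → 1ℤ))
      where
      one : ∀ c → c ≡ c * 1ℤ
      one = solve-∀

    ∑-- : (φ ψ : Fin m → ℤ) → ∑ P? (λ x → φ x - ψ x) ≡ ∑ P? φ - ∑ P? ψ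
    ∑-- φ ψ = trans (∑-cong (λ x _ → neg (φ x) (ψ x)))
      (trans (∑-+ φ (λ x → (- 1ℤ) * ψ x)) (trans (cong (λ z → ∑ P? φ + z) (∑-* (- 1ℤ) ψ)) (sym (neg (∑ P? φ) (∑ P? ψ)))))
      where
      neg : ∀ a b → a - b ≡ a + (- 1ℤ) * b
      neg = solve-∀

    ∑-single : {φ : Fin m → ℤ} (a : Fin m) → P a → (∀ x → P x → x ≡ a) → ∑ P? φ ≡ φ a
    ∑-single a p uniq = trans (∑F-single a (λ x ne → when-no (P? x) (λ q → ne (uniq x q)))) (when-yes (P? a) p)

    ∑-empty : {φ : Fin m → ℤ} → (∀ x → ¬ P x) → ∑ P? φ ≡ 0ℤ
    ∑-empty ¬p = ∑F-zero (λ x → when-no (P? x) (¬p x))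

    ∑-vanish : {φ : Fin m → ℤ} → (∀ x → P x → φ x ≡ 0ℤ) → ∑ P? φ ≡ 0ℤ
    ∑-vanish {φ} z = ∑F-zero go
      where
      go : ∀ x → when (P? x) (φ x) ≡ 0ℤ
      go x with P? x
      ... | yes p = z x p
      ... | no _  = refl

    ∑-nonneg : {φ : Fin m → ℤ} → (∀ x → P x → 0ℤ ≤ℤ φ x) → 0ℤ ≤ℤ ∑ P? φ
    ∑-nonneg nn = ≤-trans (≤-reflexive (sym (∑-vanish {λ _ → 0ℤ} (λ _ _ → refl)))) (∑-mono nn)

    ∑-split : {R : Fin m → Set} (R? : Decidable R) (φ : Fin m → ℤ)
      → ∑ P? φ ≡ ∑ (λ x → P? x ×-dec R? x) φ + ∑ (λ x → P? x ×-dec ¬? (R? x)) φ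
    ∑-split R? φ = trans (∑F-cong go) (∑F-+ _ _)
      where
      go : ∀ x → when (P? x) (φ x) ≡ when (P? x ×-dec R? x) (φ x) + when (P? x ×-dec ¬? (R? x)) (φ x)
      go x with P? x | R? x
      ... | yes _ | yes _ = sym (+-identityʳ _)
      ... | yes _ | no _  = sym (+-identityˡ _)
      ... | no _  | yes _ = refl
      ... | no _  | no _  = refl

    ∑-member : {φ : Fin m → ℤ} (a : Fin m) → P a → (∀ x → P x → 0ℤ ≤ℤ φ x) → φ a ≤ℤ ∑ P? φ
    ∑-member {φ} a p nn = ≤-trans (≤-reflexive (sym (trans
        (∑F-single a (λ x x≢a → when-no (x Fin.≟ a) x≢a)) (when-yes (a Fin.≟ a) refl)))) (∑F-mono below)
      where
      below : ∀ x → when (x Fin.≟ a) (φ x) ≤ℤ when (P? x) (φ x)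
      below x with x Fin.≟ a
      ... | yes refl = ≤-reflexive (sym (when-yes (P? a) p))
      ... | no _ with P? x
      ...   | yes q = nn x q
      ...   | no _  = ≤-refl

opaque
  unfolding ∑

  -- Double counting of incident pairs. Only the conjunctions of the two conditions have to be
  -- equivalent, so the range of the inner sum may change with the order of summation.
  ∑-swap : ∀ {m n} {P : Fin m → Set} {Q : Fin m → Fin n → Set} {P′ : Fin n → Set} {Q′ : Fin n → Fin m → Set}
    (P? : Decidable P) (Q? : ∀ x → Decidable (Q x)) (P′? : Decidable P′) (Q′? : ∀ y → Decidable (Q′ y))
    {φ : Fin m → Fin n → ℤ}
    → (∀ x y → P x → Q x y → P′ y × Q′ y x) → (∀ x y → P′ y → Q′ y x → P x × Q x y)
    → ∑ P? (λ x → ∑ (Q? x) (φ x)) ≡ ∑ P′? (λ y → ∑ (Q′? y) (λ x → φ x y))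
  ∑-swap {m} {n} P? Q? P′? Q′? {φ} f g = begin
    ∑F (λ x → when (P? x) (∑F (λ y → when (Q? x y) (φ x y))))   ≡⟨ ∑F-cong (λ x → when-∑F (P? x)) ⟩
    ∑F (λ x → ∑F (λ y → when (P? x) (when (Q? x y) (φ x y))))   ≡⟨ ∑F-swap _ ⟩
    ∑F (λ y → ∑F (λ x → when (P? x) (when (Q? x y) (φ x y))))   ≡⟨ ∑F-cong (λ y → ∑F-cong (λ x → step x y)) ⟩
    ∑F (λ y → ∑F (λ x → when (P′? y) (when (Q′? y x) (φ x y)))) ≡⟨ ∑F-cong (λ y → sym (when-∑F (P′? y))) ⟩
    ∑F (λ y → when (P′? y) (∑F (λ x → when (Q′? y x) (φ x y)))) ∎
    where
    open ≡-Reasoning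
    when-∑F : ∀ {k} {A : Set} (d : Dec A) {f : Fin k → ℤ} → when d (∑F f) ≡ ∑F (λ y → when d (f y))
    when-∑F (yes _) = refl
    when-∑F (no _)  = sym (∑F-zero (λ _ → refl))
    when-× : {A B : Set} (d : Dec A) (d′ : Dec B) {v : ℤ} → when d (when d′ v) ≡ when (d ×-dec d′) v
    when-× (yes _) (yes _) = refl
    when-× (yes _) (no _)  = refl
    when-× (no _)  _       = refl
    step : ∀ x y → when (P? x) (when (Q? x y) (φ x y)) ≡ when (P′? y) (when (Q′? y x) (φ x y))
    step x y = trans (when-× (P? x) (Q? x y)) (trans
      (when-⇔ (P? x ×-dec Q? x y) (P′? y ×-dec Q′? y x) (λ (p , q) → f x y p q) (λ (p , q) → g x y p q) (λ _ → refl))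
      (sym (when-× (P′? y) (Q′? y x))))

-- Flag h-numbers of Boolean lattices and near pencils

-- bin x y is the binomial coefficient (x + y choose x).
bin : ℕ → ℕ → ℤ
bin zero    y       = 1ℤ
bin (suc x) zero    = 1ℤ
bin (suc x) (suc y) = bin x (suc y) + bin (suc x) y

bin-zeroʳ : ∀ x → bin x 0 ≡ 1ℤ
bin-zeroʳ zero    = refl
bin-zeroʳ (suc x) = refl

0≤bin : ∀ x y → 0ℤ ≤ℤ bin x y
0≤bin zero    y       = 0≤pos 1
0≤bin (suc x) zero    = 0≤pos 1
0≤bin (suc x) (suc y) = 0≤+ (0≤bin x (suc y)) (0≤bin (suc x) y)

-- Both sides are the multinomial coefficient (x + y + z)! / (x! y! z!). The coefficients of the
-- splitting identities are compared through it.
trinomial : ∀ x y z → bin x (y ℕ.+ z) * bin y z ≡ bin (x ℕ.+ y) z * bin x y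
trinomial zero y z = *-comm 1ℤ (bin y z)
trinomial (suc x) zero z rewrite ℕ.+-identityʳ x = refl
trinomial (suc x) (suc y) zero rewrite ℕ.+-identityʳ y = *-comm (bin (suc x) (suc y)) 1ℤ
trinomial (suc x) (suc y) (suc z) = begin
  (p + q) * (r + s)                                                   ≡⟨ expand p q r s ⟩
  p * (r + s) + q * r + q * s                                         ≡⟨ cong₂ _+_ (cong₂ _+_ e₁ e₂) e₃ ⟩
  t * bin x (suc y) + t * bin (suc x) y + w * bin (suc x) (suc y)     ≡⟨ collect t w (bin x (suc y)) (bin (suc x) y) ⟩
  (t + w) * (bin x (suc y) + bin (suc x) y)                           ∎
  where
  open ≡-Reasoning
  p = bin x (suc (y ℕ.+ suc z))
  q = bin (suc x) (y ℕ.+ suc z)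
  r = bin y (suc z)
  s = bin (suc y) z
  t = bin (x ℕ.+ suc y) (suc z)
  w = bin (suc (x ℕ.+ suc y)) z
  e₁ : p * (r + s) ≡ t * bin x (suc y)
  e₁ = trinomial x (suc y) (suc z)
  e₂ : q * r ≡ t * bin (suc x) y
  e₂ = trans (trinomial (suc x) y (suc z)) (cong (λ k → bin k (suc z) * bin (suc x) y) (sym (ℕ.+-suc x y)))
  e₃ : q * s ≡ w * bin (suc x) (suc y)
  e₃ = trans (cong (λ k → bin (suc x) k * s) (ℕ.+-suc y z)) (trinomial (suc x) (suc y) z)
  expand : ∀ p q r s → (p + q) * (r + s) ≡ p * (r + s) + q * r + q * s
  expand = solve-∀
  collect : ∀ t w a b → t * a + t * b + w * (a + b) ≡ (t + w) * (a + b)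
  collect = solve-∀

-- bin x (y - 1), bin (x - 1) y and bin (x + 1) (y - 2), where bin 0 (-1) = 1 in order that
-- Pascal's rule bin↓-bin← has no exception, and other negative arguments give 0.
bin↓ bin← bin↓↓ : ℕ → ℕ → ℤ
bin↓ x       (suc y) = bin x y
bin↓ zero    zero    = 1ℤ
bin↓ (suc x) zero    = 0ℤ

bin← zero    y = 0ℤ
bin← (suc x) y = bin x y

bin↓↓ x zero          = 0ℤ
bin↓↓ x (suc zero)    = 0ℤ
bin↓↓ x (suc (suc y)) = bin (suc x) y

bin↓-bin← : ∀ x y → bin x y ≡ bin← x y + bin↓ x y
bin↓-bin← zero    zero    = refl
bin↓-bin← zero    (suc y) = refl
bin↓-bin← (suc x) zero    = sym (cong (λ z → z + 0ℤ) (bin-zeroʳ x))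
bin↓-bin← (suc x) (suc y) = refl

0≤bin↓ : ∀ x y → 0ℤ ≤ℤ bin↓ x y
0≤bin↓ zero    zero    = 0≤pos 1
0≤bin↓ (suc x) zero    = ≤-refl
0≤bin↓ zero    (suc y) = 0≤bin zero y
0≤bin↓ (suc x) (suc y) = 0≤bin (suc x) y

-- The sum over all ways to write the list as `A ++ true ∷ B`. The marked rank is that of the flat F
-- at which a chain is cut, hence the recurring hypothesis on the lengths of `A` and `B`.
∑split : (List Bool → List Bool → ℤ) → List Bool → ℤ
∑split Φ []           = 0ℤ
∑split Φ (true ∷ bs)  = Φ [] bs + ∑split (λ A → Φ (true ∷ A)) bs
∑split Φ (false ∷ bs) = ∑split (λ A → Φ (false ∷ A)) bs

∑split-mono : ∀ {Φ Ψ} S → (∀ A B → length A ℕ.+ suc (length B) ≡ length S → Φ A B ≤ℤ Ψ A B) → ∑split Φ S ≤ℤ ∑split Ψ S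
∑split-mono []           le = ≤-refl
∑split-mono (true ∷ bs)  le = +-mono-≤ (le [] bs refl) (∑split-mono bs (λ A B eq → le (true ∷ A) B (cong suc eq)))
∑split-mono (false ∷ bs) le = ∑split-mono bs (λ A B eq → le (false ∷ A) B (cong suc eq))

∑split-cong : ∀ {Φ Ψ} S → (∀ A B → length A ℕ.+ suc (length B) ≡ length S → Φ A B ≡ Ψ A B) → ∑split Φ S ≡ ∑split Ψ S
∑split-cong []           eq = refl
∑split-cong (true ∷ bs)  eq = cong₂ _+_ (eq [] bs refl) (∑split-cong bs (λ A B l → eq (true ∷ A) B (cong suc l)))
∑split-cong (false ∷ bs) eq = ∑split-cong bs (λ A B l → eq (false ∷ A) B (cong suc l))

-- The shape `c X + d Y - Z` is that of the recursions for `hB`, `hC` and `h` at a selected rank, so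
-- that a splitting identity for `true ∷ bs` follows from those for `bs` once the summands satisfy
-- the recursion.
∑split-lin : ∀ c d {Φ Φ₁ Φ₂ Φ₃} S
  → (∀ A B → length A ℕ.+ suc (length B) ≡ length S → Φ A B ≡ c * Φ₁ A B + d * Φ₂ A B - Φ₃ A B)
  → ∑split Φ S ≡ c * ∑split Φ₁ S + d * ∑split Φ₂ S - ∑split Φ₃ S
∑split-lin c d [] eq = zer c d
  where
  zer : ∀ c d → 0ℤ ≡ c * 0ℤ + d * 0ℤ - 0ℤ
  zer = solve-∀
∑split-lin c d {Φ} {Φ₁} {Φ₂} {Φ₃} (true ∷ bs) eq =
  trans (cong₂ _+_ (eq [] bs refl) (∑split-lin c d bs (λ A B l → eq (true ∷ A) B (cong suc l))))
    (regroup c d (Φ₁ [] bs) (Φ₂ [] bs) (Φ₃ [] bs) _ _ _)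
  where
  regroup : ∀ c d x y z x′ y′ z′ → c * x + d * y - z + (c * x′ + d * y′ - z′) ≡ c * (x + x′) + d * (y + y′) - (z + z′)
  regroup = solve-∀
∑split-lin c d (false ∷ bs) eq = ∑split-lin c d bs (λ A B l → eq (false ∷ A) B (cong suc l))

0≤∑split : ∀ {Φ} S → (∀ A B → length A ℕ.+ suc (length B) ≡ length S → 0ℤ ≤ℤ Φ A B) → 0ℤ ≤ℤ ∑split Φ S
0≤∑split []           nn = ≤-refl
0≤∑split (true ∷ bs)  nn = 0≤+ (nn [] bs refl) (0≤∑split bs (λ A B l → nn (true ∷ A) B (cong suc l)))
0≤∑split (false ∷ bs) nn = 0≤∑split bs (λ A B l → nn (false ∷ A) B (cong suc l))

-- hB g S is the flag h-number of the Boolean lattice of rank g + length S, where S tells which of the ranks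
-- g, g + 1, … are selected.  Each point beyond the second on the line of a near pencil adds hC g S to it.
hB : ℕ → List Bool → ℤ
hB g []           = 1ℤ
hB g (true ∷ bs)  = bin g (suc (length bs)) * hB 1 bs - hB (suc g) bs
hB g (false ∷ bs) = hB (suc g) bs

hC : ℕ → List Bool → ℤ
hC g       []           = 0ℤ
hC g       (false ∷ bs) = hC (suc g) bs
hC zero    (true ∷ bs)  = 0ℤ
hC (suc g) (true ∷ bs)  =
  bin↓ (suc g) (length bs) * hC 1 bs + bin g (length bs) * hB 1 bs - hC (suc (suc g)) bs

private
  len-suc : ∀ (a b : ℕ) {n : ℕ} → a ℕ.+ suc b ≡ n → n ≡ suc a ℕ.+ b
  len-suc a b eq = trans (sym eq) (ℕ.+-suc a b)

-- Splitting the Boolean lattice of rank `suc g + length S` by an atom e: there are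
-- `bin (suc g + length A) (length B)` sets of size `suc g + length A` avoiding e, and the intervals
-- below such a set F and above F ∨ e are Boolean. The term `hB g S` belongs to the interval above
-- e.
hB-split : ∀ g S → hB (suc g) S ≡ hB g S + ∑split (λ A B → bin (suc g ℕ.+ length A) (length B) * (hB (suc g) A * hB 0 B)) S
hB-split g [] = refl
hB-split g (false ∷ bs) = trans (hB-split (suc g) bs) (cong (λ z → hB (suc g) bs + z)
  (∑split-cong bs (λ A B _ → cong (λ k → bin k (length B) * (hB (suc (suc g)) A * hB 0 B)) (sym (ℕ.+-suc (suc g) (length A))))))
hB-split g (true ∷ bs) = begin
  (p + q) * hB 1 bs - hB (suc (suc g)) bs
    ≡⟨ cong (λ z → (p + q) * hB 1 bs - z) (hB-split (suc g) bs) ⟩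
  (p + q) * hB 1 bs - (hB (suc g) bs + s₂)
    ≡⟨ move p q (hB 1 bs) (hB (suc g) bs) s₂ ⟩
  p * hB 1 bs - hB (suc g) bs + (q * hB 1 bs - s₂)
    ≡⟨ cong (λ z → p * hB 1 bs - hB (suc g) bs + (q * z - s₂)) (hB-split 0 bs) ⟩
  p * hB 1 bs - hB (suc g) bs + (q * (hB 0 bs + s₁) - s₂)
    ≡⟨ cong (λ z → p * hB 1 bs - hB (suc g) bs + z) (dist q (hB 0 bs) s₁ s₂) ⟩
  p * hB 1 bs - hB (suc g) bs + (q * (1ℤ * hB 0 bs) + (q * s₁ + 0ℤ * s₁ - s₂))
    ≡⟨ cong₂ (λ y z → p * hB 1 bs - hB (suc g) bs + (y * (1ℤ * hB 0 bs) + z))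
         (cong (λ k → bin k n) (sym (ℕ.+-identityʳ (suc g)))) (sym (∑split-lin q 0ℤ {Φ₂ = Φ₁} bs pointwise)) ⟩
  p * hB 1 bs - hB (suc g) bs + ∑split (λ A B → bin (suc g ℕ.+ length A) (length B) * (hB (suc g) A * hB 0 B)) (true ∷ bs) ∎
  where
  open ≡-Reasoning
  n = length bs
  p = bin g (suc n)
  q = bin (suc g) n
  Φ₁ Φ₂ : List Bool → List Bool → ℤ
  Φ₁ A B = bin (1 ℕ.+ length A) (length B) * (hB 1 A * hB 0 B)
  Φ₂ A B = bin (suc (suc g) ℕ.+ length A) (length B) * (hB (suc (suc g)) A * hB 0 B)
  s₁ = ∑split Φ₁ bs
  s₂ = ∑split Φ₂ bs
  move : ∀ p q h k s → (p + q) * h - (k + s) ≡ p * h - k + (q * h - s)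
  move = solve-∀
  dist : ∀ q h s t → q * (h + s) - t ≡ q * (1ℤ * h) + (q * s + 0ℤ * s - t)
  dist = solve-∀
  alg₁ : ∀ k c h₁ h₂ u → k * ((c * h₁ - h₂) * u) ≡ (k * c) * (h₁ * u) - k * (h₂ * u)
  alg₁ = solve-∀
  alg₂ : ∀ q d v w x → (q * d) * v - x ≡ q * (d * v) + 0ℤ * (w * v) - x
  alg₂ = solve-∀
  pointwise : ∀ A B → length A ℕ.+ suc (length B) ≡ length bs →
    bin (suc g ℕ.+ suc (length A)) (length B) * (hB (suc g) (true ∷ A) * hB 0 B) ≡ q * Φ₁ A B + 0ℤ * Φ₁ A B - Φ₂ A B
  pointwise A B eq = begin
    bin (suc g ℕ.+ suc a) b * ((bin (suc g) (suc a) * hB 1 A - hB (suc (suc g)) A) * hB 0 B)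
      ≡⟨ alg₁ (bin (suc g ℕ.+ suc a) b) (bin (suc g) (suc a)) (hB 1 A) (hB (suc (suc g)) A) (hB 0 B) ⟩
    (bin (suc g ℕ.+ suc a) b * bin (suc g) (suc a)) * (hB 1 A * hB 0 B) - bin (suc g ℕ.+ suc a) b * (hB (suc (suc g)) A * hB 0 B)
      ≡⟨ cong₂ (λ y k → y * (hB 1 A * hB 0 B) - bin k b * (hB (suc (suc g)) A * hB 0 B))
           (trans (sym (trinomial (suc g) (suc a) b)) (cong (λ k → bin (suc g) k * bin (suc a) b) (sym (len-suc a b eq))))
           (ℕ.+-suc (suc g) a) ⟩
    (q * bin (suc a) b) * (hB 1 A * hB 0 B) - Φ₂ A B
      ≡⟨ alg₂ q (bin (suc a) b) (hB 1 A * hB 0 B) (bin (suc a) b) (Φ₂ A B) ⟩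
    q * Φ₁ A B + 0ℤ * Φ₁ A B - Φ₂ A B ∎
    where
    a = length A
    b = length B

-- What the splitting by an atom e gives for the near pencil if e is on the line …
hC-split-line : ∀ g S → hC (suc g) S ≡ ∑split (λ A B → bin (g ℕ.+ length A) (length B) * (hB (suc g) A * hB 0 B)) S
hC-split-line g [] = refl
hC-split-line g (false ∷ bs) = trans (hC-split-line (suc g) bs)
  (∑split-cong bs (λ A B _ → cong (λ k → bin k (length B) * (hB (suc (suc g)) A * hB 0 B)) (sym (ℕ.+-suc g (length A)))))
hC-split-line g (true ∷ bs) = begin
  q * hC 1 bs + p * hB 1 bs - hC (suc (suc g)) bs
    ≡⟨ cong₂ (λ y z → q * y + p * hB 1 bs - z) (hC-split-line 0 bs) (hC-split-line (suc g) bs) ⟩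
  q * s₁ + p * hB 1 bs - s₃
    ≡⟨ cong (λ z → q * s₁ + p * z - s₃) (hB-split 0 bs) ⟩
  q * s₁ + p * (hB 0 bs + s₂) - s₃
    ≡⟨ dist q p (hB 0 bs) s₁ s₂ s₃ ⟩
  p * (1ℤ * hB 0 bs) + (q * s₁ + p * s₂ - s₃)
    ≡⟨ cong₂ (λ y z → y * (1ℤ * hB 0 bs) + z)
         (cong (λ k → bin k n) (sym (ℕ.+-identityʳ g))) (sym (∑split-lin q p bs pointwise)) ⟩
  ∑split (λ A B → bin (g ℕ.+ length A) (length B) * (hB (suc g) A * hB 0 B)) (true ∷ bs) ∎
  where
  open ≡-Reasoning
  n = length bs
  p = bin g n
  q = bin↓ (suc g) n
  Φ₁ Φ₂ Φ₃ : List Bool → List Bool → ℤ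
  Φ₁ A B = bin (length A) (length B) * (hB 1 A * hB 0 B)
  Φ₂ A B = bin (1 ℕ.+ length A) (length B) * (hB 1 A * hB 0 B)
  Φ₃ A B = bin (suc g ℕ.+ length A) (length B) * (hB (suc (suc g)) A * hB 0 B)
  s₁ = ∑split Φ₁ bs
  s₂ = ∑split Φ₂ bs
  s₃ = ∑split Φ₃ bs
  dist : ∀ q p h s t u → q * s + p * (h + t) - u ≡ p * (1ℤ * h) + (q * s + p * t - u)
  dist = solve-∀
  alg₁ : ∀ k c d h₁ h₂ u → k * (((c + d) * h₁ - h₂) * u) ≡ ((k * c) + (k * d)) * (h₁ * u) - k * (h₂ * u)
  alg₁ = solve-∀
  alg₂ : ∀ q d p e v x → (p * e + q * d) * v - x ≡ q * (d * v) + p * (e * v) - x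
  alg₂ = solve-∀
  pointwise : ∀ A B → length A ℕ.+ suc (length B) ≡ length bs →
    bin (g ℕ.+ suc (length A)) (length B) * (hB (suc g) (true ∷ A) * hB 0 B) ≡ q * Φ₁ A B + p * Φ₂ A B - Φ₃ A B
  pointwise A B eq = begin
    bin (g ℕ.+ suc a) b * (((bin g (suc a) + bin (suc g) a) * hB 1 A - hB (suc (suc g)) A) * hB 0 B)
      ≡⟨ alg₁ (bin (g ℕ.+ suc a) b) (bin g (suc a)) (bin (suc g) a) (hB 1 A) (hB (suc (suc g)) A) (hB 0 B) ⟩
    (bin (g ℕ.+ suc a) b * bin g (suc a) + bin (g ℕ.+ suc a) b * bin (suc g) a) * (hB 1 A * hB 0 B) - bin (g ℕ.+ suc a) b * (hB (suc (suc g)) A * hB 0 B)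
      ≡⟨ cong₂ (λ y z → (y + z) * (hB 1 A * hB 0 B) - bin (g ℕ.+ suc a) b * (hB (suc (suc g)) A * hB 0 B)) e₁ e₂ ⟩
    (p * bin (suc a) b + q * bin a b) * (hB 1 A * hB 0 B) - bin (g ℕ.+ suc a) b * (hB (suc (suc g)) A * hB 0 B)
      ≡⟨ cong (λ k → (p * bin (suc a) b + q * bin a b) * (hB 1 A * hB 0 B) - bin k b * (hB (suc (suc g)) A * hB 0 B)) (ℕ.+-suc g a) ⟩
    (p * bin (suc a) b + q * bin a b) * (hB 1 A * hB 0 B) - Φ₃ A B
      ≡⟨ alg₂ q (bin a b) p (bin (suc a) b) (hB 1 A * hB 0 B) (Φ₃ A B) ⟩
    q * Φ₁ A B + p * Φ₂ A B - Φ₃ A B ∎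
    where
    a = length A
    b = length B
    e₁ : bin (g ℕ.+ suc a) b * bin g (suc a) ≡ p * bin (suc a) b
    e₁ = trans (sym (trinomial g (suc a) b)) (cong (λ k → bin g k * bin (suc a) b) (sym (len-suc a b eq)))
    e₂ : bin (g ℕ.+ suc a) b * bin (suc g) a ≡ q * bin a b
    e₂ = trans (cong (λ k → bin k b * bin (suc g) a) (ℕ.+-suc g a)) (trans (sym (trinomial (suc g) a b))
      (cong (λ k → bin↓ (suc g) k * bin a b) (sym (len-suc a b eq))))

private
  -- The second `true` clause of `hC`, made to cover `g = 0` as well: there `bin↓` is 1 and `bin←`
  -- is 0, and the right side cancels.
  hC-true : ∀ g bs → hC g (true ∷ bs) ≡ bin↓ g (length bs) * hC 1 bs + bin← g (length bs) * hB 1 bs - hC (suc g) bs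
  hC-true (suc g) bs = refl
  hC-true zero    bs = trans (zer (hC 1 bs) (hB 1 bs)) (cong (λ c → c * hC 1 bs + 0ℤ * hB 1 bs - hC 1 bs) (one (length bs)))
    where
    zer : ∀ x y → 0ℤ ≡ 1ℤ * x + 0ℤ * y - x
    zer = solve-∀
    one : ∀ n → 1ℤ ≡ bin↓ 0 n
    one zero    = refl
    one (suc n) = refl

  -- Pascal's rule. Its one exception, `g = 0` with `bs` empty, is harmless because `hC 1 []` is 0.
  pascal↓↓ : ∀ g bs → bin↓ (suc g) (length bs) * hC 1 bs ≡ (bin↓ g (length bs) + bin↓↓ g (length bs)) * hC 1 bs
  pascal↓↓ g []            = sym (*-zeroʳ (bin↓ g 0 + bin↓↓ g 0))
  pascal↓↓ g bs@(_ ∷ [])    = cong (λ c → (c + 0ℤ) * hC 1 bs) (sym (bin-zeroʳ g))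
  pascal↓↓ g (_ ∷ _ ∷ _)   = refl

  -- The three products in the coloop formula belong to flats F containing the line, meeting it in
  -- one point, and missing it. `coef₁`, `coef₃` and `coef₂` compare their coefficients in this
  -- order. The first and the last are single instances of `trinomial`; the middle one combines
  -- three of them by Pascal's rule.
  coef₁ : ∀ g A b → bin← (g ℕ.+ suc (length A)) b * bin↓ (suc g) (length A) * hC 1 A
                  ≡ bin↓↓ g (suc (length A ℕ.+ b)) * bin← (length A) b * hC 1 A
  coef₁ g []      b = trans (*-zeroʳ (bin← (g ℕ.+ 1) b * 0ℤ)) (sym (*-zeroʳ (bin↓↓ g (suc b) * 0ℤ)))
  coef₁ g A@(_ ∷ A′) b = cong (λ z → z * hC 1 A) (begin
    bin← (g ℕ.+ suc (suc a)) b * bin (suc g) a ≡⟨ cong (λ k → bin← k b * bin (suc g) a) (trans (ℕ.+-suc g (suc a)) (cong suc (ℕ.+-suc g a))) ⟩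
    bin (suc g ℕ.+ a) b * bin (suc g) a       ≡⟨ sym (trinomial (suc g) a b) ⟩
    bin (suc g) (a ℕ.+ b) * bin a b           ∎)
    where
    open ≡-Reasoning
    a = length A′

  coef₂ : ∀ g a B → bin↓↓ (g ℕ.+ suc a) (length B) * bin (suc g) (suc a) * hC 0 B
                  ≡ bin↓↓ g (suc (a ℕ.+ length B)) * bin↓↓ a (length B) * hC 0 B
  coef₂ g a []           = trans (*-zeroʳ (0ℤ * bin (suc g) (suc a))) (sym (*-zeroʳ (bin↓↓ g (suc (a ℕ.+ 0)) * 0ℤ)))
  coef₂ g a (true ∷ [])  = sym (*-zeroʳ (bin↓↓ g (suc (a ℕ.+ 1)) * 0ℤ))
  coef₂ g a (false ∷ []) = sym (*-zeroʳ (bin↓↓ g (suc (a ℕ.+ 1)) * 0ℤ))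
  coef₂ g a B@(_ ∷ _ ∷ B′) = cong (λ z → z * hC 0 B) (begin
    bin (suc g ℕ.+ suc a) b * bin (suc g) (suc a)          ≡⟨ sym (trinomial (suc g) (suc a) b) ⟩
    bin (suc g) (suc a ℕ.+ b) * bin (suc a) b              ≡⟨ cong (λ k → bin↓↓ g (suc k) * bin (suc a) b)
                                                               (sym (trans (ℕ.+-suc a (suc b)) (cong suc (ℕ.+-suc a b)))) ⟩
    bin↓↓ g (suc (a ℕ.+ suc (suc b))) * bin (suc a) b      ∎)
    where
    open ≡-Reasoning
    b = length B′

  coef₃ : ∀ g a b → bin← (g ℕ.+ suc a) b * bin g a + bin↓ (g ℕ.+ suc a) b * bin (suc g) (suc a)
                  ≡ bin↓↓ g (suc (a ℕ.+ b)) * bin↓ a b + bin↓ g (suc (a ℕ.+ b)) * bin (suc a) b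
  coef₃ g a b rewrite ℕ.+-suc g a = go a b
    where
    open ≡-Reasoning
    alg : ∀ x y → 1ℤ * x + 0ℤ * y ≡ x
    alg = solve-∀
    lemma : ∀ a → bin↓↓ g (suc (a ℕ.+ 0)) * bin↓ a 0 ≡ 0ℤ
    lemma zero    = refl
    lemma (suc a) = *-zeroʳ (bin↓↓ g (suc (suc (a ℕ.+ 0))))

    fin : ∀ x y z → x ≡ 0ℤ → y ≡ z → z ≡ x + y * 1ℤ
    fin x y z refl refl = fin′ y
      where
      fin′ : ∀ y → y ≡ 0ℤ + y * 1ℤ
      fin′ = solve-∀
    exch : ∀ p q r s t u v w x y → p ≡ q → r * (s + t) ≡ u * v + w * x → u ≡ y → p + r * (s + t) ≡ y * v + (q + w * x)
    exch p q r s t u v w x y refl e refl = trans (cong (λ z → p + z) e) (exch′ p (u * v) (w * x))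
      where
      exch′ : ∀ a b c → a + (b + c) ≡ b + (a + c)
      exch′ = solve-∀
    go : ∀ a b → bin (g ℕ.+ a) b * bin g a + bin↓ (suc (g ℕ.+ a)) b * bin (suc g) (suc a)
               ≡ bin↓↓ g (suc (a ℕ.+ b)) * bin↓ a b + bin↓ g (suc (a ℕ.+ b)) * bin (suc a) b
    go a zero = trans (cong (λ z → z * bin g a + 0ℤ * bin (suc g) (suc a)) (bin-zeroʳ (g ℕ.+ a)))
      (trans (alg (bin g a) (bin (suc g) (suc a))) (fin _ _ _ (lemma a) (cong (bin g) (ℕ.+-identityʳ a))))
    go a (suc b) = begin
      bin (g ℕ.+ a) (suc b) * bin g a + bin (suc (g ℕ.+ a)) b * (bin g (suc a) + bin (suc g) a)
        ≡⟨ exch _ _ (bin (suc (g ℕ.+ a)) b) (bin g (suc a)) (bin (suc g) a) (bin (suc g) (a ℕ.+ b)) (bin a b) (bin g (a ℕ.+ suc b)) (bin (suc a) b) _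
             (sym (trinomial g a (suc b))) e₂ (cong (λ k → bin↓↓ g (suc k)) (sym (ℕ.+-suc a b))) ⟩
      bin↓↓ g (suc (a ℕ.+ suc b)) * bin a b + (bin g (a ℕ.+ suc b) * bin a (suc b) + bin g (a ℕ.+ suc b) * bin (suc a) b)
        ≡⟨ cong (λ z → bin↓↓ g (suc (a ℕ.+ suc b)) * bin a b + z) (und (bin g (a ℕ.+ suc b)) (bin a (suc b)) (bin (suc a) b)) ⟩
      bin↓↓ g (suc (a ℕ.+ suc b)) * bin a b + bin g (a ℕ.+ suc b) * (bin a (suc b) + bin (suc a) b) ∎
      where
      und : ∀ x y z → x * y + x * z ≡ x * (y + z)
      und = solve-∀
      dis : ∀ r s t → r * (s + t) ≡ r * t + r * s
      dis = solve-∀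
      e₂ : bin (suc (g ℕ.+ a)) b * (bin g (suc a) + bin (suc g) a) ≡ bin (suc g) (a ℕ.+ b) * bin a b + bin g (a ℕ.+ suc b) * bin (suc a) b
      e₂ = trans (dis (bin (suc (g ℕ.+ a)) b) (bin g (suc a)) (bin (suc g) a)) (cong₂ _+_ (sym (trinomial (suc g) a b))
        (trans (cong (λ k → bin k b * bin g (suc a)) (sym (ℕ.+-suc g a))) (trans (sym (trinomial g (suc a) b))
          (cong (λ k → bin g k * bin (suc a) b) (sym (ℕ.+-suc a b))))))

-- … and if e is a coloop.
hC-split-coloop : ∀ g S → hC (suc g) S ≡ hC g S + ∑split (λ A B →
    bin← (g ℕ.+ length A) (length B) * (hC (suc g) A * hB 0 B) + bin↓ (g ℕ.+ length A) (length B) * (hB (suc g) A * hB 0 B)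
    + bin↓↓ (g ℕ.+ length A) (length B) * (hB (suc g) A * hC 0 B)) S
hC-split-coloop g [] = refl
hC-split-coloop g (false ∷ bs) = trans (hC-split-coloop (suc g) bs) (cong (λ z → hC (suc g) bs + z)
  (∑split-cong bs (λ A B _ → cong (λ k → bin← k (length B) * (hC (suc (suc g)) A * hB 0 B) + bin↓ k (length B) * (hB (suc (suc g)) A * hB 0 B)
    + bin↓↓ k (length B) * (hB (suc (suc g)) A * hC 0 B)) (sym (ℕ.+-suc g (length A))))))
hC-split-coloop g (true ∷ bs) = begin
  bin↓ (suc g) n * hC 1 bs + bin g n * hB 1 bs - hC (suc (suc g)) bs
    ≡⟨ cong₂ (λ y z → y + z * hB 1 bs - hC (suc (suc g)) bs) (pascal↓↓ g bs) (bin↓-bin← g n) ⟩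
  (bin↓ g n + c) * hC 1 bs + (bin← g n + d) * hB 1 bs - hC (suc (suc g)) bs
    ≡⟨ cong (λ z → (bin↓ g n + c) * hC 1 bs + (bin← g n + d) * hB 1 bs - z) (hC-split-coloop (suc g) bs) ⟩
  (bin↓ g n + c) * hC 1 bs + (bin← g n + d) * hB 1 bs - (hC (suc g) bs + s₃)
    ≡⟨ alg₀ (bin↓ g n) c (hC 1 bs) (bin← g n) d (hB 1 bs) (hC (suc g) bs) s₃ ⟩
  (bin↓ g n * hC 1 bs + bin← g n * hB 1 bs - hC (suc g) bs) + (c * hC 1 bs + d * hB 1 bs - s₃)
    ≡⟨ cong₂ (λ y z → y + (c * z + d * hB 1 bs - s₃)) (sym (hC-true g bs)) (hC-split-coloop 0 bs) ⟩
  hC g (true ∷ bs) + (c * (hC 0 bs + s₁) + d * hB 1 bs - s₃)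
    ≡⟨ cong (λ z → hC g (true ∷ bs) + (c * (hC 0 bs + s₁) + d * z - s₃)) (hB-split 0 bs) ⟩
  hC g (true ∷ bs) + (c * (hC 0 bs + s₁) + d * (hB 0 bs + s₂) - s₃)
    ≡⟨ cong (λ z → hC g (true ∷ bs) + z) (alg₁ (bin← g n) c d (hC 0 bs) (hB 0 bs) s₁ s₂ s₃) ⟩
  hC g (true ∷ bs) + (bin← g n * (0ℤ * hB 0 bs) + d * (1ℤ * hB 0 bs) + c * (1ℤ * hC 0 bs) + (c * s₁ + d * s₂ - s₃))
    ≡⟨ cong₂ (λ k z → hC g (true ∷ bs) + (bin← k n * (0ℤ * hB 0 bs) + bin↓ k n * (1ℤ * hB 0 bs) + bin↓↓ k n * (1ℤ * hC 0 bs) + z))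
         (sym (ℕ.+-identityʳ g)) (sym (∑split-lin c d bs pointwise)) ⟩
  hC g (true ∷ bs) + ∑split (Ψ g) (true ∷ bs) ∎
  where
  open ≡-Reasoning
  n = length bs
  c = bin↓↓ g n
  d = bin↓ g n
  Ψ : ℕ → List Bool → List Bool → ℤ
  Ψ g A B = bin← (g ℕ.+ length A) (length B) * (hC (suc g) A * hB 0 B) + bin↓ (g ℕ.+ length A) (length B) * (hB (suc g) A * hB 0 B)
    + bin↓↓ (g ℕ.+ length A) (length B) * (hB (suc g) A * hC 0 B)
  Φ₂ : List Bool → List Bool → ℤ
  Φ₂ A B = bin (1 ℕ.+ length A) (length B) * (hB 1 A * hB 0 B)
  s₁ = ∑split (Ψ 0) bs
  s₂ = ∑split Φ₂ bs
  s₃ = ∑split (Ψ (suc g)) bs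
  alg₀ : ∀ p c h q d k l s → (p + c) * h + (q + d) * k - (l + s) ≡ (p * h + q * k - l) + (c * h + d * k - s)
  alg₀ = solve-∀
  alg₁ : ∀ e c d h k s t u → c * (h + s) + d * (k + t) - u ≡ e * (0ℤ * k) + d * (1ℤ * k) + c * (1ℤ * h) + (c * s + d * t - u)
  alg₁ = solve-∀
  alg₂ : ∀ x y z p q r C₁ C₂ H₁ H₂ u v →
    x * ((p * C₁ + q * H₁ - C₂) * u) + y * ((r * H₁ - H₂) * u) + z * ((r * H₁ - H₂) * v)
    ≡ (x * p * C₁) * u + (x * q + y * r) * (H₁ * u) + (z * r * v) * H₁ - (x * (C₂ * u) + y * (H₂ * u) + z * (H₂ * v))
  alg₂ = solve-∀
  alg₃ : ∀ c d x y z w C₁ H₁ u v s →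
    (c * x * C₁) * u + (c * y + d * w) * (H₁ * u) + (c * z * v) * H₁ - s
    ≡ c * (x * (C₁ * u) + y * (H₁ * u) + z * (H₁ * v)) + d * (w * (H₁ * u)) - s
  alg₃ = solve-∀
  pointwise : ∀ A B → length A ℕ.+ suc (length B) ≡ length bs → Ψ g (true ∷ A) B ≡ c * Ψ 0 A B + d * Φ₂ A B - Ψ (suc g) A B
  pointwise A B eq = begin
    Ψ g (true ∷ A) B
      ≡⟨ alg₂ (bin← i b) (bin↓ i b) (bin↓↓ i b) (bin↓ (suc g) a) (bin g a) (bin (suc g) (suc a))
           (hC 1 A) (hC (suc (suc g)) A) (hB 1 A) (hB (suc (suc g)) A) (hB 0 B) (hC 0 B) ⟩
    (bin← i b * bin↓ (suc g) a * hC 1 A) * hB 0 B + (bin← i b * bin g a + bin↓ i b * bin (suc g) (suc a)) * (hB 1 A * hB 0 B)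
      + (bin↓↓ i b * bin (suc g) (suc a) * hC 0 B) * hB 1 A
      - (bin← i b * (hC (suc (suc g)) A * hB 0 B) + bin↓ i b * (hB (suc (suc g)) A * hB 0 B) + bin↓↓ i b * (hB (suc (suc g)) A * hC 0 B))
      ≡⟨ cong₂ _-_ (cong₂ _+_ (cong₂ _+_ (cong (λ z → z * hB 0 B) (coef₁ g A b)) (cong (λ z → z * (hB 1 A * hB 0 B)) (coef₃ g a b)))
           (cong (λ z → z * hB 1 A) (coef₂ g a B)))
           (cong (λ i → bin← i b * (hC (suc (suc g)) A * hB 0 B) + bin↓ i b * (hB (suc (suc g)) A * hB 0 B) + bin↓↓ i b * (hB (suc (suc g)) A * hC 0 B))
             (ℕ.+-suc g a)) ⟩
    coefficients (suc (a ℕ.+ b))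
      ≡⟨ cong coefficients (sym (len-suc a b eq)) ⟩
    coefficients n
      ≡⟨ alg₃ c d (bin← a b) (bin↓ a b) (bin↓↓ a b) (bin (suc a) b) (hC 1 A) (hB 1 A) (hB 0 B) (hC 0 B) (Ψ (suc g) A B) ⟩
    c * Ψ 0 A B + d * Φ₂ A B - Ψ (suc g) A B ∎
    where
    a = length A
    b = length B
    i = g ℕ.+ suc a
    coefficients : ℕ → ℤ
    coefficients n = (bin↓↓ g n * bin← a b * hC 1 A) * hB 0 B + (bin↓↓ g n * bin↓ a b + bin↓ g n * bin (suc a) b) * (hB 1 A * hB 0 B)
      + (bin↓↓ g n * bin↓↓ a b * hC 0 B) * hB 1 A - Ψ (suc g) A B

-- If the rank of the bottom element is selected, the chains with and without that element cancel.
hB-true : ∀ bs → hB 0 (true ∷ bs) ≡ 0ℤ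
hB-true bs = zer (hB 1 bs)
  where
  zer : ∀ x → 1ℤ * x - x ≡ 0ℤ
  zer = solve-∀

bin-monoˡ : ∀ x y → bin x y ≤ℤ bin (suc x) y
bin-monoˡ x zero    = ≤-reflexive (bin-zeroʳ x)
bin-monoˡ x (suc y) = ≤-by (0≤bin (suc x) y) (x+y-x≡y (bin x (suc y)) (bin (suc x) y))

private
  -- The defining recursions contain negative terms, but the splittings at `g = 0` do not. They
  -- express `hC 1 S` and `hB 1 S` by the same products with coefficients `bin a b ≤ bin (1 + a) b`,
  -- and the lists in these products are shorter than `S`.
  0≤hC₁≤hB₁ : ∀ n S → length S ℕ.≤ n → 0ℤ ≤ℤ hC 1 S × hC 1 S ≤ℤ hB 1 S
  0≤hB₀ : ∀ n S → length S ℕ.≤ suc n → 0ℤ ≤ℤ hB 0 S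
  0≤hB₀ n []           l = 0≤pos 1
  0≤hB₀ n (true ∷ bs)  l = ≤-reflexive (sym (hB-true bs))
  0≤hB₀ n (false ∷ bs) (ℕ.s≤s l) = let (p , q) = 0≤hC₁≤hB₁ n bs l in ≤-trans p q

  0≤hC₁≤hB₁ n [] l = ≤-refl , 0≤pos 1
  0≤hC₁≤hB₁ (suc n) S@(_ ∷ _) l =
      subst (0ℤ ≤ℤ_) (sym (hC-split-line 0 S)) (0≤∑split S (λ A B eq → 0≤* (0≤bin (length A) (length B)) (0≤hBhB A B eq)))
    , subst₂ _≤ℤ_ (trans (+-identityˡ _) (sym (hC-split-line 0 S))) (sym (hB-split 0 S))
        (+-mono-≤ (0≤hB₀ n S l) (∑split-mono S λ A B eq →
          ≤-by (0≤* (0≤bin-diff (length A) (length B)) (0≤hBhB A B eq))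
            (factor (bin (length A) (length B)) (bin (1 ℕ.+ length A) (length B)) (hB 1 A * hB 0 B))))
    where
    factor : ∀ a b h → b * h - a * h ≡ (b - a) * h
    factor = solve-∀
    0≤bin-diff : ∀ a b → 0ℤ ≤ℤ bin (suc a) b - bin a b
    0≤bin-diff a b = i≤j⇒0≤j-i (bin-monoˡ a b)
    len : ∀ a b → a ℕ.+ suc b ℕ.≤ suc n → a ℕ.≤ n × b ℕ.≤ n
    len a b le rewrite ℕ.+-suc a b = ℕ.m+n≤o⇒m≤o a (ℕ.≤-pred le) , ℕ.m+n≤o⇒n≤o a (ℕ.≤-pred le)
    0≤hBhB : ∀ A B → length A ℕ.+ suc (length B) ≡ length S → 0ℤ ≤ℤ hB 1 A * hB 0 B
    0≤hBhB A B eq =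
      let (lA , lB) = len (length A) (length B) (subst (ℕ._≤ suc n) (sym eq) l)
          (p , q)   = 0≤hC₁≤hB₁ n A lA
      in 0≤* (≤-trans p q) (0≤hB₀ n B (ℕ.m≤n⇒m≤1+n lB))

0≤hC1 : ∀ S → 0ℤ ≤ℤ hC 1 S
0≤hC1 S = proj₁ (0≤hC₁≤hB₁ (length S) S ℕ.≤-refl)

hC1≤hB1 : ∀ S → hC 1 S ≤ℤ hB 1 S
hC1≤hB1 S = proj₂ (0≤hC₁≤hB₁ (length S) S ℕ.≤-refl)

0≤hB0 : ∀ S → 0ℤ ≤ℤ hB 0 S
0≤hB0 S = 0≤hB₀ (length S) S (ℕ.n≤1+n _)

0≤hC0 : ∀ S → 0ℤ ≤ℤ hC 0 S
0≤hC0 []           = ≤-refl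
0≤hC0 (true ∷ bs)  = ≤-refl
0≤hC0 (false ∷ bs) = 0≤hC1 bs

-- Rank and atoms in geometric lattices

module Ranked {m : ℕ} (L : GeometricLattice m) where

  open GeometricLattice L public using (_⋖_; le; ρ; bot; top; bot-min; top-max; ρ-bot; ρ-cover; atomic; semimodular; Atom) renaming
    (_≤_ to _⊑_; ≤-refl to ⊑-refl; ≤-antisym to ⊑-antisym; ≤-trans to ⊑-trans′; _⊔ₗ_ to _⊔_; _⊓ₗ_ to _⊓_;
     ⊔-ub₁ to ub₁; ⊔-ub₂ to ub₂; ⊔-least to lub; ⊓-lb₁ to lb₁; ⊓-lb₂ to lb₂; ⊓-greatest to glb)

  ⊑-trans : ∀ {x y z} → x ⊑ y → y ⊑ z → x ⊑ z
  ⊑-trans {x} {y} {z} = ⊑-trans′ x y z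

  _⊑?_ : ∀ x y → Dec (x ⊑ y)
  x ⊑? y = le x y Bool.≟ true

  private
    _⊏_ : Fin m → Fin m → Set
    x ⊏ y = x ⊑ y × x ≢ y

    ⊑-isPartialOrder : IsPartialOrder _≡_ _⊑_
    ⊑-isPartialOrder = record
      { isPreorder = record { isEquivalence = isEquivalence ; reflexive = λ { {x} refl → ⊑-refl x } ; trans = ⊑-trans }
      ; antisym    = ⊑-antisym _ _ }

    between? : ∀ x y → Decidable (λ z → x ⊏ z × z ⊏ y)
    between? x y z = (x ⊑? z ×-dec ¬? (x Fin.≟ z)) ×-dec (z ⊑? y ×-dec ¬? (z Fin.≟ y))

    -- The rank function is prescribed at the bottom and along covers only. Its strict monotonicity
    -- needs a cover below `y` and above `x`, found by climbing from `x` while something lies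
    -- strictly between.
    lowerCover : ∀ {x y} → Acc (λ u v → v ⊏ u) x → x ⊏ y → ∃ λ w → x ⊑ w × w ⋖ y
    lowerCover {x} {y} (acc rs) x⊏y with any? (between? x y)
    ... | yes (z , x⊏z , z⊏y) = let (w , z⊑w , w⋖y) = lowerCover (rs x⊏z) z⊏y in w , ⊑-trans (proj₁ x⊏z) z⊑w , w⋖y
    ... | no none = x , ⊑-refl x , proj₁ x⊏y , proj₂ x⊏y , ends
      where
      ends : ∀ z → x ⊑ z → z ⊑ y → z ≡ x ⊎ z ≡ y
      ends z x⊑z z⊑y with z Fin.≟ x | z Fin.≟ y
      ... | yes z≡x | _       = inj₁ z≡x
      ... | no _    | yes z≡y = inj₂ z≡y
      ... | no z≢x  | no z≢y  = ⊥-elim (none (z , (x⊑z , z≢x ∘ sym) , (z⊑y , z≢y)))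

    strict : ∀ {x y} → Acc _⊏_ y → x ⊏ y → ρ x ℕ.< ρ y
    strict {x} {y} (acc rs) x⊏y with lowerCover (po-noetherian ⊑-isPartialOrder x) x⊏y
    ... | w , x⊑w , w⋖y with x Fin.≟ w
    ...   | yes refl = ℕ.≤-reflexive (sym (ρ-cover x y w⋖y))
    ...   | no x≢w   = ℕ.<-trans (strict (rs (proj₁ w⋖y , proj₁ (proj₂ w⋖y))) (x⊑w , x≢w))
                         (ℕ.≤-reflexive (sym (ρ-cover w y w⋖y)))

  ρ-strict : ∀ {x y} → x ⊑ y → x ≢ y → ρ x ℕ.< ρ y
  ρ-strict {x} {y} x⊑y x≢y = strict (po-wellFounded ⊑-isPartialOrder y) (x⊑y , x≢y)

  ρ-mono : ∀ {x y} → x ⊑ y → ρ x ℕ.≤ ρ y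
  ρ-mono {x} {y} x⊑y with x Fin.≟ y
  ... | yes refl = ℕ.≤-refl
  ... | no x≢y   = ℕ.<⇒≤ (ρ-strict x⊑y x≢y)

  ρ-inj : ∀ {x y} → x ⊑ y → ρ y ℕ.≤ ρ x → x ≡ y
  ρ-inj {x} {y} x⊑y ρy≤ρx with x Fin.≟ y
  ... | yes x≡y = x≡y
  ... | no x≢y  = ⊥-elim (ℕ.<⇒≱ (ρ-strict x⊑y x≢y) ρy≤ρx)

  -- The upper bound is semimodularity, as `p` lies below `x ⊓ e`; the lower bound holds because
  -- `x ⊔ e` is strictly above `x`. The element `p` makes the statement relative to an interval in
  -- which `e` is an atom.
  ρ-⊔ : ∀ {p e x} → p ⊑ e → ρ e ≡ suc (ρ p) → p ⊑ x → ¬ e ⊑ x → ρ (x ⊔ e) ≡ suc (ρ x)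
  ρ-⊔ {p} {e} {x} p⊑e ρe p⊑x e⋢x = ℕ.≤-antisym upper lower
    where
    lower : suc (ρ x) ℕ.≤ ρ (x ⊔ e)
    lower = ρ-strict (ub₁ x e) (λ eq → e⋢x (subst (e ⊑_) (sym eq) (ub₂ x e)))
    meet : ρ p ℕ.≤ ρ (x ⊓ e)
    meet = ρ-mono (glb x e p p⊑x p⊑e)
    upper : ρ (x ⊔ e) ℕ.≤ suc (ρ x)
    upper = ℕ.+-cancelʳ-≤ (ρ p) (ρ (x ⊔ e)) (suc (ρ x)) (ℕ.≤-trans (ℕ.+-monoʳ-≤ (ρ (x ⊔ e)) meet)
      (ℕ.≤-trans (semimodular x e) (ℕ.≤-reflexive (trans (cong (ρ x ℕ.+_) ρe) (ℕ.+-suc (ρ x) (ρ p))))))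

  private
    joinBelow : ∀ as u → All (_⊑ u) as → foldr _⊔_ bot as ⊑ u
    joinBelow []       u _          = bot-min u
    joinBelow (a ∷ as) u (px ∷ pxs) = lub a _ u px (joinBelow as u pxs)

    joinAbove : ∀ as → All (_⊑ foldr _⊔_ bot as) as
    joinAbove []       = []
    joinAbove (a ∷ as) = ub₁ a _ ∷ All.map (λ le → ⊑-trans le (ub₂ a _)) (joinAbove as)

    someNot : ∀ (as : List (Fin m)) u q → All Atom as → All (_⊑ q) as → ¬ All (_⊑ u) as → ∃ λ a → Atom a × a ⊑ q × ¬ a ⊑ u
    someNot []       u q _          _          none = ⊥-elim (none [])
    someNot (a ∷ as) u q (at ∷ ats) (le ∷ les) none with a ⊑? u
    ... | no a⋢u  = a , at , le , a⋢u
    ... | yes a⊑u = someNot as u q ats les (λ all → none (a⊑u ∷ all))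

  -- Intervals are atomic again: some atom `a` of the lattice lies below `q` but not below `u`, and
  -- `p ⊔ a` is the required atom of `[p, q]`.
  atomOver : ∀ {p u q} → p ⊑ u → p ⊑ q → ¬ q ⊑ u → ∃ λ x → p ⊑ x × x ⊑ q × ρ x ≡ suc (ρ p) × ¬ x ⊑ u
  atomOver {p} {u} {q} p⊑u p⊑q q⋢u with atomic q
  ... | as , atoms , refl with someNot as u q atoms (joinAbove as) (q⋢u ∘ joinBelow as u)
  ...   | a , bot⋖a , a⊑q , a⋢u = p ⊔ a , ub₁ p a , lub p a q p⊑q a⊑q
          , ρ-⊔ (bot-min a) (ρ-cover bot a bot⋖a) (bot-min p) (λ a⊑p → a⋢u (⊑-trans a⊑p p⊑u))
          , λ le → a⋢u (⊑-trans (ub₂ p a) le)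

  Itv : Fin m → Fin m → ℕ → Fin m → Set
  Itv p q k x = p ⊑ x × x ⊑ q × ρ x ≡ k

  itv? : ∀ p q k → Decidable (Itv p q k)
  itv? p q k x = p ⊑? x ×-dec x ⊑? q ×-dec ρ x ℕ.≟ k

  Miss : Fin m → Fin m → Fin m → ℕ → Fin m → Set
  Miss p e q k x = Itv p q k x × ¬ e ⊑ x

  miss? : ∀ p e q k → Decidable (Miss p e q k)
  miss? p e q k x = itv? p q k x ×-dec ¬? (e ⊑? x)

  AtomOf : Fin m → Fin m → Fin m → Set
  AtomOf p q = Itv p q (suc (ρ p))

  -- Climb from `x` to covers `y` not below `x ⊔ e`. One exists as long as `x ⊔ e` is not all of
  -- `q`, which the ranks ensure below `k`; it avoids `e`, since otherwise it would equal `x ⊔ e`.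
  missingHyperplane : ∀ {p e q x} k → AtomOf p q e → p ⊑ x → x ⊑ q → ¬ e ⊑ x → ρ q ≡ suc k → ∃ λ H → Miss x e q k H
  missingHyperplane {p} {e} {q} {x} k at@(p⊑e , e⊑q , ρe) p⊑x x⊑q e⋢x ρq =
    climb (k ℕ.∸ ρ x) p⊑x x⊑q e⋢x (ℕ.m∸n+n≡m ρx≤k)
    where
    ρx≤k : ρ x ℕ.≤ k
    ρx≤k = ℕ.≤-pred (subst (ρ x ℕ.<_) ρq (ρ-strict x⊑q (λ eq → e⋢x (subst (e ⊑_) (sym eq) e⊑q))))
    climb : ∀ d {x} → p ⊑ x → x ⊑ q → ¬ e ⊑ x → d ℕ.+ ρ x ≡ k → ∃ λ H → Miss x e q k H
    climb zero    {x} p⊑x x⊑q e⋢x eq = x , (⊑-refl x , x⊑q , eq) , e⋢x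
    climb (suc d) {x} p⊑x x⊑q e⋢x eq
      with atomOver {x} {x ⊔ e} {q} (ub₁ x e) x⊑q tooSmall
      where
      tooSmall : ¬ q ⊑ (x ⊔ e)
      tooSmall q⊑ = ℕ.<⇒≱ (ℕ.s≤s (ℕ.s≤s (ℕ.m≤n+m (ρ x) d))) (ℕ.≤-trans
        (ℕ.≤-reflexive (sym (trans ρq (cong suc (sym eq))))) (ℕ.≤-trans (ρ-mono q⊑) (ℕ.≤-reflexive (ρ-⊔ p⊑e ρe p⊑x e⋢x))))
    ... | y , x⊑y , y⊑q , ρy , y⋢ with climb d (⊑-trans p⊑x x⊑y) y⊑q e⋢y (trans (cong (d ℕ.+_) ρy) (trans (ℕ.+-suc d (ρ x)) eq))
      where
      e⋢y : ¬ e ⊑ y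
      e⋢y e⊑y = y⋢ (subst (_⊑ (x ⊔ e)) (ρ-inj (lub x e y x⊑y e⊑y) (ℕ.≤-reflexive (trans ρy (sym (ρ-⊔ p⊑e ρe p⊑x e⋢x))))) (⊑-refl _))
    ...   | H , (y⊑H , H⊑q , ρH) , e⋢H = H , (⊑-trans x⊑y y⊑H , H⊑q , ρH) , e⋢H

-- Splitting flag h-numbers by an atom

∑-∑split : ∀ {m} {P : Fin m → Set} (P? : Decidable P) {Φ : Fin m → List Bool → List Bool → ℤ} S
  → ∑ P? (λ x → ∑split (Φ x) S) ≡ ∑split (λ A B → ∑ P? (λ x → Φ x A B)) S
∑-∑split P? []           = ∑-vanish P? (λ _ _ → refl)
∑-∑split P? (false ∷ bs) = ∑-∑split P? bs
∑-∑split P? {Φ} (true ∷ bs)  = trans (∑-+ P? (λ x → Φ x [] bs) (λ x → ∑split (λ A → Φ x (true ∷ A)) bs))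
  (cong (λ z → ∑ P? (λ x → Φ x [] bs) + z) (∑-∑split P? bs))

module Flags {m : ℕ} (L : GeometricLattice m) where

  open Ranked L public

  -- The flag h-number of the interval [p, q]; the list tells which of the ranks t, t + 1, … of L are selected.
  h : Fin m → Fin m → ℕ → List Bool → ℤ
  h p q t []           = 1ℤ
  h p q t (true ∷ bs)  = ∑ (itv? p q t) (λ x → h x q (suc t) bs) - h p q (suc t) bs
  h p q t (false ∷ bs) = h p q (suc t) bs

  ∑-contains : ∀ {p e q} k (φ : Fin m → ℤ)
    → ∑ (itv? p q k) φ ≡ ∑ (itv? (p ⊔ e) q k) φ + ∑ (miss? p e q k) φ
  ∑-contains {p} {e} {q} k φ = trans (∑-split (itv? p q k) (e ⊑?_) φ) (cong (λ z → z + ∑ (miss? p e q k) φ)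
    (∑-⇔ (λ x → itv? p q k x ×-dec e ⊑? x) (itv? (p ⊔ e) q k)
      (λ x ((p⊑x , x⊑q , ρx) , e⊑x) → lub p e x p⊑x e⊑x , x⊑q , ρx)
      (λ x (pe⊑x , x⊑q , ρx) → (⊑-trans (ub₁ p e) pe⊑x , x⊑q , ρx) , ⊑-trans (ub₂ p e) pe⊑x) (λ _ _ → refl)))

  -- F is the last member of the chain not above e.  If the next rank is selected too, the summand vanishes,
  -- since h (F ⊔ e) q (ρ (F ⊔ e)) is 0 on lists starting with true.
  h-split : ∀ e p q t S → h p q t S ≡ h (p ⊔ e) q t S + ∑split (λ A B →
    ∑ (miss? p e q (t ℕ.+ length A)) (λ F → h p F t A * h (F ⊔ e) q (suc (t ℕ.+ length A)) B)) S
  h-split e p q t [] = refl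
  h-split e p q t (false ∷ bs) = trans (h-split e p q (suc t) bs) (cong (λ z → h (p ⊔ e) q (suc t) bs + z)
    (∑split-cong bs (λ A B _ → cong (λ k → ∑ (miss? p e q k) (λ F → h p F (suc t) A * h (F ⊔ e) q (suc k) B))
      (sym (ℕ.+-suc t (length A))))))
  h-split e p q t (true ∷ bs) = begin
    ∑ (itv? p q t) (λ x → h x q (suc t) bs) - h p q (suc t) bs
      ≡⟨ cong₂ _-_ (∑-contains {p} {e} {q} t _) (h-split e p q (suc t) bs) ⟩
    a + ∑ (miss? p e q t) (λ x → h x q (suc t) bs) - (b + s₃)
      -- An `x` of rank `t` avoiding `e` is followed by the splitting of `[x, q]`: either `x` is
      -- itself the last member not above `e`, which gives `c`, or a later `F` is, which gives `s₁`.
      ≡⟨ cong (λ z → a + z - (b + s₃)) (trans (∑-cong (miss? p e q t) (λ x _ → h-split e x q (suc t) bs)) (trans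
           (∑-+ (miss? p e q t) _ _) (cong (λ z → c + z) (∑-∑split (miss? p e q t) bs)))) ⟩
    a + (c + s₁) - (b + s₃)
      ≡⟨ alg a b c s₁ s₃ ⟩
    a - b + (c + (1ℤ * s₁ + 0ℤ * s₁ - s₃))
      ≡⟨ cong₂ (λ y z → a - b + (y + z)) headTerm (sym (∑split-lin 1ℤ 0ℤ {Φ₂ = Φ₁} bs pointwise)) ⟩
    a - b + ∑split (λ A B → ∑ (miss? p e q (t ℕ.+ length A)) (λ F → h p F t A * h (F ⊔ e) q (suc (t ℕ.+ length A)) B)) (true ∷ bs) ∎
    where
    open ≡-Reasoning
    Φ : Fin m → List Bool → List Bool → ℤ
    Φ x A B = ∑ (miss? x e q (suc t ℕ.+ length A)) (λ F → h x F (suc t) A * h (F ⊔ e) q (suc (suc t ℕ.+ length A)) B)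
    Φ₁ : List Bool → List Bool → ℤ
    Φ₁ A B = ∑ (miss? p e q t) (λ x → Φ x A B)
    a = ∑ (itv? (p ⊔ e) q t) (λ x → h x q (suc t) bs)
    b = h (p ⊔ e) q (suc t) bs
    c = ∑ (miss? p e q t) (λ x → h (x ⊔ e) q (suc t) bs)
    s₁ = ∑split Φ₁ bs
    s₃ = ∑split (Φ p) bs
    alg : ∀ a b c s t → a + (c + s) - (b + t) ≡ a - b + (c + (1ℤ * s + 0ℤ * s - t))
    alg = solve-∀
    headTerm : c ≡ ∑ (miss? p e q (t ℕ.+ 0)) (λ F → 1ℤ * h (F ⊔ e) q (suc (t ℕ.+ 0)) bs)
    headTerm rewrite ℕ.+-identityʳ t = ∑-cong (miss? p e q t) (λ F _ → sym (*-identityˡ (h (F ⊔ e) q (suc t) bs)))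
    pointwise : ∀ A B → length A ℕ.+ suc (length B) ≡ length bs →
      ∑ (miss? p e q (t ℕ.+ suc (length A))) (λ F → h p F t (true ∷ A) * h (F ⊔ e) q (suc (t ℕ.+ suc (length A))) B)
      ≡ 1ℤ * Φ₁ A B + 0ℤ * Φ₁ A B - Φ p A B
    pointwise A B _ rewrite ℕ.+-suc t (length A) = begin
      ∑ M? (λ F → (∑ (itv? p F t) (λ x → h x F (suc t) A) - h p F (suc t) A) * U F)
        ≡⟨ ∑-cong M? (λ F _ → trans (dist (∑ (itv? p F t) (λ x → h x F (suc t) A)) (h p F (suc t) A) (U F))
             (cong (λ z → z - h p F (suc t) A * U F) (sym (∑-*ʳ (itv? p F t) (U F) (λ x → h x F (suc t) A))))) ⟩
      ∑ M? (λ F → ∑ (itv? p F t) (λ x → h x F (suc t) A * U F) - h p F (suc t) A * U F)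
        ≡⟨ ∑-- M? (λ F → ∑ (itv? p F t) (λ x → h x F (suc t) A * U F)) (λ F → h p F (suc t) A * U F) ⟩
      ∑ M? (λ F → ∑ (itv? p F t) (λ x → h x F (suc t) A * U F)) - Φ p A B
        -- Exchange the first member `x` of the chain with `F`. As `x ⊑ F`, it avoids `e` whenever
        -- `F` does.
        ≡⟨ cong (λ z → z - Φ p A B) (∑-swap M? (λ F → itv? p F t) (miss? p e q t) (λ x → miss? x e q (suc t ℕ.+ length A))
             (λ F x ((p⊑F , F⊑q , ρF) , e⋢F) (p⊑x , x⊑F , ρx) →
               ((p⊑x , ⊑-trans x⊑F F⊑q , ρx) , λ e⊑x → e⋢F (⊑-trans e⊑x x⊑F)) , ((x⊑F , F⊑q , ρF) , e⋢F))
             (λ F x ((p⊑x , x⊑q , ρx) , _) ((x⊑F , F⊑q , ρF) , e⋢F) →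
               ((⊑-trans p⊑x x⊑F , F⊑q , ρF) , e⋢F) , (p⊑x , x⊑F , ρx))) ⟩
      Φ₁ A B - Φ p A B
        ≡⟨ one (Φ₁ A B) (Φ p A B) ⟩
      1ℤ * Φ₁ A B + 0ℤ * Φ₁ A B - Φ p A B ∎
      where
      M? = miss? p e q (suc t ℕ.+ length A)
      U : Fin m → ℤ
      U F = h (F ⊔ e) q (suc (suc t ℕ.+ length A)) B
      dist : ∀ a b c → (a - b) * c ≡ a * c - b * c
      dist = solve-∀
      one : ∀ a b → a - b ≡ 1ℤ * a + 0ℤ * a - b
      one = solve-∀

-- Atoms of intervals and flats avoiding an atom

module AtomCounts {m : ℕ} (L : GeometricLattice m) where

  open Ranked L

  at : Fin m → Fin m → ℤ
  at p q = ∑ (itv? p q (suc (ρ p))) (λ _ → 1ℤ)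

  N : Fin m → Fin m → Fin m → ℕ → ℤ
  N p e q k = ∑ (miss? p e q k) (λ _ → 1ℤ)

  -- The sum of |l| - 2 over the lines l of [p, q] through e, where |l| = at p l = N p e l (ρ e) + 1.
  τ : Fin m → Fin m → Fin m → ℤ
  τ p e q = ∑ (itv? e q (suc (ρ e))) (λ l → N p e l (ρ e) - 1ℤ)

  restrict : ∀ {p e q G} → AtomOf p q e → e ⊑ G → AtomOf p G e
  restrict (p⊑e , _ , ρe) e⊑G = p⊑e , e⊑G , ρe

  atom⋢base : ∀ {p q e} → AtomOf p q e → ¬ e ⊑ p
  atom⋢base (p⊑e , _ , ρe) e⊑p = ℕ.<⇒≱ (ℕ.≤-reflexive (sym ρe)) (ρ-mono e⊑p)

  joinAtom : ∀ {p q e x k} → AtomOf p q e → Miss p e q k x → Itv e q (suc k) (x ⊔ e)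
  joinAtom {p} {q} {e} {x} (p⊑e , e⊑q , ρe) ((p⊑x , x⊑q , ρx) , e⋢x) =
    ub₂ x e , lub x e q x⊑q e⊑q , trans (ρ-⊔ p⊑e ρe p⊑x e⋢x) (cong suc ρx)

  join-unique : ∀ {p q e x y k} → AtomOf p q e → Miss p e q k x → x ⊑ y → e ⊑ y → ρ y ≡ suc k → y ≡ x ⊔ e
  join-unique {x = x} {y} at M x⊑y e⊑y ρy = sym (ρ-inj (lub _ _ y x⊑y e⊑y)
    (ℕ.≤-reflexive (trans ρy (sym (proj₂ (proj₂ (joinAtom at M)))))))

  -- For a flat x avoiding the atom e, x ⊔ e is the only G above x and e of rank one more.
  ∑-fibres : ∀ {p q e} → AtomOf p q e → ∀ k φ
    → ∑ (miss? p e q k) φ ≡ ∑ (itv? e q (suc k)) (λ G → ∑ (miss? p e G k) φ)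
  ∑-fibres {p} {q} {e} at k φ = sym (begin
    ∑ (itv? e q (suc k)) (λ G → ∑ (miss? p e G k) φ)
      ≡⟨ ∑-swap (itv? e q (suc k)) (λ G → miss? p e G k) (miss? p e q k) (λ x → itv? (x ⊔ e) q (suc k))
           (λ G x (e⊑G , G⊑q , ρG) ((p⊑x , x⊑G , ρx) , e⋢x) →
             ((p⊑x , ⊑-trans x⊑G G⊑q , ρx) , e⋢x) , (lub x e G x⊑G e⊑G , G⊑q , ρG))
           (λ G x ((p⊑x , x⊑q , ρx) , e⋢x) (xe⊑G , G⊑q , ρG) →
             (⊑-trans (ub₂ x e) xe⊑G , G⊑q , ρG) , ((p⊑x , ⊑-trans (ub₁ x e) xe⊑G , ρx) , e⋢x)) ⟩
    ∑ (miss? p e q k) (λ x → ∑ (itv? (x ⊔ e) q (suc k)) (λ _ → φ x))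
      ≡⟨ ∑-cong (miss? p e q k) (λ x M → ∑-single (itv? (x ⊔ e) q (suc k)) (x ⊔ e)
           (let (_ , xe⊑q , ρxe) = joinAtom at M in ⊑-refl _ , xe⊑q , ρxe)
           (λ G (xe⊑G , G⊑q , ρG) → join-unique at M (⊑-trans (ub₁ x e) xe⊑G) (⊑-trans (ub₂ x e) xe⊑G) ρG)) ⟩
    ∑ (miss? p e q k) φ ∎)
    where open ≡-Reasoning

  ∑-splitAtom : ∀ {p q e} → AtomOf p q e → ∀ k φ → ∑ (itv? p q k) φ ≡ ∑ (itv? e q k) φ + ∑ (miss? p e q k) φ
  ∑-splitAtom {p} {q} {e} (p⊑e , _ , _) k φ = trans (∑-split (itv? p q k) (e ⊑?_) φ) (cong (λ z → z + ∑ (miss? p e q k) φ)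
    (∑-⇔ (λ x → itv? p q k x ×-dec e ⊑? x) (itv? e q k)
      (λ x ((p⊑x , x⊑q , ρx) , e⊑x) → e⊑x , x⊑q , ρx)
      (λ x (e⊑x , x⊑q , ρx) → (⊑-trans p⊑e e⊑x , x⊑q , ρx) , e⊑x) (λ _ _ → refl)))

  ∑-bottom : ∀ {p q} φ → p ⊑ q → ∑ (itv? p q (ρ p)) φ ≡ φ p
  ∑-bottom {p} {q} φ p⊑q = ∑-single (itv? p q (ρ p)) p (⊑-refl p , p⊑q , refl)
    (λ x (p⊑x , _ , ρx) → sym (ρ-inj p⊑x (ℕ.≤-reflexive ρx)))

  ∑-top : ∀ {p q} φ → p ⊑ q → ∑ (itv? p q (ρ q)) φ ≡ φ q
  ∑-top {p} {q} φ p⊑q = ∑-single (itv? p q (ρ q)) q (p⊑q , ⊑-refl q , refl)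
    (λ x (_ , x⊑q , ρx) → ρ-inj x⊑q (ℕ.≤-reflexive (sym ρx)))

  ∑-pairs : ∀ p q j k (φ ψ : Fin m → ℤ) → ∑ (itv? p q k) (λ G → φ G * ∑ (itv? p G j) ψ)
    ≡ ∑ (itv? p q j) (λ l → ψ l * ∑ (itv? l q k) φ)
  ∑-pairs p q j k φ ψ = begin
    ∑ (itv? p q k) (λ G → φ G * ∑ (itv? p G j) ψ)
      ≡⟨ ∑-cong (itv? p q k) (λ G _ → sym (∑-* (itv? p G j) (φ G) ψ)) ⟩
    ∑ (itv? p q k) (λ G → ∑ (itv? p G j) (λ l → φ G * ψ l))
      ≡⟨ ∑-swap (itv? p q k) (λ G → itv? p G j) (itv? p q j) (λ l → itv? l q k)
           (λ G l (p⊑G , G⊑q , ρG) (p⊑l , l⊑G , ρl) → (p⊑l , ⊑-trans l⊑G G⊑q , ρl) , (l⊑G , G⊑q , ρG))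
           (λ G l (p⊑l , l⊑q , ρl) (l⊑G , G⊑q , ρG) → (⊑-trans p⊑l l⊑G , G⊑q , ρG) , (p⊑l , l⊑G , ρl)) ⟩
    ∑ (itv? p q j) (λ l → ∑ (itv? l q k) (λ G → φ G * ψ l))
      ≡⟨ ∑-cong (itv? p q j) (λ l _ → trans (∑-*ʳ (itv? l q k) (ψ l) φ) (*-comm (∑ (itv? l q k) φ) (ψ l))) ⟩
    ∑ (itv? p q j) (λ l → ψ l * ∑ (itv? l q k) φ) ∎
    where open ≡-Reasoning

  1≤N : ∀ {p q e k} → AtomOf p q e → ρ q ≡ suc k → 1ℤ ≤ℤ N p e q k
  1≤N {p} {q} {e} {k} at@(p⊑e , e⊑q , _) ρq =
    let (H , M) = missingHyperplane k at (⊑-refl p) (⊑-trans p⊑e e⊑q) (atom⋢base at) ρq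
    in ∑-member (miss? p e q k) H M (λ _ _ → 0≤pos 1)

  0≤τ-term : ∀ {p q e l} → AtomOf p q e → Itv e q (suc (ρ e)) l → 0ℤ ≤ℤ N p e l (ρ e) - 1ℤ
  0≤τ-term at (e⊑l , _ , ρl) = i≤j⇒0≤j-i (1≤N (restrict at e⊑l) ρl)

  0≤τ : ∀ {p q e} → AtomOf p q e → 0ℤ ≤ℤ τ p e q
  0≤τ {p} {q} {e} at = ∑-nonneg (itv? e q (suc (ρ e))) (λ l I → 0≤τ-term at I)

  -- The atoms other than `e` are partitioned by the lines joining them to `e`, and these lines are
  -- the atoms of `[e, q]`. Taking one atom from each line leaves `|l| - 2` on each.
  at-split : ∀ {p q e} → AtomOf p q e → at p q ≡ 1ℤ + at e q + τ p e q
  at-split {p} {q} {e} A@(p⊑e , e⊑q , ρe) = begin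
    ∑ (itv? p q (suc (ρ p))) one  ≡⟨ cong (λ k → ∑ (itv? p q k) one) (sym ρe) ⟩
    ∑ (itv? p q (ρ e)) one        ≡⟨ ∑-splitAtom A (ρ e) one ⟩
    ∑ (itv? e q (ρ e)) one + N p e q (ρ e) ≡⟨ cong₂ _+_ (∑-bottom one e⊑q) (∑-fibres A (ρ e) one) ⟩
    1ℤ + ∑ I? (λ l → N p e l (ρ e)) ≡⟨ cong (λ z → 1ℤ + z) (trans (∑-cong I? (λ l _ → shift (N p e l (ρ e)))) (∑-+ I? one (λ l → N p e l (ρ e) - 1ℤ))) ⟩
    1ℤ + (at e q + τ p e q)       ≡⟨ assoc (at e q) (τ p e q) ⟩
    1ℤ + at e q + τ p e q ∎
    where
    open ≡-Reasoning
    one : Fin m → ℤ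
    one _ = 1ℤ
    I? = itv? e q (suc (ρ e))
    shift : ∀ x → x ≡ 1ℤ + (x - 1ℤ)
    shift = solve-∀
    assoc : ∀ x y → 1ℤ + (x + y) ≡ 1ℤ + x + y
    assoc = solve-∀

  someAtom : ∀ {p q} d → p ⊑ q → ρ q ≡ suc d ℕ.+ ρ p → ∃ λ e → AtomOf p q e
  someAtom {p} {q} d p⊑q ρq with atomOver (⊑-refl p) p⊑q
    (λ q⊑p → ℕ.<⇒≱ (ℕ.s≤s (ℕ.m≤n+m (ρ p) d)) (subst (ℕ._≤ ρ p) ρq (ρ-mono q⊑p)))
  ... | x , p⊑x , x⊑q , ρx , _ = x , p⊑x , x⊑q , ρx

  corank : ∀ {p q e d} → AtomOf p q e → ρ q ≡ suc d ℕ.+ ρ p → ρ q ≡ d ℕ.+ ρ e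
  corank {p} {d = d} (_ , _ , ρe) ρq = trans ρq (trans (sym (ℕ.+-suc d (ρ p))) (cong (d ℕ.+_) (sym ρe)))

  rank≤at : ∀ {p q} d → p ⊑ q → ρ q ≡ d ℕ.+ ρ p → + d ≤ℤ at p q
  rank≤at {p} {q} zero    p⊑q ρq = ∑-nonneg (itv? p q (suc (ρ p))) (λ _ _ → 0≤pos 1)
  rank≤at {p} {q} (suc d) p⊑q ρq with someAtom d p⊑q ρq
  ... | e , A@(p⊑e , e⊑q , ρe) = subst (+ suc d ≤ℤ_) (sym (at-split A))
    (≤-trans (≤-reflexive (sym (+-identityʳ (+ suc d))))
      (+-mono-≤ (+-mono-≤ (≤-refl {1ℤ}) (rank≤at d e⊑q (corank A ρq))) (0≤τ A)))

  at-rank0 : ∀ {p q} → p ⊑ q → ρ q ≡ ρ p → at p q ≡ 0ℤ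
  at-rank0 {p} {q} p⊑q ρq = ∑-empty (itv? p q (suc (ρ p)))
    (λ x (_ , x⊑q , ρx) → ℕ.<⇒≱ (ℕ.≤-reflexive (sym ρx)) (subst (ρ x ℕ.≤_) ρq (ρ-mono x⊑q)))

  at-rank1 : ∀ {p q} → p ⊑ q → ρ q ≡ suc (ρ p) → at p q ≡ 1ℤ
  at-rank1 {p} {q} p⊑q ρq = trans (cong (λ k → ∑ (itv? p q k) (λ _ → 1ℤ)) (sym ρq)) (∑-top (λ _ → 1ℤ) p⊑q)

  line-span : ∀ {p l y y′ H} → AtomOf p l y → AtomOf p l y′ → ρ l ≡ suc (suc (ρ p)) → y ≢ y′ → y ⊑ H → y′ ⊑ H → l ⊑ H
  line-span {p} {l} {y} {y′} {H} (p⊑y , y⊑l , ρy) (p⊑y′ , y′⊑l , ρy′) ρl y≢y′ y⊑H y′⊑H = subst (_⊑ H)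
    (ρ-inj (lub y y′ l y⊑l y′⊑l) (ℕ.≤-reflexive (trans ρl (trans (cong suc (sym ρy)) (sym (ρ-⊔ p⊑y′ ρy′ p⊑y y′⋢y))))))
    (lub y y′ H y⊑H y′⊑H)
    where
    y′⋢y : ¬ y′ ⊑ y
    y′⋢y y′⊑y = y≢y′ (sym (ρ-inj y′⊑y (ℕ.≤-reflexive (trans ρy (sym ρy′)))))

  line-atMostOne : ∀ {p l H} {P : Fin m → Set} (P? : Decidable P) → (∀ y → P y → AtomOf p l y)
    → ρ l ≡ suc (suc (ρ p)) → ¬ l ⊑ H → ∑ (λ y → P? y ×-dec y ⊑? H) (λ _ → 1ℤ) ≤ℤ 1ℤ
  line-atMostOne {H = H} {P} P? atoms ρl l⋢H with any? (λ y → P? y ×-dec y ⊑? H)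
  ... | no none = ≤-trans (≤-reflexive (∑-empty (λ y → P? y ×-dec y ⊑? H) (λ y Py → none (y , Py)))) (0≤pos 1)
  ... | yes (y , Py , y⊑H) = ≤-reflexive (∑-single (λ y → P? y ×-dec y ⊑? H) y (Py , y⊑H) unique)
    where
    unique : ∀ y′ → P y′ × y′ ⊑ H → y′ ≡ y
    unique y′ (Py′ , y′⊑H) with y′ Fin.≟ y
    ... | yes eq = eq
    ... | no ne  = ⊥-elim (l⋢H (line-span (atoms y′ Py′) (atoms y Py) ρl ne y′⊑H y⊑H))

  -- Every other line through x lies in a hyperplane avoiding l.
  τ-offLine : ∀ {p q x l k} → AtomOf p q x → AtomOf x q l → ρ q ≡ suc k
    → τ p x q ≤ℤ (N p x l (ρ x) - 1ℤ) + ∑ (miss? x l q k) (τ p x)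
  τ-offLine {p} {q} {x} {l} {k} X X→l@(x⊑l , l⊑q , ρl) ρq = ≤-trans (≤-reflexive τ-line)
    (+-mono-≤ (≤-refl {ω l}) (≤-trans (∑-mono J? (λ l′ (I , l⋢l′) → term l′ I l⋢l′)) (≤-reflexive (sym swap))))
    where
    ω : Fin m → ℤ
    ω l′ = N p x l′ (ρ x) - 1ℤ
    I? = itv? x q (suc (ρ x))
    J? : Decidable (λ l′ → Itv x q (suc (ρ x)) l′ × ¬ l ⊑ l′)
    J? l′ = I? l′ ×-dec ¬? (l ⊑? l′)
    τ-line : τ p x q ≡ ω l + ∑ J? ω
    τ-line = trans (∑-split I? (l ⊑?_) ω) (cong (λ z → z + ∑ J? ω)
      (∑-single (λ l′ → I? l′ ×-dec l ⊑? l′) l (X→l , ⊑-refl l)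
        (λ l′ ((_ , _ , ρl′) , l⊑l′) → sym (ρ-inj l⊑l′ (ℕ.≤-reflexive (trans ρl′ (sym ρl)))))))
    term : ∀ l′ → Itv x q (suc (ρ x)) l′ → ¬ l ⊑ l′ → ω l′ ≤ℤ ∑ (miss? l′ l q k) (λ _ → ω l′)
    term l′ I@(x⊑l′ , l′⊑q , _) l⋢l′ =
      let (H , M) = missingHyperplane k X→l x⊑l′ l′⊑q l⋢l′ ρq
      in ∑-member (miss? l′ l q k) {λ _ → ω l′} H M (λ _ _ → 0≤τ-term X I)
    swap : ∑ (miss? x l q k) (τ p x) ≡ ∑ J? (λ l′ → ∑ (miss? l′ l q k) (λ _ → ω l′))
    swap = ∑-swap (miss? x l q k) (λ H → itv? x H (suc (ρ x))) J? (λ l′ → miss? l′ l q k)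
      (λ H l′ ((x⊑H , H⊑q , ρH) , l⋢H) (x⊑l′ , l′⊑H , ρl′) →
        ((x⊑l′ , ⊑-trans l′⊑H H⊑q , ρl′) , λ l⊑l′ → l⋢H (⊑-trans l⊑l′ l′⊑H)) , ((l′⊑H , H⊑q , ρH) , l⋢H))
      (λ H l′ ((x⊑l′ , l′⊑q , ρl′) , _) ((l′⊑H , H⊑q , ρH) , l⋢H) →
        ((⊑-trans x⊑l′ l′⊑H , H⊑q , ρH) , l⋢H) , (x⊑l′ , l′⊑H , ρl′))

  -- Each H avoiding e contains at most one atom of the line l = x ⊔ e, so the hyperplanes through x and
  -- those through the other atoms of l give disjoint contributions.
  ∑-missing-at : ∀ {p q e} r → AtomOf p q e → ρ q ≡ suc r ℕ.+ ρ p
    → at p q - + r ≤ℤ ∑ (miss? p e q (r ℕ.+ ρ p)) (λ H → at p H - + r + 1ℤ)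
  ∑-missing-at {p} {q} {e} zero A@(p⊑e , e⊑q , ρe) ρq = ≤-trans
    (≤-reflexive (cong (λ z → z - 0ℤ) (at-rank1 (⊑-trans p⊑e e⊑q) ρq)))
    (∑-mem (at-rank0 (⊑-refl p) refl))
    where
    nn : ∀ H → Miss p e q (ρ p) H → 0ℤ ≤ℤ at p H - 0ℤ + 1ℤ
    nn H ((p⊑H , _ , ρH) , _) = subst (λ z → 0ℤ ≤ℤ z - 0ℤ + 1ℤ) (sym (at-rank0 p⊑H ρH)) (0≤pos 1)
    ∑-mem : at p p ≡ 0ℤ → 1ℤ ≤ℤ ∑ (miss? p e q (ρ p)) (λ H → at p H - 0ℤ + 1ℤ)
    ∑-mem eq = ≤-trans (≤-reflexive (cong (λ z → z - 0ℤ + 1ℤ) (sym eq)))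
      (∑-member (miss? p e q (ρ p)) p ((⊑-refl p , ⊑-trans p⊑e e⊑q , refl) , atom⋢base A) nn)
  ∑-missing-at {p} {q} {e} (suc r) A@(p⊑e , e⊑q , ρe) ρq with atomOver p⊑e (⊑-trans p⊑e e⊑q)
    (λ q⊑e → ℕ.<⇒≱ (ℕ.s≤s (ℕ.s≤s (ℕ.m≤n+m (ρ p) r))) (subst₂ ℕ._≤_ ρq ρe (ρ-mono q⊑e)))
  ... | x , p⊑x , x⊑q , ρx , x⋢e = begin
    at p q - + suc r
      ≡⟨ trans (cong (λ z → z - + suc r) (at-split X)) (alg₁ (at x q) (τ p x q) (+ r)) ⟩
    (at x q - + r) + τ p x q
      ≤⟨ +-mono-≤ (∑-missing-at r X→l ρq′) (τ-offLine X X→l ρq′) ⟩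
    ∑ M? (λ H → at x H - + r + 1ℤ) + (ω + ∑ M? (τ p x))
      ≡⟨ alg₃ (∑ M? (λ H → at x H - + r + 1ℤ)) ω (∑ M? (τ p x)) ⟩
    (∑ M? (λ H → at x H - + r + 1ℤ) + ∑ M? (τ p x)) + ω
      ≤⟨ ℤ.+-monoʳ-≤ (∑ M? (λ H → at x H - + r + 1ℤ) + ∑ M? (τ p x)) onLine≤ ⟩
    (∑ M? (λ H → at x H - + r + 1ℤ) + ∑ M? (τ p x)) + ∑ M′? (λ H → at p H - + suc r + 1ℤ)
      ≡⟨ cong (λ z → z + ∑ M′? (λ H → at p H - + suc r + 1ℤ)) through-x ⟩
    ∑ (λ H → miss? p e q k H ×-dec x ⊑? H) (λ H → at p H - + suc r + 1ℤ) + ∑ M′? (λ H → at p H - + suc r + 1ℤ)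
      ≡⟨ sym (∑-split (miss? p e q k) (x ⊑?_) (λ H → at p H - + suc r + 1ℤ)) ⟩
    ∑ (miss? p e q k) (λ H → at p H - + suc r + 1ℤ) ∎
    where
    open ℤ.≤-Reasoning
    k = suc r ℕ.+ ρ p
    X : AtomOf p q x
    X = p⊑x , x⊑q , ρx
    l = x ⊔ e
    e⋢x : ¬ e ⊑ x
    e⋢x e⊑x = x⋢e (subst (x ⊑_) (sym (ρ-inj e⊑x (ℕ.≤-reflexive (trans ρx (sym ρe))))) (⊑-refl x))
    ρl : ρ l ≡ suc (ρ x)
    ρl = ρ-⊔ p⊑e ρe p⊑x e⋢x
    X→l : AtomOf x q l
    X→l = ub₁ x e , lub x e q x⊑q e⊑q , ρl
    ρq′ : ρ q ≡ suc r ℕ.+ ρ x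
    ρq′ = corank X ρq
    k≡ : r ℕ.+ ρ x ≡ k
    k≡ = trans (cong (r ℕ.+_) ρx) (ℕ.+-suc r (ρ p))
    M? = miss? x l q (r ℕ.+ ρ x)
    M′? : Decidable (λ H → Miss p e q k H × ¬ x ⊑ H)
    M′? H = miss? p e q k H ×-dec ¬? (x ⊑? H)
    ω : ℤ
    ω = N p x l (ρ x) - 1ℤ
    alg₁ : ∀ a t r → 1ℤ + a + t - (1ℤ + r) ≡ (a - r) + t
    alg₁ = solve-∀
    alg₃ : ∀ a b c → a + (b + c) ≡ (a + c) + b
    alg₃ = solve-∀
    through-x : ∑ M? (λ H → at x H - + r + 1ℤ) + ∑ M? (τ p x)
      ≡ ∑ (λ H → miss? p e q k H ×-dec x ⊑? H) (λ H → at p H - + suc r + 1ℤ)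
    -- A hyperplane through `x` avoids `e` exactly when it avoids `l`. By `at-split` at `x`, the
    -- atoms of `H` are then accounted for by `at x H` and `τ p x H`.
    through-x = trans (sym (∑-+ M? (λ H → at x H - + r + 1ℤ) (τ p x)))
      (∑-⇔ M? (λ H → miss? p e q k H ×-dec x ⊑? H)
        (λ H ((x⊑H , H⊑q , ρH) , l⋢H) →
          ((⊑-trans p⊑x x⊑H , H⊑q , trans ρH k≡) , λ e⊑H → l⋢H (lub x e H x⊑H e⊑H)) , x⊑H)
        (λ H (((_ , H⊑q , ρH) , e⋢H) , x⊑H) → (x⊑H , H⊑q , trans ρH (sym k≡)) , λ l⊑H → e⋢H (⊑-trans (ub₂ x e) l⊑H))
        (λ H ((x⊑H , H⊑q , ρH) , _) → trans (alg₂ (at x H) (τ p x H) (+ r))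
          (cong (λ z → z - + suc r + 1ℤ) (sym (at-split (restrict X x⊑H))))))
      where
      alg₂ : ∀ a t r → a - r + 1ℤ + t ≡ 1ℤ + a + t - (1ℤ + r) + 1ℤ
      alg₂ = solve-∀
    Y? : Decidable (λ y → Miss p x l (ρ x) y × ¬ e ⊑ y)
    Y? y = miss? p x l (ρ x) y ×-dec ¬? (e ⊑? y)
    ω-line : ω ≡ ∑ Y? (λ _ → 1ℤ)
    ω-line = trans (cong (λ z → z - 1ℤ) (trans (∑-split (miss? p x l (ρ x)) (e ⊑?_) (λ _ → 1ℤ))
      (cong (λ z → z + ∑ Y? (λ _ → 1ℤ)) (∑-single (λ y → miss? p x l (ρ x) y ×-dec e ⊑? y) e
        (((p⊑e , ub₂ x e , trans ρe (sym ρx)) , x⋢e) , ⊑-refl e)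
        (λ y (((_ , _ , ρy) , _) , e⊑y) → sym (ρ-inj e⊑y (ℕ.≤-reflexive (trans ρy (trans ρx (sym ρe))))))))))
      (cancel (∑ Y? (λ _ → 1ℤ)))
      where
      cancel : ∀ z → 1ℤ + z - 1ℤ ≡ z
      cancel = solve-∀
    onLine≤ : ω ≤ℤ ∑ M′? (λ H → at p H - + suc r + 1ℤ)
    -- `ω` counts the atoms `y` of `l` besides `x` and `e`. Each lies in a hyperplane avoiding `e`;
    -- this cannot contain `x` too, or it would contain `l`. Its weight is at least 1 by `rank≤at`.
    onLine≤ = begin
      ω                                             ≡⟨ ω-line ⟩
      ∑ Y? (λ _ → 1ℤ)                               ≤⟨ ∑-mono Y? hyper ⟩
      ∑ Y? (λ y → ∑ (miss? y e q k) (λ _ → 1ℤ))     ≡⟨ sym swap ⟩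
      ∑ M′? (λ H → ∑ (YH? H) (λ _ → 1ℤ))            ≤⟨ ∑-mono M′? (λ H (M , x⋢H) → ≤-trans
        (line-atMostOne Y? Y-atoms ρl₂ (λ l⊑H → x⋢H (⊑-trans (ub₁ x e) l⊑H))) (large H M)) ⟩
      ∑ M′? (λ H → at p H - + suc r + 1ℤ)           ∎
      where
      ρl₂ : ρ l ≡ suc (suc (ρ p))
      ρl₂ = trans ρl (cong suc ρx)
      YH? : ∀ H → Decidable (λ y → (Miss p x l (ρ x) y × ¬ e ⊑ y) × y ⊑ H)
      YH? H y = Y? y ×-dec y ⊑? H
      Y-atoms : ∀ y → Miss p x l (ρ x) y × ¬ e ⊑ y → AtomOf p l y
      Y-atoms y (((p⊑y , y⊑l , ρy) , _) , _) = p⊑y , y⊑l , trans ρy ρx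
      hyper : ∀ y → Miss p x l (ρ x) y × ¬ e ⊑ y → 1ℤ ≤ℤ ∑ (miss? y e q k) (λ _ → 1ℤ)
      hyper y (((p⊑y , y⊑l , _) , _) , e⋢y) =
        let (H , M) = missingHyperplane k A p⊑y (⊑-trans y⊑l (lub x e q x⊑q e⊑q)) e⋢y ρq
        in ∑-member (miss? y e q k) H M (λ _ _ → 0≤pos 1)
      swap : ∑ M′? (λ H → ∑ (YH? H) (λ _ → 1ℤ)) ≡ ∑ Y? (λ y → ∑ (miss? y e q k) (λ _ → 1ℤ))
      swap = ∑-swap M′? YH? Y? (λ y → miss? y e q k)
        (λ H y (((_ , H⊑q , ρH) , e⋢H) , _) (Yy , y⊑H) → Yy , ((y⊑H , H⊑q , ρH) , e⋢H))
        (λ H y Yy@((((p⊑y , _ , _) , _)) , _) ((y⊑H , H⊑q , ρH) , e⋢H) →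
          (((⊑-trans p⊑y y⊑H , H⊑q , ρH) , e⋢H) , 
            λ x⊑H → e⋢H (⊑-trans (ub₂ x e) (line-span (Y-atoms y Yy) (p⊑x , ub₁ x e , ρx) ρl₂
              (λ y≡x → proj₂ (proj₁ Yy) (subst (x ⊑_) (sym y≡x) (⊑-refl x))) y⊑H x⊑H))) , (Yy , y⊑H))
      large : ∀ H → Miss p e q k H → 1ℤ ≤ℤ at p H - + suc r + 1ℤ
      large H ((p⊑H , _ , ρH) , _) = ≤-by (i≤j⇒0≤j-i (rank≤at (suc r) p⊑H ρH)) (alg₄ (at p H) (+ suc r))
        where
        alg₄ : ∀ a r → a - r + 1ℤ - 1ℤ ≡ a - r
        alg₄ = solve-∀

-- Hyperplanes avoiding an atom

-- Gaussian elimination without division. A row `R` with nonzero first entry serves as pivot, and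
-- every other row is replaced by a combination with the pivot row in which the first unknown
-- cancels. A solution `g` of the reduced system is scaled by `R zero`, so that the first unknown
-- can be the integer `- ∑ R g`.
homogeneous : ∀ n (rows : List (Fin n → ℤ)) → length rows ℕ.< n
  → ∃ λ (f : Fin n → ℤ) → (∃ λ x → f x ≢ 0ℤ) × All (λ row → ∑F (λ x → row x * f x) ≡ 0ℤ) rows
homogeneous (suc n) rows len with pivot rows
  where
  pivot : (rows : List (Fin (suc n) → ℤ)) → All (λ r → r zero ≡ 0ℤ) rows
    ⊎ ∃ λ R → ∃ λ rs → R zero ≢ 0ℤ × suc (length rs) ≡ length rows
        × (∀ {P : (Fin (suc n) → ℤ) → Set} → P R → All P rs → All P rows)
  pivot [] = inj₁ []
  pivot (r ∷ rows) with r zero ℤ.≟ 0ℤ | pivot rows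
  ... | no r≢0  | _ = inj₂ (r , rows , r≢0 , refl , _∷_)
  ... | yes r≡0 | inj₁ all = inj₁ (r≡0 ∷ all)
  ... | yes r≡0 | inj₂ (R , rs , R≢0 , eq , re) =
    inj₂ (R , r ∷ rs , R≢0 , cong suc eq , λ { pR (pr ∷ prs) → pr ∷ re pR prs })
... | inj₁ all = f , (zero , λ ()) , All.map (λ {r} → solves r) all
  where
  f : Fin (suc n) → ℤ
  f zero    = 1ℤ
  f (suc _) = 0ℤ
  solves : ∀ (r : Fin (suc n) → ℤ) → r zero ≡ 0ℤ → ∑F (λ x → r x * f x) ≡ 0ℤ
  solves r r≡0 = trans (∑F-suc (λ x → r x * f x)) (cong₂ _+_ (cong (λ z → z * 1ℤ) r≡0) (∑F-zero (λ x → *-zeroʳ (r (suc x)))))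
... | inj₂ (R , rs , R≢0 , eq , reassemble)
  with homogeneous n (map (λ r x → R zero * r (suc x) - r zero * R (suc x)) rs)
         (subst (ℕ._< n) (sym (length-map _ rs)) (ℕ.≤-pred (subst (ℕ._< suc n) (sym eq) len)))
...   | g , (y , gy≢0) , all = f , (suc y , fy≢0) , reassemble {λ r → ∑F (λ x → r x * f x) ≡ 0ℤ} (trans (expand R) (alg₁ c s)) 
      (All.map {P = λ r → ∑F (λ x → (c * r (suc x) - r zero * R (suc x)) * g x) ≡ 0ℤ} {Q = λ r → ∑F (λ x → r x * f x) ≡ 0ℤ}
        (λ {r} → solves r) (All.map⁻ all))
  where
  c s : ℤ
  c = R zero
  s = ∑F (λ x → R (suc x) * g x)
  f : Fin (suc n) → ℤ
  f zero    = - s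
  f (suc x) = c * g x
  fy≢0 : c * g y ≢ 0ℤ
  fy≢0 e = [ R≢0 , gy≢0 ]′ (ℤ.i*j≡0⇒i≡0∨j≡0 c e)
  alg₁ : ∀ c s → c * (- s) + c * s ≡ 0ℤ
  alg₁ = solve-∀
  alg₂ : ∀ c a b → a * (c * b) ≡ c * (a * b)
  alg₂ = solve-∀
  alg₃ : ∀ c a b d g → (c * a - b * d) * g ≡ c * (a * g) + (- b) * (d * g)
  alg₃ = solve-∀
  alg₄ : ∀ b s x → b * (- s) + x ≡ x + (- b) * s
  alg₄ = solve-∀
  expand : ∀ r → ∑F (λ x → r x * f x) ≡ r zero * (- s) + c * ∑F (λ x → r (suc x) * g x)
  expand r = trans (∑F-suc (λ x → r x * f x)) (cong (λ z → r zero * (- s) + z) (trans (∑F-cong (λ x → alg₂ c (r (suc x)) (g x))) (∑F-* c (λ x → r (suc x) * g x))))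
  solves : ∀ r → ∑F (λ x → (c * r (suc x) - r zero * R (suc x)) * g x) ≡ 0ℤ → ∑F (λ x → r x * f x) ≡ 0ℤ
  solves r z = trans (expand r) (trans (alg₄ (r zero) s (c * ∑F (λ x → r (suc x) * g x)))
    (trans (sym (trans (∑F-cong (λ x → alg₃ c (r (suc x)) (r zero) (R (suc x)) (g x)))
      (trans (∑F-+ _ _) (cong₂ _+_ (∑F-* c (λ x → r (suc x) * g x)) (∑F-* (- r zero) (λ x → R (suc x) * g x)))))) z))

opaque
  unfolding ∑F ∑

  private
    length-filter-tabulate : ∀ {n m} {P : Fin m → Set} (P? : Decidable P) (g : Fin n → Fin m)
      → + length (filter P? (tabulate g)) ≡ ∑F (λ x → when (P? (g x)) 1ℤ)
    length-filter-tabulate {zero} P? g = refl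
    length-filter-tabulate {suc n} P? g with P? (g zero)
    ... | yes _ = cong (λ z → 1ℤ + z) (length-filter-tabulate P? (g ∘ suc))
    ... | no _  = trans (length-filter-tabulate P? (g ∘ suc)) (sym (+-identityˡ _))

  length-filter-allFin : ∀ {m} {P : Fin m → Set} (P? : Decidable P) → + length (filter P? (allFin m)) ≡ ∑ P? (λ _ → 1ℤ)
  length-filter-allFin P? = length-filter-tabulate P? (λ x → x)

  ∑-complement : ∀ {m} {P : Fin m → Set} (P? : Decidable P) → ∑ P? (λ _ → 1ℤ) + ∑ (λ x → ¬? (P? x)) (λ _ → 1ℤ) ≡ + m
  ∑-complement {m} P? = trans (sym (∑F-+ (λ x → when (P? x) 1ℤ) (λ x → when (¬? (P? x)) 1ℤ))) (trans (∑F-cong go) (total m))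
    where
    go : ∀ x → when (P? x) 1ℤ + when (¬? (P? x)) 1ℤ ≡ 1ℤ
    go x with P? x
    ... | yes _ = refl
    ... | no _  = refl
    total : ∀ m → ∑F {m} (λ _ → 1ℤ) ≡ + m
    total zero    = refl
    total (suc m) = cong (λ z → 1ℤ + z) (total m)

  -- The unknowns are indexed by `U` and the equations by `Q`. Unit rows force `f` to vanish outside
  -- `U`, which permits working with all `m` coordinates instead of renumbering `U`.
  underdetermined : ∀ {m} {U Q : Fin m → Set} (U? : Decidable U) (Q? : Decidable Q)
    {E : Fin m → Fin m → Set} (E? : ∀ y → Decidable (E y))
    → ∑ Q? (λ _ → 1ℤ) <ℤ ∑ U? (λ _ → 1ℤ)
    → ∃ λ (f : Fin m → ℤ) → (∃ λ x → f x ≢ 0ℤ) × (∀ y → Q y → ∑ (E? y) f ≡ 0ℤ) × (∀ x → ¬ U x → f x ≡ 0ℤ)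
  underdetermined {m} U? Q? E? lt with homogeneous m (map row (filter Q? (allFin m)) ++ map unit (filter (λ x → ¬? (U? x)) (allFin m))) len
    where
    row unit : Fin m → Fin m → ℤ
    row y x = when (E? y x) 1ℤ
    unit y x = when (x Fin.≟ y) 1ℤ
    len : length (map row (filter Q? (allFin m)) ++ map unit (filter (λ x → ¬? (U? x)) (allFin m))) ℕ.< m
    len = drop‿+<+ (subst₂ _<ℤ_
      (sym (trans (cong +_ (trans (length-++ (map row (filter Q? (allFin m)))) (cong₂ ℕ._+_ (length-map row (filter Q? (allFin m))) (length-map unit (filter (λ x → ¬? (U? x)) (allFin m))))))
        (cong₂ _+_ (length-filter-allFin Q?) (length-filter-allFin (λ x → ¬? (U? x))))))
      (∑-complement U?) (ℤ.+-monoˡ-< (∑ (λ x → ¬? (U? x)) (λ _ → 1ℤ)) lt))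
  ... | f , nz , all = f , nz
    , (λ y Qy → trans (∑F-cong (λ x → when-* (E? y x) (f x))) (All.lookup (All.map⁻ (All.++⁻ˡ _ all)) (∈-filter⁺ Q? (∈-allFin y) Qy)))
    , (λ x ¬Ux → trans (sym (trans (∑F-single x (λ z z≢x → trans (cong (λ w → w * f z) (when-no (z Fin.≟ x) z≢x)) (ℤ.*-zeroˡ (f z))))
          (trans (cong (λ w → w * f x) (when-yes (x Fin.≟ x) refl)) (*-identityˡ (f x)))))
        (All.lookup (All.map⁻ (All.++⁻ʳ (map _ (filter Q? (allFin m))) all)) (∈-filter⁺ (λ x → ¬? (U? x)) (∈-allFin x) ¬Ux)))
    where
    when-* : ∀ {A : Set} (d : Dec A) v → when d v ≡ when d 1ℤ * v
    when-* (yes _) v = sym (*-identityˡ v)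
    when-* (no _)  v = refl

module Hyperplanes {m : ℕ} (L : GeometricLattice m) where

  open Ranked L
  open AtomCounts L

  private
    -- The base together with the atoms of an interval. The unknown at `p` acts as a constant term,
    -- paid for by the equation at `e`: it cancels `f e`, so that the sum over a flat above `e`
    -- reduces to its atoms other than `e`, and these sums are additive over the lines through `e`.
    Low : Fin m → Fin m → Fin m → Set
    Low p y x = p ⊑ x × x ⊑ y × ρ x ℕ.≤ suc (ρ p)

    low? : ∀ p y → Decidable (Low p y)
    low? p y x = p ⊑? x ×-dec x ⊑? y ×-dec ρ x ℕ.≤? suc (ρ p)

    ∑-low : ∀ {p y} → p ⊑ y → ∀ φ → ∑ (low? p y) φ ≡ φ p + ∑ (itv? p y (suc (ρ p))) φ
    ∑-low {p} {y} p⊑y φ = trans (∑-split (low? p y) (_⊑? p) φ) (cong₂ _+_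
      (∑-single (λ x → low? p y x ×-dec x ⊑? p) p ((⊑-refl p , p⊑y , ℕ.n≤1+n _) , ⊑-refl p)
        (λ x ((p⊑x , _) , x⊑p) → ⊑-antisym x p x⊑p p⊑x))
      (∑-⇔ (λ x → low? p y x ×-dec ¬? (x ⊑? p)) (itv? p y (suc (ρ p)))
        (λ x ((p⊑x , x⊑y , ρx≤) , x⋢p) → p⊑x , x⊑y , ℕ.≤-antisym ρx≤ (ρ-strict p⊑x (λ p≡x → x⋢p (subst (_⊑ p) p≡x (⊑-refl p)))))
        (λ x (p⊑x , x⊑y , ρx) → (p⊑x , x⊑y , ℕ.≤-reflexive ρx) , λ x⊑p → ℕ.<⇒≱ (ℕ.≤-reflexive (sym ρx)) (ρ-mono x⊑p))
        (λ _ _ → refl)))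

    out? : ∀ p K y → Decidable (λ x → AtomOf p y x × ¬ x ⊑ K)
    out? p K y x = itv? p y (suc (ρ p)) x ×-dec ¬? (x ⊑? K)

    -- For an atom `x` not below `K`, the only cover of `K` above `x` is `K ⊔ x`; so the covers
    -- partition the atoms outside `K`.
    ∑-covers : ∀ {p K q} → p ⊑ K → K ⊑ q → ∀ φ → ∑ (out? p K q) φ ≡ ∑ (itv? K q (suc (ρ K))) (λ y → ∑ (out? p K y) φ)
    ∑-covers {p} {K} {q} p⊑K K⊑q φ = sym (trans
      (∑-swap (itv? K q (suc (ρ K))) (out? p K) (out? p K q) (λ x → itv? (K ⊔ x) q (suc (ρ K)))
        (λ y x (K⊑y , y⊑q , ρy) ((p⊑x , x⊑y , ρx) , x⋢K) → ((p⊑x , ⊑-trans x⊑y y⊑q , ρx) , x⋢K) , (lub K x y K⊑y x⊑y , y⊑q , ρy))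
        (λ y x ((p⊑x , x⊑q , ρx) , x⋢K) (Kx⊑y , y⊑q , ρy) →
          (⊑-trans (ub₁ K x) Kx⊑y , y⊑q , ρy) , ((p⊑x , ⊑-trans (ub₂ K x) Kx⊑y , ρx) , x⋢K)))
      (∑-cong (out? p K q) (λ x ((p⊑x , x⊑q , ρx) , x⋢K) → let ρKx = ρ-⊔ p⊑x ρx p⊑K x⋢K in
        ∑-single (itv? (K ⊔ x) q (suc (ρ K))) (K ⊔ x) (⊑-refl _ , lub K x q K⊑q x⊑q , ρKx)
          (λ y (Kx⊑y , _ , ρy) → sym (ρ-inj Kx⊑y (ℕ.≤-reflexive (trans ρy (sym ρKx))))))))

    ∑-outside : ∀ {p K y} → K ⊑ y → ∀ φ → ∑ (itv? p y (suc (ρ p))) φ ≡ ∑ (itv? p K (suc (ρ p))) φ + ∑ (out? p K y) φ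
    ∑-outside {p} {K} {y} K⊑y φ = trans (∑-split (itv? p y (suc (ρ p))) (_⊑? K) φ) (cong (λ z → z + ∑ (out? p K y) φ)
      (∑-⇔ (λ x → itv? p y (suc (ρ p)) x ×-dec x ⊑? K) (itv? p K (suc (ρ p)))
        (λ x ((p⊑x , _ , ρx) , x⊑K) → p⊑x , x⊑K , ρx) (λ x (p⊑x , x⊑K , ρx) → (p⊑x , ⊑-trans x⊑K K⊑y , ρx) , x⊑K) (λ _ _ → refl)))

    module Vanishing {p q e k} (A : AtomOf p q e) (ρq : ρ q ≡ suc k) (f : Fin m → ℤ)
      (hyp : ∀ y → Miss p e q k y ⊎ Low e q y → ∑ (low? p y) f ≡ 0ℤ) where

      p⊑e = proj₁ A
      e⊑q = proj₁ (proj₂ A)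
      ρe  = proj₂ (proj₂ A)
      p⊑q = ⊑-trans p⊑e e⊑q

      F : Fin m → ℤ
      F y = ∑ (low? p y) f

      private
        S : Fin m → ℤ
        S z = ∑ (miss? p e z (ρ e)) f

        F-above-e : ∀ {z} → e ⊑ z → F z ≡ f p + (f e + S z)
        F-above-e {z} e⊑z = trans (∑-low (⊑-trans p⊑e e⊑z) f) (cong (λ w → f p + w)
          (trans (cong (λ k → ∑ (itv? p z k) f) (sym ρe)) (trans (∑-splitAtom (restrict A e⊑z) (ρ e) f)
            (cong (λ w → w + S z) (∑-bottom f e⊑z)))))

        S-e : S e ≡ 0ℤ
        S-e = ∑-empty (miss? p e e (ρ e)) (λ x ((_ , x⊑e , ρx) , e⋢x) →
          e⋢x (subst (e ⊑_) (sym (ρ-inj x⊑e (ℕ.≤-reflexive (sym ρx)))) (⊑-refl e)))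

        base : f p + f e ≡ 0ℤ
        base = trans (cong (λ w → f p + w) (sym (trans (cong (λ w → f e + w) S-e) (+-identityʳ (f e)))))
          (trans (sym (F-above-e (⊑-refl e))) (hyp e (inj₂ (⊑-refl e , e⊑q , ℕ.n≤1+n _))))

        F≡S : ∀ {z} → e ⊑ z → F z ≡ S z
        F≡S {z} e⊑z = trans (F-above-e e⊑z) (trans (sym (ℤ.+-assoc (f p) (f e) (S z)))
          (trans (cong (λ w → w + S z) base) (+-identityˡ (S z))))

      F-above : ∀ {z} → e ⊑ z → z ⊑ q → F z ≡ 0ℤ
      F-above {z} e⊑z z⊑q = trans (F≡S e⊑z) (trans (∑-fibres (restrict A e⊑z) (ρ e) f)
        (∑-vanish (itv? e z (suc (ρ e))) (λ l (e⊑l , l⊑z , ρl) → trans (sym (F≡S e⊑l))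
          (hyp l (inj₂ (e⊑l , ⊑-trans l⊑z z⊑q , ℕ.≤-reflexive ρl))))))

      F-below : ∀ c {K} → p ⊑ K → K ⊑ q → suc c ℕ.+ ρ K ≡ ρ q → F K ≡ 0ℤ
      F-below zero {K} p⊑K K⊑q eq with e ⊑? K
      ... | yes e⊑K = F-above e⊑K K⊑q
      ... | no e⋢K  = hyp K (inj₁ ((p⊑K , K⊑q , ℕ.suc-injective (trans eq ρq)) , e⋢K))
      F-below (suc c) {K} p⊑K K⊑q eq = [ (λ z → ⊥-elim (ℤ.<⇒≢ two≤ (sym (ℤ.i-j≡0⇒i≡j (at K q) 1ℤ z)))) , (λ z → z) ]′
        (ℤ.i*j≡0⇒i≡0∨j≡0 (at K q - 1ℤ) product≡0)
        where
        two≤ : 1ℤ <ℤ at K q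
        two≤ = ℤ.<-≤-trans (+<+ (ℕ.s≤s (ℕ.s≤s ℕ.z≤n))) (rank≤at (suc (suc c)) K⊑q (sym eq))
        O : Fin m → ℤ
        O y = ∑ (out? p K y) f
        O≡ : ∀ {y} → K ⊑ y → F y ≡ 0ℤ → O y ≡ - F K
        O≡ {y} K⊑y Fy≡0 = alg (F K) (O y) (trans (sym (trans (∑-low (⊑-trans p⊑K K⊑y) f) (trans
          (cong (λ w → f p + w) (∑-outside K⊑y f)) (trans (sym (ℤ.+-assoc (f p) _ (O y))) (cong (λ w → w + O y) (sym (∑-low p⊑K f))))))) Fy≡0)
          where
          alg : ∀ a b → a + b ≡ 0ℤ → b ≡ - a
          alg a b z = trans (alg′ a b) (trans (cong (λ w → w - a) z) (+-identityˡ (- a)))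
            where
            alg′ : ∀ a b → b ≡ a + b - a
            alg′ = solve-∀
        -- The sum over the atoms outside `K` is evaluated twice: within `q`, and cover by cover.
        -- Each evaluation yields `- F K`, once or `at K q` times.
        count : - F K ≡ (- F K) * at K q
        count = trans (sym (O≡ K⊑q (F-above e⊑q (⊑-refl q)))) (trans (∑-covers p⊑K K⊑q f)
          (trans (∑-cong (itv? K q (suc (ρ K))) (λ y (K⊑y , y⊑q , ρy) → O≡ K⊑y (F-below c (⊑-trans p⊑K K⊑y) y⊑q
            (trans (cong (λ z → suc (c ℕ.+ z)) ρy) (trans (cong suc (ℕ.+-suc c (ρ K))) eq)))))
            (∑-const (itv? K q (suc (ρ K))) (- F K))))
        product≡0 : (at K q - 1ℤ) * F K ≡ 0ℤ
        product≡0 = trans (alg (F K) (at K q)) (ℤ.i≡j⇒i-j≡0 count)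
          where
          alg : ∀ a n → (n - 1ℤ) * a ≡ - a - (- a) * n
          alg = solve-∀

      F-zero : ∀ {K} → p ⊑ K → K ⊑ q → F K ≡ 0ℤ
      F-zero {K} p⊑K K⊑q with K Fin.≟ q
      ... | yes refl = F-above e⊑q (⊑-refl q)
      ... | no K≢q   = F-below (ρ q ℕ.∸ suc (ρ K)) p⊑K K⊑q
        (trans (sym (ℕ.+-suc _ (ρ K))) (ℕ.m∸n+n≡m (ρ-strict K⊑q K≢q)))

      f-base : f p ≡ 0ℤ
      f-base = trans (sym (trans (∑-low (⊑-refl p) f) (trans (cong (λ w → f p + w)
        (∑-empty (itv? p p (suc (ρ p))) (λ y (_ , y⊑p , ρy) → ℕ.<⇒≱ (ℕ.≤-reflexive (sym ρy)) (ρ-mono y⊑p)))) (+-identityʳ (f p)))))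
        (F-zero (⊑-refl p) p⊑q)

      f-zero : ∀ x → Low p q x → f x ≡ 0ℤ
      f-zero x (p⊑x , x⊑q , ρx≤) with x ⊑? p
      ... | yes x⊑p = subst (λ z → f z ≡ 0ℤ) (⊑-antisym p x p⊑x x⊑p) f-base
      ... | no x⋢p = trans (sym (+-identityˡ (f x))) (trans (cong (λ w → w + f x) (sym f-base))
        (trans (sym (trans (∑-low p⊑x f) (cong (λ w → f p + w) (trans (cong (λ k → ∑ (itv? p x k) f) (sym ρx)) (∑-top f p⊑x)))))
          (F-zero p⊑x x⊑q)))
        where
        ρx : ρ x ≡ suc (ρ p)
        ρx = ℕ.≤-antisym ρx≤ (ρ-strict p⊑x (λ p≡x → x⋢p (subst (_⊑ p) p≡x (⊑-refl p))))

  -- If it failed, there would be a nonzero f on p and the atoms of [p, q] whose sums F y over the elements below y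
  -- vanish for the hyperplanes y avoiding e, for e and for the lines through e.  Then F vanishes above e, so at all
  -- hyperplanes and at q, and so downwards everywhere: F K = at K q * F K if F vanishes at q and the covers of K,
  -- and at K q ≥ 2 if K is not q or a hyperplane.
  1+τ≤N : ∀ {p q e k} → AtomOf p q e → ρ q ≡ suc k → 1ℤ + τ p e q ≤ℤ N p e q k
  1+τ≤N {p} {q} {e} {k} A@(p⊑e , e⊑q , ρe) ρq = ≤-by (i≤j⇒0≤j-i U≤Q) (trans (alg (N p e q k) (at e q) (τ p e q))
      (cong (λ z → 1ℤ + at e q + N p e q k - (1ℤ + z)) (sym (at-split A))))
    where
    alg : ∀ n a t → n - (1ℤ + t) ≡ 1ℤ + a + n - (1ℤ + (1ℤ + a + t))
    alg = solve-∀
    one : Fin m → ℤ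
    one _ = 1ℤ
    Q? : Decidable (λ y → Miss p e q k y ⊎ Low e q y)
    Q? y = miss? p e q k y ⊎-dec low? e q y
    sizeU : ∑ (low? p q) one ≡ 1ℤ + at p q
    sizeU = ∑-low (⊑-trans p⊑e e⊑q) one
    sizeQ : ∑ Q? one ≡ 1ℤ + at e q + N p e q k
    sizeQ = trans (∑-split Q? (e ⊑?_) one) (cong₂ _+_
      (trans (∑-⇔ (λ y → Q? y ×-dec e ⊑? y) (low? e q)
          (λ { y (inj₁ (_ , e⋢y) , e⊑y) → ⊥-elim (e⋢y e⊑y) ; y (inj₂ low , _) → low })
          (λ y low → inj₂ low , proj₁ low) (λ _ _ → refl)) (∑-low e⊑q one))
      (∑-⇔ (λ y → Q? y ×-dec ¬? (e ⊑? y)) (miss? p e q k)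
        (λ { y (inj₁ M , _) → M ; y (inj₂ low , e⋢y) → ⊥-elim (e⋢y (proj₁ low)) })
        (λ y M → inj₁ M , proj₂ M) (λ _ _ → refl)))
    U≤Q : 1ℤ + at p q ≤ℤ 1ℤ + at e q + N p e q k
    U≤Q with (1ℤ + at p q) ℤ.≤? (1ℤ + at e q + N p e q k)
    ... | yes le = le
    ... | no ≰ with underdetermined (low? p q) Q? (low? p) (subst₂ _<ℤ_ (sym sizeQ) (sym sizeU) (ℤ.≰⇒> ≰))
    ...   | f , (x , fx≢0) , eqs , outside with low? p q x
    ...     | yes low = ⊥-elim (fx≢0 (Vanishing.f-zero A ρq f eqs x low))
    ...     | no ¬low = ⊥-elim (fx≢0 (outside x ¬low))

-- Numbers of flats

-- bin (i - 1) (j - 1) and bin i (j - 1), with the conventions of bin↓.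
binW binZ : ℕ → ℕ → ℤ
binW zero    j = 0ℤ
binW (suc i) j = bin↓ i j

binZ i zero    = 0ℤ
binZ i (suc j) = bin i j

module WhitneyNumbers {m : ℕ} (L : GeometricLattice m) where

  open Ranked L
  open AtomCounts L
  open Hyperplanes L

  W : Fin m → Fin m → ℕ → ℤ
  W p q k = ∑ (itv? p q k) (λ _ → 1ℤ)

  -- A count of pairs of a line `l` through `e` and a flat `G` above `l`: since `τ p e G` is the sum
  -- of the weights of the lines below `G`, each line passes its weight to all the flats containing
  -- it.
  τ-weighted : ∀ {p q e} k c (φ : Fin m → ℤ) → AtomOf p q e
    → (∀ l → AtomOf e q l → c ≤ℤ ∑ (itv? l q k) φ) → τ p e q * c ≤ℤ ∑ (itv? e q k) (λ G → φ G * τ p e G)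
  τ-weighted {p} {q} {e} k c φ A le = begin
    τ p e q * c                                        ≡⟨ sym (∑-*ʳ I? c ω) ⟩
    ∑ I? (λ l → ω l * c)                               ≤⟨ ∑-mono I? (λ l Al → *-monoˡ (0≤τ-term A Al) (le l Al)) ⟩
    ∑ I? (λ l → ω l * ∑ (itv? l q k) φ)                ≡⟨ sym (∑-pairs e q (suc (ρ e)) k φ ω) ⟩
    ∑ (itv? e q k) (λ G → φ G * τ p e G)               ∎
    where
    open ℤ.≤-Reasoning
    ω : Fin m → ℤ
    ω l = N p e l (ρ e) - 1ℤ
    I? = itv? e q (suc (ρ e))

  ∑-τ : ∀ {p q e} k c → AtomOf p q e → (∀ l → AtomOf e q l → c ≤ℤ W l q k) → τ p e q * c ≤ℤ ∑ (itv? e q k) (τ p e)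
  ∑-τ {p} {q} {e} k c A le = ≤-trans (τ-weighted k c (λ _ → 1ℤ) A le)
    (≤-reflexive (∑-cong (itv? e q k) (λ G _ → *-identityˡ (τ p e G))))

  atomLevel : ∀ {p q e} i {k} → AtomOf p q e → k ≡ suc i ℕ.+ ρ p → k ≡ i ℕ.+ ρ e
  atomLevel {p} i (_ , _ , ρe) eq = trans eq (trans (sym (ℕ.+-suc i (ρ p))) (cong (i ℕ.+_) (sym ρe)))

  lineLevel : ∀ {p q e l} i {k} → AtomOf p q e → AtomOf e q l → k ≡ suc (suc i) ℕ.+ ρ p → k ≡ i ℕ.+ ρ l
  lineLevel i A Al eq = atomLevel i Al (atomLevel (suc i) A eq)

  atomLevel′ : ∀ {p q e} i {k} → AtomOf p q e → k ≡ i ℕ.+ ρ p → suc k ≡ i ℕ.+ ρ e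
  atomLevel′ i A eq = atomLevel i A (cong suc eq)

  ⊑-of : ∀ {p q e} → AtomOf p q e → p ⊑ q
  ⊑-of (p⊑e , e⊑q , _) = ⊑-trans p⊑e e⊑q

  atomExists : ∀ {p q} i j {k} → p ⊑ q → k ≡ i ℕ.+ ρ p → ρ q ≡ suc j ℕ.+ k → ∃ λ e → AtomOf p q e
  atomExists {p} i j p⊑q refl ρq = someAtom (j ℕ.+ i) p⊑q (trans ρq (cong suc (sym (ℕ.+-assoc j i (ρ p)))))

  rank≤at′ : ∀ {p q} i j {k} → p ⊑ q → k ≡ i ℕ.+ ρ p → ρ q ≡ j ℕ.+ k → 0ℤ ≤ℤ at p q - + (i ℕ.+ j)
  rank≤at′ {p} i j p⊑q refl ρq = i≤j⇒0≤j-i (rank≤at (i ℕ.+ j) p⊑q (trans ρq (trans (sym (ℕ.+-assoc j i (ρ p))) (cong (ℕ._+ ρ p) (ℕ.+-comm j i)))))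

  W-atBottom : ∀ {p q k} φ → p ⊑ q → k ≡ ρ p → ∑ (itv? p q k) φ ≡ φ p
  W-atBottom φ p⊑q refl = ∑-bottom φ p⊑q

  W-atTop : ∀ {p q k} φ → p ⊑ q → ρ q ≡ k → ∑ (itv? p q k) φ ≡ φ q
  W-atTop φ p⊑q refl = ∑-top φ p⊑q

  -- Below, k = i + ρ p and ρ q = j + k: the flats counted have rank i and corank j in [p, q].
  W-lower : ∀ i j {p q k} → p ⊑ q → k ≡ i ℕ.+ ρ p → ρ q ≡ j ℕ.+ k
    → bin i j + (at p q - + (i ℕ.+ j)) * binW i j ≤ℤ W p q k

  W-bin : ∀ i j {p q k} → p ⊑ q → k ≡ i ℕ.+ ρ p → ρ q ≡ j ℕ.+ k → bin i j ≤ℤ W p q k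
  W-bin i j {p} {q} p⊑q keq ρq = ≤-trans
    (≤-by (0≤* (rank≤at′ i j p⊑q keq ρq) (0≤binW i j)) (x+y-x≡y (bin i j) ((at p q - + (i ℕ.+ j)) * binW i j)))
    (W-lower i j p⊑q keq ρq)
    where
    0≤binW : ∀ i j → 0ℤ ≤ℤ binW i j
    0≤binW zero    j = ≤-refl
    0≤binW (suc i) j = 0≤bin↓ i j

  W-lower zero j {p} {q} {k} p⊑q keq ρq = ≤-reflexive (trans (1+x*0≡1 (at p q - + j)) (sym (W-atBottom (λ _ → 1ℤ) p⊑q keq)))
  -- The convention for `bin↓ 0 0` makes the coefficient 1 here instead of 0, which does no harm: in
  -- rank 1 the excess is 0.
  W-lower (suc zero) zero {p} {q} {k} p⊑q keq ρq = ≤-reflexive (trans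
    (cong (λ z → 1ℤ + (z - 1ℤ) * 1ℤ) (at-rank1 p⊑q (trans ρq keq))) (sym (W-atTop (λ _ → 1ℤ) p⊑q ρq)))
  W-lower (suc (suc i)) zero {p} {q} {k} p⊑q keq ρq = ≤-reflexive (trans (1+x*0≡1 (at p q - + (suc (suc i) ℕ.+ 0))) (sym (W-atTop (λ _ → 1ℤ) p⊑q ρq)))

  W-lower (suc i) (suc j) {p} {q} {k} p⊑q keq ρq with atomExists (suc i) j p⊑q keq ρq
  ... | e , A@(p⊑e , e⊑q , ρe) = begin
    (bin i (suc j) + bin (suc i) j) + (at p q - (1ℤ + + (i ℕ.+ suc j))) * bin i j
      ≡⟨ cong₂ (λ y z → (bin i (suc j) + bin (suc i) j) + (y - (1ℤ + r)) * z) (at-split A) (bin↓-bin← i j) ⟩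
    (bin i (suc j) + bin (suc i) j) + (1ℤ + at e q + τ p e q - (1ℤ + r)) * (bin← i j + bin↓ i j)
      ≡⟨ alg (bin i (suc j)) (bin (suc i) j) (at e q) (τ p e q) r (bin← i j) (bin↓ i j) ⟩
    (bin i (suc j) + (at e q - r) * bin← i j) + (bin (suc i) j + (at e q - r) * bin↓ i j) + τ p e q * (bin← i j + bin↓ i j)
      ≡⟨ cong₂ _+_ (cong₂ _+_ (cong (λ z → bin i (suc j) + (at e q - r) * z) (sym (binW-suc i j)))
           (cong (λ n → bin (suc i) j + (at e q - + n) * bin↓ i j) (ℕ.+-suc i j))) (cong (λ z → τ p e q * z) (sym (bin↓-bin← i j))) ⟩
    (bin i (suc j) + (at e q - r) * binW i (suc j)) + (bin (suc i) j + (at e q - + (suc i ℕ.+ j)) * bin↓ i j) + τ p e q * bin i j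
      -- The flats through `e` have rank `i` in `[e, q]`; those avoiding `e` are sorted by their
      -- join `G` with `e`, which has rank `suc i` there. Every line through `e` lies in at least
      -- `bin i j` of these `G`, and the whole of `τ p e q` is passed on to them.
      ≤⟨ +-mono-≤ (+-mono-≤ (W-lower i (suc j) e⊑q (atomLevel i A keq) ρq) (W-lower (suc i) j e⊑q (atomLevel′ (suc i) A keq) ρq′))
           (∑-τ (suc k) (bin i j) A (λ l Al → W-bin i j (proj₁ (proj₂ Al)) (lineLevel i A Al (cong suc keq)) ρq′)) ⟩
    W e q k + W e q (suc k) + ∑ (itv? e q (suc k)) (τ p e)
      ≡⟨ trans (ℤ.+-assoc (W e q k) _ _) (cong (λ z → W e q k + z) (sym (∑-+ (itv? e q (suc k)) (λ _ → 1ℤ) (τ p e)))) ⟩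
    W e q k + ∑ (itv? e q (suc k)) (λ G → 1ℤ + τ p e G)
      -- The flats below `G` that are counted are the hyperplanes of `[p, G]` avoiding `e`.
      ≤⟨ ℤ.+-monoʳ-≤ (W e q k) (∑-mono (itv? e q (suc k)) (λ G (e⊑G , _ , ρG) → 1+τ≤N (restrict A e⊑G) ρG)) ⟩
    W e q k + ∑ (itv? e q (suc k)) (λ G → N p e G k)
      ≡⟨ trans (cong (λ z → W e q k + z) (sym (∑-fibres A k (λ _ → 1ℤ)))) (sym (∑-splitAtom A k (λ _ → 1ℤ))) ⟩
    W p q k ∎
    where
    open ℤ.≤-Reasoning
    r = + (i ℕ.+ suc j)
    ρq′ : ρ q ≡ j ℕ.+ suc k
    ρq′ = trans ρq (sym (ℕ.+-suc j k))
    binW-suc : ∀ i j → binW i (suc j) ≡ bin← i j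
    binW-suc zero    j = refl
    binW-suc (suc i) j = refl
    alg : ∀ x y a t r b c → (x + y) + (1ℤ + a + t - (1ℤ + r)) * (b + c) ≡ (x + (a - r) * b) + (y + (a - r) * c) + t * (b + c)
    alg = solve-∀

  -- Each flat has weight one plus the excess of `[p, G]`. In the near pencil a further line point
  -- creates flats having it as their only line point and adds 1 to the weight of those containing
  -- the line, `bin← i j` in all. The induction is that of `W-lower`, with `∑-missing-at` in place
  -- of `1+τ≤N`; here the flats through `e` receive a share of `τ` too.
  V-lower : ∀ i j {p q k} → p ⊑ q → k ≡ i ℕ.+ ρ p → ρ q ≡ j ℕ.+ k
    → bin i j + (at p q - + (i ℕ.+ j)) * bin← i j ≤ℤ ∑ (itv? p q k) (λ G → at p G - + i + 1ℤ)
  V-lower zero j {p} {q} p⊑q keq ρq = ≤-reflexive (trans (1+x*0≡1 (at p q - + j))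
    (sym (trans (W-atBottom (λ G → at p G - 0ℤ + 1ℤ) p⊑q keq) (cong (λ z → z - 0ℤ + 1ℤ) (at-rank0 (⊑-refl p) refl)))))
  V-lower (suc i) zero {p} {q} p⊑q keq ρq = ≤-reflexive (trans (cong₂ (λ y z → 1ℤ + (at p q - + suc y) * z) (ℕ.+-identityʳ i) (bin-zeroʳ i))
    (trans (alg (at p q) (+ suc i)) (sym (W-atTop (λ G → at p G - + suc i + 1ℤ) p⊑q ρq))))
    where
    alg : ∀ a x → 1ℤ + (a - x) * 1ℤ ≡ a - x + 1ℤ
    alg = solve-∀
  V-lower (suc i) (suc j) {p} {q} {k} p⊑q keq ρq with atomExists (suc i) j p⊑q keq ρq
  ... | e , A@(p⊑e , e⊑q , ρe) = begin
    (bin i (suc j) + bin (suc i) j) + (at p q - (1ℤ + + (i ℕ.+ suc j))) * bin i (suc j)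
      ≡⟨ cong₂ (λ y z → (bin i (suc j) + bin (suc i) j) + (y - (1ℤ + r)) * z) (at-split A) (bin↓-bin← i (suc j)) ⟩
    (bin i (suc j) + bin (suc i) j) + (1ℤ + at e q + τ p e q - (1ℤ + r)) * (bin← i (suc j) + bin i j)
      ≡⟨ alg (bin i (suc j)) (bin (suc i) j) (at e q) (τ p e q) r (bin← i (suc j)) (bin i j) ⟩
    ((bin i (suc j) + (at e q - r) * bin← i (suc j)) + τ p e q * bin← i (suc j))
      + ((bin (suc i) j + (at e q - r) * bin i j) + τ p e q * bin i j)
      ≡⟨ cong (λ n → ((bin i (suc j) + (at e q - r) * bin← i (suc j)) + τ p e q * bin← i (suc j))
           + ((bin (suc i) j + (at e q - + n) * bin i j) + τ p e q * bin i j)) (ℕ.+-suc i j) ⟩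
    ((bin i (suc j) + (at e q - r) * bin← i (suc j)) + τ p e q * bin← i (suc j))
      + ((bin (suc i) j + (at e q - + (suc i ℕ.+ j)) * bin i j) + τ p e q * bin i j)
      ≤⟨ +-mono-≤ (+-mono-≤ (V-lower i (suc j) e⊑q (atomLevel i A keq) ρq) (∑-τ k (bin← i (suc j)) A (level i keq)))
           (+-mono-≤ (V-lower (suc i) j e⊑q (atomLevel′ (suc i) A keq) ρq′)
             (∑-τ (suc k) (bin i j) A (λ l Al → W-bin i j (proj₁ (proj₂ Al)) (lineLevel i A Al (cong suc keq)) ρq′))) ⟩
    (∑ (itv? e q k) (λ G → at e G - + i + 1ℤ) + ∑ (itv? e q k) (τ p e))
      + (∑ (itv? e q (suc k)) (λ G → at e G - + suc i + 1ℤ) + ∑ (itv? e q (suc k)) (τ p e))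
      ≡⟨ cong₂ _+_ through (sym (∑-+ (itv? e q (suc k)) (λ G → at e G - + suc i + 1ℤ) (τ p e))) ⟩
    ∑ (itv? e q k) φ + ∑ (itv? e q (suc k)) (λ G → at e G - + suc i + 1ℤ + τ p e G)
      ≤⟨ ℤ.+-monoʳ-≤ (∑ (itv? e q k) φ) (∑-mono (itv? e q (suc k)) avoiding) ⟩
    ∑ (itv? e q k) φ + ∑ (itv? e q (suc k)) (λ G → ∑ (miss? p e G k) φ)
      ≡⟨ trans (cong (λ z → ∑ (itv? e q k) φ + z) (sym (∑-fibres A k φ))) (sym (∑-splitAtom A k φ)) ⟩
    ∑ (itv? p q k) φ ∎
    where
    open ℤ.≤-Reasoning
    r = + (i ℕ.+ suc j)
    φ : Fin m → ℤ
    φ G = at p G - + suc i + 1ℤ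
    ρq′ : ρ q ≡ j ℕ.+ suc k
    ρq′ = trans ρq (sym (ℕ.+-suc j k))
    alg : ∀ x y a t r b c → (x + y) + (1ℤ + a + t - (1ℤ + r)) * (b + c) ≡ ((x + (a - r) * b) + t * b) + ((y + (a - r) * c) + t * c)
    alg = solve-∀
    alg₂ : ∀ a t i → a - i + 1ℤ + t ≡ 1ℤ + a + t - (1ℤ + i) + 1ℤ
    alg₂ = solve-∀
    alg₃ : ∀ a t i → a - i + 1ℤ + t ≡ 1ℤ + a + t - i
    alg₃ = solve-∀
    level : ∀ i → k ≡ suc i ℕ.+ ρ p → ∀ l → AtomOf e q l → bin← i (suc j) ≤ℤ W l q k
    level zero    eq l Al = ∑-nonneg (itv? l q k) (λ _ _ → 0≤pos 1)
    level (suc i) eq l Al = W-bin i (suc j) (proj₁ (proj₂ Al)) (lineLevel i A Al eq) ρq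
    through : ∑ (itv? e q k) (λ G → at e G - + i + 1ℤ) + ∑ (itv? e q k) (τ p e) ≡ ∑ (itv? e q k) φ
    through = trans (sym (∑-+ (itv? e q k) (λ G → at e G - + i + 1ℤ) (τ p e))) (∑-cong (itv? e q k) (λ G (e⊑G , _ , _) →
      trans (alg₂ (at e G) (τ p e G) (+ i)) (cong (λ z → z - + suc i + 1ℤ) (sym (at-split (restrict A e⊑G))))))
    avoiding : ∀ G → Itv e q (suc k) G → at e G - + suc i + 1ℤ + τ p e G ≤ℤ ∑ (miss? p e G k) φ
    avoiding G (e⊑G , _ , ρG) = subst₂ _≤ℤ_
      (trans (cong (λ z → z - + suc i) (at-split (restrict A e⊑G))) (sym (alg₃ (at e G) (τ p e G) (+ suc i))))
      (cong (λ k → ∑ (miss? p e G k) φ) (sym keq)) (∑-missing-at (suc i) (restrict A e⊑G) (trans ρG (cong suc keq)))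

  -- A flat G of rank k avoiding e, and a line l through e not in G ⊔ e: joining G with the atoms of l other than e
  -- gives distinct covers of G.
  N-line≤N-cover : ∀ {p Z e l G G′ k} → AtomOf p Z e → AtomOf e Z l → Miss e l Z (suc k) G′ → Miss p e G′ k G
    → N p e l (ρ e) ≤ℤ N G G′ Z (suc k)
  N-line≤N-cover {p} {Z} {e} {l} {G} {G′} {k} A@(p⊑e , e⊑Z , ρe) (e⊑l , l⊑Z , ρl) ((e⊑G′ , G′⊑Z , ρG′) , l⋢G′) MG@((p⊑G , G⊑G′ , ρG) , e⋢G) = begin
    ∑ X? (λ _ → 1ℤ)                                ≤⟨ ∑-mono X? (λ x Mx → ∑-member (C? x) (G ⊔ x) (cover x Mx) (λ _ _ → 0≤pos 1)) ⟩
    ∑ X? (λ x → ∑ (C? x) (λ _ → 1ℤ))               ≡⟨ ∑-swap X? C? Y? (λ y x → X? x ×-dec x ⊑? y)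
                                                        (λ x y Mx (My , x⊑y) → My , (Mx , x⊑y)) (λ x y My (Mx , x⊑y) → Mx , (My , x⊑y)) ⟩
    ∑ Y? (λ y → ∑ (λ x → X? x ×-dec x ⊑? y) (λ _ → 1ℤ)) ≤⟨ ∑-mono Y? (λ y My → line-atMostOne X? atoms ρl₂ (l⋢ y My)) ⟩
    ∑ Y? (λ _ → 1ℤ)                                ∎
    where
    open ℤ.≤-Reasoning
    X? = miss? p e l (ρ e)
    Y? = miss? G G′ Z (suc k)
    C? : ∀ x → Decidable (λ y → Miss G G′ Z (suc k) y × x ⊑ y)
    C? x y = Y? y ×-dec x ⊑? y
    ρl₂ : ρ l ≡ suc (suc (ρ p))
    ρl₂ = trans ρl (cong suc ρe)
    atoms : ∀ x → Miss p e l (ρ e) x → AtomOf p l x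
    atoms x ((p⊑x , x⊑l , ρx) , _) = p⊑x , x⊑l , trans ρx ρe
    G′≡ : G′ ≡ G ⊔ e
    G′≡ = join-unique (restrict A e⊑G′) MG G⊑G′ e⊑G′ ρG′
    x⋢G′ : ∀ x → Miss p e l (ρ e) x → ¬ x ⊑ G′
    x⋢G′ x Mx@(_ , e⋢x) x⊑G′ = l⋢G′ (line-span (atoms x Mx) (p⊑e , e⊑l , ρe) ρl₂
      (λ x≡e → e⋢x (subst (e ⊑_) (sym x≡e) (⊑-refl e))) x⊑G′ e⊑G′)
    l⋢ : ∀ y → Miss G G′ Z (suc k) y → ¬ l ⊑ y
    l⋢ y ((G⊑y , _ , _) , G′⋢y) l⊑y = G′⋢y (subst (_⊑ y) (sym G′≡) (lub G e y G⊑y (⊑-trans e⊑l l⊑y)))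
    cover : ∀ x → Miss p e l (ρ e) x → Miss G G′ Z (suc k) (G ⊔ x) × x ⊑ (G ⊔ x)
    cover x Mx@((p⊑x , x⊑l , ρx) , _) = ((ub₁ G x , lub G x Z (⊑-trans G⊑G′ G′⊑Z) (⊑-trans x⊑l l⊑Z) , ρGx) , G′⋢) , ub₂ G x
      where
      ρGx : ρ (G ⊔ x) ≡ suc k
      ρGx = trans (ρ-⊔ p⊑x (trans ρx ρe) p⊑G (λ x⊑G → x⋢G′ x Mx (⊑-trans x⊑G G⊑G′))) (cong suc ρG)
      G′⋢ : ¬ G′ ⊑ (G ⊔ x)
      G′⋢ G′⊑ = x⋢G′ x Mx (subst (x ⊑_) (sym (ρ-inj G′⊑ (ℕ.≤-reflexive (trans ρGx (sym ρG′))))) (ub₂ G x))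

  private
    coverExcess≥0 : ∀ {p Z e k} → ρ Z ≡ suc (suc k) → ∀ G′ → Itv e Z (suc k) G′
      → 0ℤ ≤ℤ ∑ (miss? p e G′ k) (λ G → N G G′ Z (suc k) - 1ℤ)
    coverExcess≥0 {p} {Z} {e} {k} ρZ G′ (_ , G′⊑Z , ρG′) = ∑-nonneg (miss? p e G′ k)
      (λ G ((_ , G⊑G′ , ρG) , _) → i≤j⇒0≤j-i (1≤N (G⊑G′ , G′⊑Z , trans ρG′ (cong suc (sym ρG))) ρZ))

  -- Turns long lines below into rank-2 intervals `[G, Z]` with many atoms. If no line through `e`
  -- has three atoms, `τ` is 0. Otherwise fix such a line `l`. By `τ-offLine` the rest of `τ` is
  -- distributed over the hyperplanes `G′` through `e` not containing `l`, and `l` makes every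
  -- `[G, Z]` with `G` a hyperplane of `G′` avoiding `e` long.
  τ≤coverExcess : ∀ {p Z e k} → AtomOf p Z e → ρ Z ≡ suc (suc k)
    → τ p e Z ≤ℤ ∑ (itv? e Z (suc k)) (λ G′ → ∑ (miss? p e G′ k) (λ G → N G G′ Z (suc k) - 1ℤ))
  τ≤coverExcess {p} {Z} {e} {k} A ρZ with any? (λ l → itv? e Z (suc (ρ e)) l ×-dec (1ℤ ℤ.≤? (N p e l (ρ e) - 1ℤ)))
  ... | no none = ≤-trans (≤-reflexive (∑-vanish (itv? e Z (suc (ρ e))) small)) (∑-nonneg (itv? e Z (suc k)) (coverExcess≥0 ρZ))
    where
    small : ∀ l → AtomOf e Z l → N p e l (ρ e) - 1ℤ ≡ 0ℤ
    small l Al = ℤ.≤-antisym (ℤ.i<j⇒i≤pred[j] (ℤ.≰⇒> (λ le → none (l , Al , le)))) (0≤τ-term A Al)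
  ... | yes (l , Al , 1≤ω) = begin
    τ p e Z
      ≤⟨ τ-offLine A Al ρZ ⟩
    ω + ∑ M? (τ p e)
      ≤⟨ ℤ.+-monoˡ-≤ (∑ M? (τ p e)) (≤-trans (≤-reflexive (sym (*-identityʳ ω))) (*-monoˡ 0≤ω (1≤N Al ρZ))) ⟩
    ω * ∑ M? (λ _ → 1ℤ) + ∑ M? (τ p e)
      ≡⟨ trans (cong (λ z → z + ∑ M? (τ p e)) (sym (∑-const M? ω))) (sym (∑-+ M? (λ _ → ω) (τ p e))) ⟩
    ∑ M? (λ G′ → ω + τ p e G′)
      ≤⟨ ∑-mono M? step ⟩
    ∑ M? E
      ≤⟨ ≤-by (∑-nonneg (itv? l Z (suc k)) (λ G′ (l⊑G′ , G′⊑Z , ρG′) → coverExcess≥0 ρZ G′ (⊑-trans (proj₁ Al) l⊑G′ , G′⊑Z , ρG′)))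
           (trans (cong (λ z → z - ∑ M? E) (∑-splitAtom Al (suc k) E)) (cancel (∑ (itv? l Z (suc k)) E) (∑ M? E))) ⟩
    ∑ (itv? e Z (suc k)) E ∎
    where
    open ℤ.≤-Reasoning
    ω : ℤ
    ω = N p e l (ρ e) - 1ℤ
    0≤ω : 0ℤ ≤ℤ ω
    0≤ω = 0≤τ-term A Al
    M? = miss? e l Z (suc k)
    E : Fin m → ℤ
    E G′ = ∑ (miss? p e G′ k) (λ G → N G G′ Z (suc k) - 1ℤ)
    cancel : ∀ a b → a + b - b ≡ a
    cancel = solve-∀
    dist : ∀ w t → w * (1ℤ + t) - (w + t) ≡ (w - 1ℤ) * t
    dist = solve-∀
    step : ∀ G′ → Miss e l Z (suc k) G′ → ω + τ p e G′ ≤ℤ E G′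
    step G′ MG′@((e⊑G′ , G′⊑Z , ρG′) , _) = begin
      -- This first inequality is where the third atom of `l`, in the form `1 ≤ ω`, enters.
      ω + τ p e G′                         ≤⟨ ≤-by (0≤* (i≤j⇒0≤j-i 1≤ω) (0≤τ (restrict A e⊑G′))) (dist ω (τ p e G′)) ⟩
      ω * (1ℤ + τ p e G′)                  ≤⟨ *-monoˡ 0≤ω (1+τ≤N (restrict A e⊑G′) ρG′) ⟩
      ω * N p e G′ k                       ≡⟨ sym (∑-const (miss? p e G′ k) ω) ⟩
      ∑ (miss? p e G′ k) (λ _ → ω)         ≤⟨ ∑-mono (miss? p e G′ k) (λ G MG → ℤ.+-monoˡ-≤ (- 1ℤ) (N-line≤N-cover A Al MG′ MG)) ⟩
      E G′                                 ∎

  0≤Z : ∀ j {p q k} → ρ q ≡ j ℕ.+ k → 0ℤ ≤ℤ ∑ (itv? p q k) (λ G → at G q - + j)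
  0≤Z j {p} {q} {k} ρq = ∑-nonneg (itv? p q k) (λ G (_ , G⊑q , ρG) →
    i≤j⇒0≤j-i (rank≤at j G⊑q (trans ρq (cong (j ℕ.+_) (sym ρG)))))

  -- Each flat is weighted by the excess above it. The coefficient `binZ i j` is the number of flats
  -- of rank `i` without line points in a near pencil, the only ones above which the line persists.
  -- For `G` avoiding `e` and `G′ = G ⊔ e`, `at-split` divides the excess of `[G, q]` into that of
  -- `[G′, q]` and `τ G G′ q`; the latter sum is bounded by `τ≤coverExcess`.
  Z-lower : ∀ i j {p q k} → p ⊑ q → k ≡ i ℕ.+ ρ p → ρ q ≡ suc j ℕ.+ k
    → (at p q - + (i ℕ.+ suc j)) * binZ i j ≤ℤ ∑ (itv? p q k) (λ G → at G q - + suc j)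
  Z-lower i zero {p} {q} p⊑q keq ρq = ≤-trans (≤-reflexive (*-zeroʳ (at p q - + (i ℕ.+ 1)))) (0≤Z 1 ρq)
  Z-lower zero (suc j) {p} {q} p⊑q keq ρq = ≤-reflexive (trans (*-identityʳ (at p q - + suc (suc j)))
    (sym (W-atBottom (λ G → at G q - + suc (suc j)) p⊑q keq)))
  Z-lower (suc i) (suc j) {p} {q} {k} p⊑q keq ρq with atomExists (suc i) (suc j) p⊑q keq ρq
  ... | e , A@(p⊑e , e⊑q , ρe) = begin
    (at p q - (1ℤ + + (i ℕ.+ suc (suc j)))) * bin (suc i) j
      ≡⟨ cong (λ y → (y - (1ℤ + r)) * bin (suc i) j) (at-split A) ⟩
    (1ℤ + at e q + τ p e q - (1ℤ + r)) * bin (suc i) j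
      ≡⟨ alg₁ (at e q) (τ p e q) r (bin (suc i) j) ⟩
    (at e q - r) * bin (suc i) j + τ p e q * bin (suc i) j
      ≡⟨ cong (λ z → (at e q - r) * z + τ p e q * bin (suc i) j) (pascal i j) ⟩
    (at e q - r) * (bin i j + binZ (suc i) j) + τ p e q * bin (suc i) j
      ≡⟨ alg₂ (at e q - r) (bin i j) (binZ (suc i) j) (τ p e q * bin (suc i) j) ⟩
    (at e q - r) * bin i j + ((at e q - r) * binZ (suc i) j + τ p e q * bin (suc i) j)
      ≡⟨ cong (λ n → (at e q - r) * bin i j + ((at e q - + n) * binZ (suc i) j + τ p e q * bin (suc i) j)) (ℕ.+-suc i (suc j)) ⟩
    (at e q - r) * bin i j + ((at e q - + (suc i ℕ.+ suc j)) * binZ (suc i) j + τ p e q * bin (suc i) j)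
      ≤⟨ +-mono-≤ (Z-lower i (suc j) e⊑q (atomLevel i A keq) ρq)
           (+-mono-≤ (Z-lower (suc i) j e⊑q (atomLevel′ (suc i) A keq) ρq′)
             (∑-τ (suc (suc k)) (bin (suc i) j) A
               (λ l Al → W-bin (suc i) j (proj₁ (proj₂ Al)) (lineLevel (suc i) A Al (cong (λ z → suc (suc z)) keq)) ρq″))) ⟩
    ∑ (itv? e q k) ψ + (∑ (itv? e q (suc k)) χ + ∑ (itv? e q (suc (suc k))) (τ p e))
      ≤⟨ ℤ.+-monoʳ-≤ (∑ (itv? e q k) ψ) (+-mono-≤ (∑-mono (itv? e q (suc k)) once) excess) ⟩
    ∑ (itv? e q k) ψ + (∑ (itv? e q (suc k)) (λ G′ → ∑ (miss? p e G′ k) (λ _ → χ G′)) + ∑ (itv? e q (suc k)) (λ G′ → ∑ (miss? p e G′ k) (λ G → τ G G′ q)))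
      ≡⟨ cong (λ z → ∑ (itv? e q k) ψ + z) avoiding ⟩
    ∑ (itv? e q k) ψ + ∑ (itv? e q (suc k)) (λ G′ → ∑ (miss? p e G′ k) ψ)
      ≡⟨ trans (cong (λ z → ∑ (itv? e q k) ψ + z) (sym (∑-fibres A k ψ))) (sym (∑-splitAtom A k ψ)) ⟩
    ∑ (itv? p q k) ψ ∎
    where
    open ℤ.≤-Reasoning
    r = + (i ℕ.+ suc (suc j))
    ψ χ : Fin m → ℤ
    ψ G = at G q - + suc (suc j)
    χ G = at G q - + suc j
    ρq′ : ρ q ≡ suc j ℕ.+ suc k
    ρq′ = trans ρq (cong suc (sym (ℕ.+-suc j k)))
    ρq″ : ρ q ≡ j ℕ.+ suc (suc k)
    ρq″ = trans ρq′ (sym (ℕ.+-suc j (suc k)))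
    alg₁ : ∀ a t r b → (1ℤ + a + t - (1ℤ + r)) * b ≡ (a - r) * b + t * b
    alg₁ = solve-∀
    alg₂ : ∀ a b c d → a * (b + c) + d ≡ a * b + (a * c + d)
    alg₂ = solve-∀
    alg₃ : ∀ a t j → a - j + t ≡ 1ℤ + a + t - (1ℤ + j)
    alg₃ = solve-∀
    pascal : ∀ i j → bin (suc i) j ≡ bin i j + binZ (suc i) j
    pascal i zero    = sym (trans (+-identityʳ (bin i 0)) (bin-zeroʳ i))
    pascal i (suc j) = refl
    once : ∀ G′ → Itv e q (suc k) G′ → χ G′ ≤ℤ ∑ (miss? p e G′ k) (λ _ → χ G′)
    once G′ (e⊑G′ , G′⊑q , ρG′) = let A′ = restrict A e⊑G′
                                      (G , MG) = missingHyperplane k A′ (⊑-refl p) (⊑-of A′) (atom⋢base A) ρG′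
      in ∑-member (miss? p e G′ k) {λ _ → χ G′} G MG
           (λ _ _ → i≤j⇒0≤j-i (rank≤at (suc j) G′⊑q (trans ρq′ (cong (suc j ℕ.+_) (sym ρG′)))))
    -- Unfolded, `τ G G′ q` is a sum over the covers `Z` of `G′`, so summing over `Z` first gives
    -- the right side of `τ≤coverExcess`.
    excess : ∑ (itv? e q (suc (suc k))) (τ p e) ≤ℤ ∑ (itv? e q (suc k)) (λ G′ → ∑ (miss? p e G′ k) (λ G → τ G G′ q))
    excess = ≤-trans (∑-mono (itv? e q (suc (suc k))) (λ Z (e⊑Z , _ , ρZ) → τ≤coverExcess (restrict A e⊑Z) ρZ)) (≤-reflexive
      (trans (∑-swap (itv? e q (suc (suc k))) (λ Z → itv? e Z (suc k)) (itv? e q (suc k)) (λ G′ → itv? G′ q (suc (suc k)))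
          (λ Z G′ (e⊑Z , Z⊑q , ρZ) (e⊑G′ , G′⊑Z , ρG′) → (e⊑G′ , ⊑-trans G′⊑Z Z⊑q , ρG′) , (G′⊑Z , Z⊑q , ρZ))
          (λ Z G′ (e⊑G′ , G′⊑q , ρG′) (G′⊑Z , Z⊑q , ρZ) → (⊑-trans e⊑G′ G′⊑Z , Z⊑q , ρZ) , (e⊑G′ , G′⊑Z , ρG′)))
        (∑-cong (itv? e q (suc k)) (λ G′ (_ , _ , ρG′) → trans
          (∑-swap (itv? G′ q (suc (suc k))) (λ _ → miss? p e G′ k) (miss? p e G′ k) (λ _ → itv? G′ q (suc (suc k)))
            (λ Z G I M → M , I) (λ Z G M I → I , M))
          (∑-cong (miss? p e G′ k) (λ G _ → cong (λ n → ∑ (itv? G′ q (suc n)) (λ Z → N G G′ Z n - 1ℤ)) (sym ρG′)))))))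
    avoiding : ∑ (itv? e q (suc k)) (λ G′ → ∑ (miss? p e G′ k) (λ _ → χ G′)) + ∑ (itv? e q (suc k)) (λ G′ → ∑ (miss? p e G′ k) (λ G → τ G G′ q))
      ≡ ∑ (itv? e q (suc k)) (λ G′ → ∑ (miss? p e G′ k) ψ)
    avoiding = trans (sym (∑-+ (itv? e q (suc k)) (λ G′ → ∑ (miss? p e G′ k) (λ _ → χ G′)) (λ G′ → ∑ (miss? p e G′ k) (λ G → τ G G′ q))))
      (∑-cong (itv? e q (suc k)) (λ G′ (_ , G′⊑q , ρG′) → trans (sym (∑-+ (miss? p e G′ k) (λ _ → χ G′) (λ G → τ G G′ q)))
        (∑-cong (miss? p e G′ k) (λ G ((_ , G⊑G′ , ρG) , _) → trans (alg₃ (at G′ q) (τ G G′ q) (+ suc j))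
          (cong (λ z → z - + suc (suc j)) (sym (at-split (G⊑G′ , G′⊑q , trans ρG′ (cong suc (sym ρG))))))))))

-- The lower bound

∑split-+ : ∀ {Φ Ψ} S → ∑split (λ A B → Φ A B + Ψ A B) S ≡ ∑split Φ S + ∑split Ψ S
∑split-+ [] = refl
∑split-+ (false ∷ bs) = ∑split-+ bs
∑split-+ {Φ} {Ψ} (true ∷ bs) = trans (cong (λ z → Φ [] bs + Ψ [] bs + z) (∑split-+ bs))
  (+-interchange (Φ [] bs) (Ψ [] bs) _ _)

∑split-* : ∀ c {Φ} S → ∑split (λ A B → c * Φ A B) S ≡ c * ∑split Φ S
∑split-* c [] = sym (*-zeroʳ c)
∑split-* c (false ∷ bs) = ∑split-* c bs
∑split-* c {Φ} (true ∷ bs) = trans (cong (λ z → c * Φ [] bs + z) (∑split-* c bs)) (sym (*-distribˡ-+ c (Φ [] bs) _))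

module LowerBound {m : ℕ} (L : GeometricLattice m) where

  open Flags L
  open AtomCounts L
  open Hyperplanes L
  open WhitneyNumbers L

  Bound : ℕ → Set
  Bound n = ∀ S → length S ℕ.≤ n → ∀ {p q} → p ⊑ q → ρ q ≡ suc (length S) ℕ.+ ρ p
    → hB 1 S + (at p q - + suc (length S)) * hC 1 S ≤ℤ h p q (suc (ρ p)) S

  bound₀ : ∀ {n} → Bound n → ∀ S → length S ℕ.≤ suc n → ∀ {p q} → p ⊑ q → ρ q ≡ length S ℕ.+ ρ p
    → hB 0 S + (at p q - + length S) * hC 0 S ≤ℤ h p q (ρ p) S
  bound₀ ih [] l {p} {q} p⊑q ρq = ≤-reflexive (1+x*0≡1 (at p q - 0ℤ))
  bound₀ ih (true ∷ bs) l {p} {q} p⊑q ρq = ≤-reflexive (trans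
    (trans (cong (λ z → z + x * 0ℤ) (hB-true bs)) (alg x))
    (sym (trans (cong (λ z → z - h p q (suc (ρ p)) bs) (∑-bottom (λ x → h x q (suc (ρ p)) bs) p⊑q)) (ℤ.+-inverseʳ (h p q (suc (ρ p)) bs)))))
    where
    x = at p q - + suc (length bs)
    alg : ∀ x → 0ℤ + x * 0ℤ ≡ 0ℤ
    alg = solve-∀
  bound₀ ih (false ∷ bs) (ℕ.s≤s l) p⊑q ρq = ih bs l p⊑q ρq

  private
    module Step {n} (ih : Bound n) {p q e} (A→ : AtomOf p q e) (A B : List Bool)
      (lA : length A ℕ.≤ n) (lB : length B ℕ.≤ n) {r} (lengths : length A ℕ.+ suc (length B) ≡ r) (ρq : ρ q ≡ suc r ℕ.+ ρ p) where

      open ℤ.≤-Reasoning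

      a b k : ℕ
      a = length A
      b = length B
      k = suc (ρ p) ℕ.+ a

      p⊑e = proj₁ A→
      e⊑q = proj₁ (proj₂ A→)

      k≡ : k ≡ suc a ℕ.+ ρ p
      k≡ = cong suc (ℕ.+-comm (ρ p) a)

      ρq′ : ρ q ≡ b ℕ.+ suc k
      ρq′ = trans ρq (trans (cong (λ r → suc r ℕ.+ ρ p) (sym lengths)) (rearrange a b (ρ p)))
        where
        rearrange : ∀ a b s → suc (a ℕ.+ suc b) ℕ.+ s ≡ b ℕ.+ suc (suc s ℕ.+ a)
        rearrange = ℕSolver.solve-∀

      r≡ : + (suc a ℕ.+ b) ≡ + r
      r≡ = cong +_ (trans (sym (ℕ.+-suc a b)) lengths)

      β c u₀ u₁ δ T : ℤ
      β = hB 1 A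
      c = hC 1 A
      u₀ = hB 0 B
      u₁ = hC 0 B
      δ = at e q - + r
      T = τ p e q

      0≤c = 0≤hC1 A
      0≤β-c = i≤j⇒0≤j-i (hC1≤hB1 A)
      0≤β = ≤-trans 0≤c (hC1≤hB1 A)
      0≤u₀ = 0≤hB0 B
      0≤u₁ = 0≤hC0 B

      u : Fin m → ℤ
      u G = h G q (suc k) B

      G? = itv? e q (suc k)

      u-lower : ∀ G → G ⊑ q → ρ G ≡ suc k → u₀ + (at G q - + b) * u₁ ≤ℤ u G
      u-lower G G⊑q ρG = subst (λ t → u₀ + (at G q - + b) * u₁ ≤ℤ h G q t B) ρG
        (bound₀ ih B (ℕ.m≤n⇒m≤1+n lB) G⊑q (trans ρq′ (cong (b ℕ.+_) (sym ρG))))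

      0≤corank : ∀ G → G ⊑ q → ρ G ≡ suc k → 0ℤ ≤ℤ at G q - + b
      0≤corank G G⊑q ρG = i≤j⇒0≤j-i (rank≤at b G⊑q (trans ρq′ (cong (b ℕ.+_) (sym ρG))))

      u₀≤u : ∀ G → G ⊑ q → ρ G ≡ suc k → u₀ ≤ℤ u G
      u₀≤u G G⊑q ρG = ≤-trans (≤-by (0≤* (0≤corank G G⊑q ρG) 0≤u₁) (x+y-x≡y u₀ ((at G q - + b) * u₁))) (u-lower G G⊑q ρG)

      fibre : Fin m → ℤ
      fibre G = ∑ (miss? p e G k) (λ F → h p F (suc (ρ p)) A)

      -- The induction hypothesis for `[p, F]` is `(β - c) + c * (at p F - + suc a + 1ℤ)` with
      -- nonnegative coefficients. Summed over the `F` below `G`, the constant part is bounded by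
      -- `1+τ≤N` and the other by `∑-missing-at`.
      fibre-lower : ∀ G → Itv e q (suc k) G → β * τ p e G + ((β - c) + c * (at e G - + suc a + 1ℤ)) ≤ℤ fibre G
      fibre-lower G (e⊑G , G⊑q , ρG) = begin
        β * τ p e G + ((β - c) + c * (at e G - + suc a + 1ℤ))
          ≡⟨ alg₁ β c (τ p e G) (at e G) (+ suc a) ⟩
        (β - c) * (1ℤ + τ p e G) + c * (1ℤ + at e G + τ p e G - + suc a)
          ≡⟨ cong (λ z → (β - c) * (1ℤ + τ p e G) + c * (z - + suc a)) (sym (at-split AG)) ⟩
        (β - c) * (1ℤ + τ p e G) + c * (at p G - + suc a)
          ≤⟨ +-mono-≤ (*-monoˡ 0≤β-c (1+τ≤N AG ρG)) (*-monoˡ 0≤c missing) ⟩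
        (β - c) * N p e G k + c * ∑ M? (λ F → at p F - + suc a + 1ℤ)
          ≡⟨ trans (cong₂ _+_ (sym (∑-const M? (β - c))) (sym (∑-* M? c (λ F → at p F - + suc a + 1ℤ))))
               (sym (∑-+ M? (λ _ → β - c) (λ F → c * (at p F - + suc a + 1ℤ)))) ⟩
        ∑ M? (λ F → (β - c) + c * (at p F - + suc a + 1ℤ))
          ≤⟨ ∑-mono M? (λ F ((p⊑F , _ , ρF) , _) → ≤-trans (≤-reflexive (alg₂ β c (at p F) (+ suc a))) (ih A lA p⊑F (trans ρF k≡))) ⟩
        fibre G ∎
        where
        AG = restrict A→ e⊑G
        M? = miss? p e G k
        missing : at p G - + suc a ≤ℤ ∑ M? (λ F → at p F - + suc a + 1ℤ)
        missing = subst (λ k → at p G - + suc a ≤ℤ ∑ (miss? p e G k) (λ F → at p F - + suc a + 1ℤ)) (sym k≡)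
          (∑-missing-at (suc a) AG (trans ρG (cong suc k≡)))
        alg₁ : ∀ β c t x s → β * t + ((β - c) + c * (x - s + 1ℤ)) ≡ (β - c) * (1ℤ + t) + c * (1ℤ + x + t - s)
        alg₁ = solve-∀
        alg₂ : ∀ β c x s → (β - c) + c * (x - s + 1ℤ) ≡ β + (x - s) * c
        alg₂ = solve-∀

      ∑uτ : T * (bin a b * u₀) ≤ℤ ∑ G? (λ G → u G * τ p e G)
      ∑uτ = τ-weighted (suc k) (bin a b * u₀) u A→ perLine
        where
        perLine : ∀ l → AtomOf e q l → bin a b * u₀ ≤ℤ ∑ (itv? l q (suc k)) u
        perLine l Al@(_ , l⊑q , _) = begin
          bin a b * u₀                          ≡⟨ *-comm (bin a b) u₀ ⟩
          u₀ * bin a b                          ≤⟨ *-monoˡ 0≤u₀ (W-bin a b l⊑q (lineLevel a A→ Al (cong suc k≡)) ρq′) ⟩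
          u₀ * W l q (suc k)                    ≡⟨ sym (∑-const (itv? l q (suc k)) u₀) ⟩
          ∑ (itv? l q (suc k)) (λ _ → u₀)       ≤⟨ ∑-mono (itv? l q (suc k)) (λ G (_ , G⊑q , ρG) → u₀≤u G G⊑q ρG) ⟩
          ∑ (itv? l q (suc k)) u                ∎

      level : suc k ≡ suc a ℕ.+ ρ e
      level = atomLevel′ (suc a) A→ k≡

      ∑corank : δ * bin↓↓ a b ≤ℤ ∑ G? (λ G → at G q - + b)
      ∑corank = go b refl
        where
        bin↓↓≡binZ : ∀ b → bin↓↓ a (suc b) ≡ binZ (suc a) b
        bin↓↓≡binZ zero    = refl
        bin↓↓≡binZ (suc b) = refl
        go : ∀ b′ → b ≡ b′ → δ * bin↓↓ a b′ ≤ℤ ∑ G? (λ G → at G q - + b′)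
        go zero eq = ≤-trans (≤-reflexive (*-zeroʳ δ)) (0≤Z 0 (trans ρq′ (cong (ℕ._+ suc k) eq)))
        go (suc b′) eq = ≤-trans
          (≤-reflexive (cong₂ (λ x y → (at e q - x) * y) (trans (sym r≡) (cong (λ b → + (suc a ℕ.+ b)) eq)) (bin↓↓≡binZ b′)))
          (Z-lower (suc a) b′ e⊑q level (trans ρq′ (cong (ℕ._+ suc k) eq)))

      ∑u : (bin (suc a) b + δ * bin↓ a b) * u₀ + (δ * bin↓↓ a b) * u₁ ≤ℤ ∑ G? u
      ∑u = begin
        (bin (suc a) b + δ * bin↓ a b) * u₀ + (δ * bin↓↓ a b) * u₁
          ≡⟨ cong₂ _+_ (*-comm _ u₀) (*-comm _ u₁) ⟩
        u₀ * (bin (suc a) b + δ * bin↓ a b) + u₁ * (δ * bin↓↓ a b)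
          ≤⟨ +-mono-≤ (*-monoˡ 0≤u₀ (subst (λ z → bin (suc a) b + (at e q - z) * bin↓ a b ≤ℤ W e q (suc k)) r≡ (W-lower (suc a) b e⊑q level ρq′)))
               (*-monoˡ 0≤u₁ ∑corank) ⟩
        u₀ * W e q (suc k) + u₁ * ∑ G? (λ G → at G q - + b)
          ≡⟨ trans (cong₂ _+_ (sym (∑-const G? u₀)) (sym (∑-* G? u₁ (λ G → at G q - + b)))) (sym (∑-+ G? (λ _ → u₀) (λ G → u₁ * (at G q - + b)))) ⟩
        ∑ G? (λ G → u₀ + u₁ * (at G q - + b))
          ≤⟨ ∑-mono G? (λ G (_ , G⊑q , ρG) → ≤-trans (≤-reflexive (cong (λ z → u₀ + z) (*-comm u₁ (at G q - + b)))) (u-lower G G⊑q ρG)) ⟩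
        ∑ G? u ∎

      ∑u-at : (bin (suc a) b + δ * bin a b) * u₀ + (δ * bin↓↓ a b) * u₁ ≤ℤ ∑ G? (λ G → u G * (at e G - + suc a + 1ℤ))
      ∑u-at = begin
        (bin (suc a) b + δ * bin a b) * u₀ + (δ * bin↓↓ a b) * u₁
          ≡⟨ cong₂ _+_ (*-comm _ u₀) (*-comm _ u₁) ⟩
        u₀ * (bin (suc a) b + δ * bin a b) + u₁ * (δ * bin↓↓ a b)
          ≤⟨ +-mono-≤ (*-monoˡ 0≤u₀ (subst (λ z → bin (suc a) b + (at e q - z) * bin a b ≤ℤ ∑ G? w) r≡ (V-lower (suc a) b e⊑q level ρq′)))
               (*-monoˡ 0≤u₁ ∑corank) ⟩
        u₀ * ∑ G? w + u₁ * ∑ G? (λ G → at G q - + b)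
          ≡⟨ trans (cong₂ _+_ (sym (∑-* G? u₀ w)) (sym (∑-* G? u₁ (λ G → at G q - + b)))) (sym (∑-+ G? (λ G → u₀ * w G) (λ G → u₁ * (at G q - + b)))) ⟩
        ∑ G? (λ G → u₀ * w G + u₁ * (at G q - + b))
          ≤⟨ ∑-mono G? pointwise ⟩
        ∑ G? (λ G → u G * w G) ∎
        where
        w : Fin m → ℤ
        w G = at e G - + suc a + 1ℤ
        alg : ∀ u u₀ u₁ x s t →
          u * (x - s + 1ℤ) - (u₀ * (x - s + 1ℤ) + u₁ * t) ≡ (u - (u₀ + t * u₁)) * (x - s + 1ℤ) + (t * u₁) * (x - s)
        alg = solve-∀
        -- The product of the lower bounds for `u G` and `w G` is weakened by using only `1 ≤ w G`
        -- against the `u₁` term. In a near pencil this loses nothing: `[e, G]` and `[G, q]` do not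
        -- both have positive excess.
        pointwise : ∀ G → Itv e q (suc k) G → u₀ * w G + u₁ * (at G q - + b) ≤ℤ u G * w G
        pointwise G (e⊑G , G⊑q , ρG) = ≤-by
          (0≤+ (0≤* (i≤j⇒0≤j-i (u-lower G G⊑q ρG)) (0≤+ 0≤x (0≤pos 1))) (0≤* (0≤* (0≤corank G G⊑q ρG) 0≤u₁) 0≤x))
          (alg (u G) u₀ u₁ (at e G) (+ suc a) (at G q - + b))
          where
          0≤x : 0ℤ ≤ℤ at e G - + suc a
          0≤x = i≤j⇒0≤j-i (rank≤at (suc a) e⊑G (trans ρG level))

      -- `T` and `δ` are the two parts of the excess of `[p, q]`; they multiply the line form and
      -- the coloop form of the summand of `hC 1 S`. Regrouped, everything is a combination of the
      -- left sides of `∑uτ`, `∑u` and `∑u-at` with the nonnegative coefficients `β`, `β - c` and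
      -- `c`.
      term : bin (suc a) b * (β * u₀) + (T * (bin a b * (β * u₀))
          + δ * (bin← a b * (c * u₀) + bin↓ a b * (β * u₀) + bin↓↓ a b * (β * u₁)))
        ≤ℤ ∑ (miss? p e q k) (λ F → h p F (suc (ρ p)) A * h (F ⊔ e) q (suc k) B)
      term = begin
        bin (suc a) b * (β * u₀) + (T * (bin a b * (β * u₀)) + δ * (bin← a b * (c * u₀) + bin↓ a b * (β * u₀) + bin↓↓ a b * (β * u₁)))
          ≡⟨ cong (λ z → bin (suc a) b * (β * u₀) + (T * (z * (β * u₀)) + δ * (bin← a b * (c * u₀) + bin↓ a b * (β * u₀) + bin↓↓ a b * (β * u₁))))
               (bin↓-bin← a b) ⟩
        bin (suc a) b * (β * u₀) + (T * ((x + y) * (β * u₀)) + δ * (x * (c * u₀) + y * (β * u₀) + bin↓↓ a b * (β * u₁)))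
          ≡⟨ alg₁ (bin (suc a) b) β c u₀ u₁ T δ x y (bin↓↓ a b) ⟩
        β * (T * ((x + y) * u₀)) + ((β - c) * ((bin (suc a) b + δ * y) * u₀ + (δ * bin↓↓ a b) * u₁)
          + c * ((bin (suc a) b + δ * (x + y)) * u₀ + (δ * bin↓↓ a b) * u₁))
          ≡⟨ cong (λ z → β * (T * (z * u₀)) + ((β - c) * ((bin (suc a) b + δ * y) * u₀ + (δ * bin↓↓ a b) * u₁)
               + c * ((bin (suc a) b + δ * z) * u₀ + (δ * bin↓↓ a b) * u₁))) (sym (bin↓-bin← a b)) ⟩
        β * (T * (bin a b * u₀)) + ((β - c) * ((bin (suc a) b + δ * y) * u₀ + (δ * bin↓↓ a b) * u₁)
          + c * ((bin (suc a) b + δ * bin a b) * u₀ + (δ * bin↓↓ a b) * u₁))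
          ≤⟨ +-mono-≤ (*-monoˡ 0≤β ∑uτ) (+-mono-≤ (*-monoˡ 0≤β-c ∑u) (*-monoˡ 0≤c ∑u-at)) ⟩
        β * ∑ G? (λ G → u G * τ p e G) + ((β - c) * ∑ G? u + c * ∑ G? (λ G → u G * (at e G - + suc a + 1ℤ)))
          ≡⟨ trans (cong₂ _+_ (sym (∑-* G? β (λ G → u G * τ p e G))) (trans (cong₂ _+_ (sym (∑-* G? (β - c) u))
               (sym (∑-* G? c (λ G → u G * (at e G - + suc a + 1ℤ))))) (sym (∑-+ G? (λ G → (β - c) * u G) (λ G → c * (u G * (at e G - + suc a + 1ℤ)))))))
               (sym (∑-+ G? (λ G → β * (u G * τ p e G)) (λ G → (β - c) * u G + c * (u G * (at e G - + suc a + 1ℤ))))) ⟩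
        ∑ G? (λ G → β * (u G * τ p e G) + ((β - c) * u G + c * (u G * (at e G - + suc a + 1ℤ))))
          ≡⟨ ∑-cong G? (λ G _ → alg₂ β c (u G) (τ p e G) (at e G - + suc a + 1ℤ)) ⟩
        ∑ G? (λ G → u G * (β * τ p e G + ((β - c) + c * (at e G - + suc a + 1ℤ))))
          ≤⟨ ∑-mono G? (λ G I@(_ , G⊑q , ρG) → *-monoˡ (≤-trans 0≤u₀ (u₀≤u G G⊑q ρG)) (fibre-lower G I)) ⟩
        ∑ G? (λ G → u G * fibre G)
          ≡⟨ ∑-cong G? (λ G (e⊑G , G⊑q , ρG) → trans (sym (∑-* (miss? p e G k) (u G) (λ F → h p F (suc (ρ p)) A)))
               (∑-cong (miss? p e G k) (λ F M@((_ , F⊑G , _) , _) → trans (*-comm (u G) (h p F (suc (ρ p)) A))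
                 (cong (λ z → h p F (suc (ρ p)) A * h z q (suc k) B) (join-unique (restrict A→ e⊑G) M F⊑G e⊑G ρG))))) ⟩
        ∑ G? (λ G → ∑ (miss? p e G k) (λ F → h p F (suc (ρ p)) A * h (F ⊔ e) q (suc k) B))
          ≡⟨ sym (∑-fibres A→ k (λ F → h p F (suc (ρ p)) A * h (F ⊔ e) q (suc k) B)) ⟩
        ∑ (miss? p e q k) (λ F → h p F (suc (ρ p)) A * h (F ⊔ e) q (suc k) B) ∎
        where
        x = bin← a b
        y = bin↓ a b
        alg₁ : ∀ d β c u v T δ x y z →
          d * (β * u) + (T * ((x + y) * (β * u)) + δ * (x * (c * u) + y * (β * u) + z * (β * v)))
          ≡ β * (T * ((x + y) * u)) + ((β - c) * ((d + δ * y) * u + (δ * z) * v) + c * ((d + δ * (x + y)) * u + (δ * z) * v))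
        alg₁ = solve-∀
        alg₂ : ∀ β c u t w → β * (u * t) + ((β - c) * u + c * (u * w)) ≡ u * (β * t + ((β - c) + c * w))
        alg₂ = solve-∀

  bound : ∀ n → Bound n
  bound-step : ∀ n → Bound n → ∀ S → length S ℕ.≤ suc n → ∀ {p q} → p ⊑ q → ρ q ≡ suc (length S) ℕ.+ ρ p
    → hB 1 S + (at p q - + suc (length S)) * hC 1 S ≤ℤ h p q (suc (ρ p)) S

  bound zero [] l {p} {q} p⊑q ρq = ≤-reflexive (1+x*0≡1 (at p q - 1ℤ))
  bound (suc n) S l p⊑q ρq = bound-step n (bound n) S l p⊑q ρq

  bound-step n ih S l {p} {q} p⊑q ρq with someAtom (length S) p⊑q ρq
  ... | e , A→@(p⊑e , e⊑q , ρe) = begin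
    hB 1 S + (at p q - + suc (length S)) * hC 1 S
      ≡⟨ cong (λ z → hB 1 S + (z - + suc (length S)) * hC 1 S) (at-split A→) ⟩
    hB 1 S + (1ℤ + at e q + T - (1ℤ + + length S)) * hC 1 S
      ≡⟨ alg₁ (hB 1 S) (at e q) T (+ length S) (hC 1 S) ⟩
    hB 1 S + (T * hC 1 S + δ * hC 1 S)
      ≡⟨ cong₂ _+_ (hB-split 0 S) (cong₂ (λ y z → T * y + δ * z) (hC-split-line 0 S) (hC-split-coloop 0 S)) ⟩
    (hB 0 S + ∑split Φb S) + (T * ∑split Φl S + δ * (hC 0 S + ∑split Φc S))
      ≡⟨ alg₂ (hB 0 S) (∑split Φb S) T (∑split Φl S) δ (hC 0 S) (∑split Φc S) ⟩
    (hB 0 S + δ * hC 0 S) + (∑split Φb S + (T * ∑split Φl S + δ * ∑split Φc S))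
      ≡⟨ cong (λ z → (hB 0 S + δ * hC 0 S) + z) (sym (trans (∑split-+ S) (cong (λ z → ∑split Φb S + z)
           (trans (∑split-+ S) (cong₂ _+_ (∑split-* T S) (∑split-* δ S)))))) ⟩
    (hB 0 S + δ * hC 0 S) + ∑split (λ A B → Φb A B + (T * Φl A B + δ * Φc A B)) S
      -- What the splittings leave over, `hB 0 S + δ * hC 0 S`, is the bound for `[e, q]`, that is,
      -- for the chains with all members above `e`.
      ≤⟨ +-mono-≤ first (∑split-mono S (λ A B eq → Step.term ih A→ A B (proj₁ (short A B eq)) (proj₂ (short A B eq)) eq ρq)) ⟩
    h (p ⊔ e) q (suc (ρ p)) S + ∑split (λ A B → ∑ (miss? p e q (suc (ρ p) ℕ.+ length A))
        (λ F → h p F (suc (ρ p)) A * h (F ⊔ e) q (suc (suc (ρ p) ℕ.+ length A)) B)) S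
      ≡⟨ sym (h-split e p q (suc (ρ p)) S) ⟩
    h p q (suc (ρ p)) S ∎
    where
    open ℤ.≤-Reasoning
    T = τ p e q
    δ = at e q - + length S
    Φb Φl Φc : List Bool → List Bool → ℤ
    Φb A B = bin (1 ℕ.+ length A) (length B) * (hB 1 A * hB 0 B)
    Φl A B = bin (length A) (length B) * (hB 1 A * hB 0 B)
    Φc A B = bin← (length A) (length B) * (hC 1 A * hB 0 B) + bin↓ (length A) (length B) * (hB 1 A * hB 0 B)
      + bin↓↓ (length A) (length B) * (hB 1 A * hC 0 B)
    alg₁ : ∀ b x t s c → b + (1ℤ + x + t - (1ℤ + s)) * c ≡ b + (t * c + (x - s) * c)
    alg₁ = solve-∀
    alg₂ : ∀ b x t l d c y → (b + x) + (t * l + d * (c + y)) ≡ (b + d * c) + (x + (t * l + d * y))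
    alg₂ = solve-∀
    p⊔e≡e : p ⊔ e ≡ e
    p⊔e≡e = ⊑-antisym (p ⊔ e) e (lub p e e p⊑e (⊑-refl e)) (ub₂ p e)
    first : hB 0 S + δ * hC 0 S ≤ℤ h (p ⊔ e) q (suc (ρ p)) S
    first = subst₂ (λ x t → hB 0 S + δ * hC 0 S ≤ℤ h x q t S) (sym p⊔e≡e) ρe (bound₀ ih S l e⊑q (corank A→ ρq))
    short : ∀ A B → length A ℕ.+ suc (length B) ≡ length S → length A ℕ.≤ n × length B ℕ.≤ n
    short A B eq = ℕ.m+n≤o⇒m≤o (length A) sum≤n , ℕ.m+n≤o⇒n≤o (length A) sum≤n
      where
      sum≤n : length A ℕ.+ length B ℕ.≤ n
      sum≤n = ℕ.≤-pred (ℕ.≤-trans (ℕ.≤-reflexive (trans (sym (ℕ.+-suc (length A) (length B))) eq)) l)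

  h-lower : ∀ S {p q} → p ⊑ q → ρ q ≡ suc (length S) ℕ.+ ρ p
    → hB 1 S + (at p q - + suc (length S)) * hC 1 S ≤ℤ h p q (suc (ρ p)) S
  h-lower S = bound (length S) S ℕ.≤-refl

-- The recursion for the flag h-vector

∑L : {X : Set} → (X → ℤ) → List X → ℤ
∑L f xs = foldr _+_ 0ℤ (map f xs)

∑L-cong : {X : Set} {f g : X → ℤ} (xs : List X) → All (λ x → f x ≡ g x) xs → ∑L f xs ≡ ∑L g xs
∑L-cong []       []         = refl
∑L-cong (x ∷ xs) (eq ∷ eqs) = cong₂ _+_ eq (∑L-cong xs eqs)

∑L-cong′ : {X : Set} {f g : X → ℤ} (xs : List X) → (∀ x → f x ≡ g x) → ∑L f xs ≡ ∑L g xs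
∑L-cong′ xs eq = ∑L-cong xs (All.universal eq xs)

∑L-++ : {X : Set} (f : X → ℤ) (xs ys : List X) → ∑L f (xs ++ ys) ≡ ∑L f xs + ∑L f ys
∑L-++ f []       ys = sym (+-identityˡ _)
∑L-++ f (x ∷ xs) ys = trans (cong (λ z → f x + z) (∑L-++ f xs ys)) (sym (ℤ.+-assoc (f x) _ _))

∑L-map : {X Y : Set} (f : X → ℤ) (g : Y → X) (ys : List Y) → ∑L f (map g ys) ≡ ∑L (f ∘ g) ys
∑L-map f g []       = refl
∑L-map f g (y ∷ ys) = cong (λ z → f (g y) + z) (∑L-map f g ys)

∑L-* : {X : Set} (c : ℤ) (f : X → ℤ) (xs : List X) → ∑L (λ x → c * f x) xs ≡ c * ∑L f xs
∑L-* c f []       = sym (*-zeroʳ c)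
∑L-* c f (x ∷ xs) = trans (cong (λ z → c * f x + z) (∑L-* c f xs)) (sym (*-distribˡ-+ c (f x) _))

∑L-+ : {X : Set} (f g : X → ℤ) (xs : List X) → ∑L (λ x → f x + g x) xs ≡ ∑L f xs + ∑L g xs
∑L-+ f g []       = refl
∑L-+ f g (x ∷ xs) = trans (cong (λ z → f x + g x + z) (∑L-+ f g xs)) (+-interchange (f x) (g x) _ _)

∑L-zero : {X : Set} (xs : List X) → ∑L (λ _ → 0ℤ) xs ≡ 0ℤ
∑L-zero []       = refl
∑L-zero (x ∷ xs) = trans (+-identityˡ _) (∑L-zero xs)

∑L-swap : {X Y : Set} (f : X → Y → ℤ) (xs : List X) (ys : List Y) → ∑L (λ x → ∑L (f x) ys) xs ≡ ∑L (λ y → ∑L (λ x → f x y) xs) ys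
∑L-swap f []       ys = sym (∑L-zero ys)
∑L-swap f (x ∷ xs) ys = trans (cong (λ z → ∑L (f x) ys + z) (∑L-swap f xs ys)) (sym (∑L-+ (f x) (λ y → ∑L (λ x → f x y) xs) ys))

guard : Bool → ℤ → ℤ
guard b v = if b then v else 0ℤ

module Alternating (Q : FinRankedPoset) where

  open FinRankedPoset Q

  below : Maybe Carrier → Carrier → Bool
  below nothing  x = true
  below (just y) x = leq y x

  hrec : Maybe Carrier → List ℕ → ℤ
  hrec p []       = 1ℤ
  hrec p (t ∷ ts) = ∑L (λ x → guard ((rk x ≡ᵇ t) ∧ below p x) (hrec (just x) ts)) elems - hrec p ts

  private
    +sumℕ : ∀ {X : Set} (b : X → Bool) (f : X → ℕ) (xs : List X)
      → + sumℕ (map (λ x → if b x then f x else 0) xs) ≡ ∑L (λ x → guard (b x) (+ f x)) xs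
    +sumℕ b f [] = refl
    +sumℕ b f (x ∷ xs) with b x
    ... | true  = cong (λ z → + f x + z) (+sumℕ b f xs)
    ... | false = trans (+sumℕ b f xs) (sym (+-identityˡ _))

    chains-cons : ∀ p t ts → + chainCount Q p (t ∷ ts)
      ≡ ∑L (λ x → guard ((rk x ≡ᵇ t) ∧ below p x) (+ chainCount Q (just x) ts)) elems
    chains-cons nothing  t ts = +sumℕ (λ x → (rk x ≡ᵇ t) ∧ true) (λ x → chainCount Q (just x) ts) elems
    chains-cons (just y) t ts = +sumℕ (λ x → (rk x ≡ᵇ t) ∧ leq y x) (λ x → chainCount Q (just x) ts) elems

    sublists-short : ∀ (ts : List ℕ) → All (λ T → length T ℕ.≤ length ts) (sublists ts)
    sublists-short []       = ℕ.z≤n ∷ []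
    sublists-short (t ∷ ts) = All.++⁺ (All.map ℕ.m≤n⇒m≤1+n (sublists-short ts)) (All.map⁺ (All.map ℕ.s≤s (sublists-short ts)))

  alternating : Maybe Carrier → List ℕ → ℤ
  alternating p ts = ∑L (λ T → sign (length ts ∸ length T) * + chainCount Q p T) (sublists ts)

  -- The sublists are sorted by whether they contain the first rank; those omitting it carry the
  -- opposite sign. As `∸` truncates, the change of sign needs the bound on their lengths.
  alternating≡hrec : ∀ p ts → alternating p ts ≡ hrec p ts
  alternating≡hrec p []       = refl
  alternating≡hrec p (t ∷ ts) = begin
    ∑L F (sublists ts ++ map (t ∷_) (sublists ts))
      ≡⟨ trans (∑L-++ F (sublists ts) (map (t ∷_) (sublists ts))) (cong (λ z → ∑L F (sublists ts) + z) (∑L-map F (t ∷_) (sublists ts))) ⟩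
    ∑L F (sublists ts) + ∑L (λ T → sign (length ts ∸ length T) * + chainCount Q p (t ∷ T)) (sublists ts)
      ≡⟨ cong₂ _+_ without with-t ⟩
    - hrec p ts + ∑L (λ x → guard ((rk x ≡ᵇ t) ∧ below p x) (hrec (just x) ts)) elems
      ≡⟨ ℤ.+-comm (- hrec p ts) _ ⟩
    hrec p (t ∷ ts) ∎
    where
    open ≡-Reasoning
    F : List ℕ → ℤ
    F T = sign (suc (length ts) ∸ length T) * + chainCount Q p T
    g : Carrier → Bool
    g x = (rk x ≡ᵇ t) ∧ below p x
    neg : ∀ s c → (- s) * c ≡ (- 1ℤ) * (s * c)
    neg = solve-∀
    neg₁ : ∀ x → (- 1ℤ) * x ≡ - x
    neg₁ = solve-∀
    without : ∑L F (sublists ts) ≡ - hrec p ts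
    without = trans (∑L-cong (sublists ts) (All.map (λ {T} short →
        trans (cong (λ k → sign k * + chainCount Q p T) (ℕ.+-∸-assoc 1 short)) (neg (sign (length ts ∸ length T)) (+ chainCount Q p T)))
        (sublists-short ts)))
      (trans (∑L-* (- 1ℤ) (λ T → sign (length ts ∸ length T) * + chainCount Q p T) (sublists ts))
        (trans (cong (λ z → (- 1ℤ) * z) (alternating≡hrec p ts)) (neg₁ (hrec p ts))))
    guard-* : ∀ b c v → c * guard b v ≡ guard b (c * v)
    guard-* true  c v = refl
    guard-* false c v = *-zeroʳ c
    guard-∑ : ∀ b {X : Set} (f : X → ℤ) xs → ∑L (λ x → guard b (f x)) xs ≡ guard b (∑L f xs)
    guard-∑ true  f xs = refl
    guard-∑ false f xs = ∑L-zero xs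
    with-t : ∑L (λ T → sign (length ts ∸ length T) * + chainCount Q p (t ∷ T)) (sublists ts)
      ≡ ∑L (λ x → guard (g x) (hrec (just x) ts)) elems
    with-t = begin
      ∑L (λ T → sign (length ts ∸ length T) * + chainCount Q p (t ∷ T)) (sublists ts)
        ≡⟨ ∑L-cong′ (sublists ts) (λ T → trans (cong (λ z → sign (length ts ∸ length T) * z) (chains-cons p t T))
             (trans (sym (∑L-* (sign (length ts ∸ length T)) (λ x → guard (g x) (+ chainCount Q (just x) T)) elems))
               (∑L-cong′ elems (λ x → guard-* (g x) (sign (length ts ∸ length T)) (+ chainCount Q (just x) T))))) ⟩
      ∑L (λ T → ∑L (λ x → guard (g x) (sign (length ts ∸ length T) * + chainCount Q (just x) T)) elems) (sublists ts)
        ≡⟨ ∑L-swap _ (sublists ts) elems ⟩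
      ∑L (λ x → ∑L (λ T → guard (g x) (sign (length ts ∸ length T) * + chainCount Q (just x) T)) (sublists ts)) elems
        ≡⟨ ∑L-cong′ elems (λ x → trans (guard-∑ (g x) _ (sublists ts)) (cong (guard (g x)) (alternating≡hrec (just x) ts))) ⟩
      ∑L (λ x → guard (g x) (hrec (just x) ts)) elems ∎

ranksFrom : ℕ → List Bool → List ℕ
ranksFrom t []           = []
ranksFrom t (true ∷ bs)  = t ∷ ranksFrom (suc t) bs
ranksFrom t (false ∷ bs) = ranksFrom (suc t) bs

private
  filter-ranks : ∀ {k r} (S : Vec Bool k) t (p : Fin r → Bool) (val : Fin r → ℕ) (g : Fin k → Fin r)
    → (∀ i → p (g i) ≡ lookup S i) → (∀ i → val (g i) ≡ t ℕ.+ toℕ i)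
    → map val (filter (λ i → p i Bool.≟ true) (tabulate g)) ≡ ranksFrom t (toList S)
  filter-ranks []          t p val g pe ve = refl
  filter-ranks (b ∷ S) t p val g pe ve with p (g zero) | pe zero
  ... | true  | refl = cong₂ _∷_ (trans (ve zero) (ℕ.+-identityʳ t))
    (filter-ranks S (suc t) p val (g ∘ suc) (pe ∘ suc) (λ i → trans (ve (suc i)) (ℕ.+-suc t (toℕ i))))
  ... | false | refl = filter-ranks S (suc t) p val (g ∘ suc) (pe ∘ suc) (λ i → trans (ve (suc i)) (ℕ.+-suc t (toℕ i)))

ranks≡ranksFrom : ∀ {r} (S : Subset r) → ranks S ≡ ranksFrom 1 (toList S)
ranks≡ranksFrom S = filter-ranks S 1 (lookup S) (λ i → suc (toℕ i)) (λ i → i) (λ _ → refl) (λ _ → refl)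

hS≡hrec : ∀ {r} Q (S : Subset r) → hS Q S ≡ Alternating.hrec Q nothing (ranksFrom 1 (toList S))
hS≡hrec Q S = trans (Alternating.alternating≡hrec Q nothing (ranks S)) (cong (Alternating.hrec Q nothing) (ranks≡ranksFrom S))

opaque
  unfolding ∑F

  ∑L-tabulate : ∀ {k} {X : Set} (f : X → ℤ) (g : Fin k → X) → ∑L f (tabulate g) ≡ ∑F (f ∘ g)
  ∑L-tabulate {zero}  f g = refl
  ∑L-tabulate {suc k} f g = cong (λ z → f (g zero) + z) (∑L-tabulate f (g ∘ suc))

opaque
  unfolding ∑

  ∑L-allFin : ∀ {m} {P : Fin m → Set} (P? : Decidable P) (b : Fin m → Bool) (f : Fin m → ℤ)
    → (∀ x → b x ≡ true → P x) → (∀ x → P x → b x ≡ true) → ∑L (λ x → guard (b x) (f x)) (allFin m) ≡ ∑ P? f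
  ∑L-allFin P? b f to from = trans (∑L-tabulate (λ x → guard (b x) (f x)) (λ x → x)) (∑F-cong (λ x → go x (b x) refl))
    where
    go : ∀ x c → b x ≡ c → guard c (f x) ≡ when (P? x) (f x)
    go x true  eq = sym (when-yes (P? x) (to x eq))
    go x false eq = sym (when-no (P? x) (λ Px → case trans (sym eq) (from x Px) of λ ()))

≡ᵇ-sound : ∀ a b → (a ≡ᵇ b) ≡ true → a ≡ b
≡ᵇ-sound a b eq = ℕ.≡ᵇ⇒≡ a b (subst Bool.T (sym eq) _)

≡ᵇ-complete : ∀ {a b} → a ≡ b → (a ≡ᵇ b) ≡ true
≡ᵇ-complete {zero}  refl = refl
≡ᵇ-complete {suc a} refl = ≡ᵇ-complete {a} refl

∧-true : ∀ {a b} → a ∧ b ≡ true → a ≡ true × b ≡ true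
∧-true {true} {true} refl = refl , refl

∧-intro : ∀ {a b} → a ≡ true → b ≡ true → a ∧ b ≡ true
∧-intro refl refl = refl

private
  allᵇ-tabulate⁻ : ∀ {k} {X : Set} (p : X → Bool) (g : Fin k → X) → allᵇ p (tabulate g) ≡ true → ∀ i → p (g i) ≡ true
  allᵇ-tabulate⁻ p g eq zero    = proj₁ (∧-true eq)
  allᵇ-tabulate⁻ p g eq (suc i) = allᵇ-tabulate⁻ p (g ∘ suc) (proj₂ (∧-true {p (g zero)} eq)) i

  allᵇ-tabulate⁺ : ∀ {k} {X : Set} (p : X → Bool) (g : Fin k → X) → (∀ i → p (g i) ≡ true) → allᵇ p (tabulate g) ≡ true
  allᵇ-tabulate⁺ {zero}  p g eq = refl
  allᵇ-tabulate⁺ {suc k} p g eq = ∧-intro (eq zero) (allᵇ-tabulate⁺ p (g ∘ suc) (eq ∘ suc))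

allᵇ⁻ : ∀ {k} (p : Fin k → Bool) → allᵇ p (allFin k) ≡ true → ∀ i → p i ≡ true
allᵇ⁻ p = allᵇ-tabulate⁻ p (λ i → i)

allᵇ⁺ : ∀ {k} (p : Fin k → Bool) → (∀ i → p i ≡ true) → allᵇ p (allFin k) ≡ true
allᵇ⁺ p = allᵇ-tabulate⁺ p (λ i → i)

-- The recursion in a geometric lattice

module LatticeChains {m : ℕ} (L : GeometricLattice m) where

  open Flags L
  open AtomCounts L
  open GeometricLattice L using (asPoset; numAtoms; isAtomᵇ)
  open Alternating asPoset

  hrec≡h : ∀ p t bs → hrec (just p) (ranksFrom t bs) ≡ h p top t bs
  hrec≡h p t []           = refl
  hrec≡h p t (false ∷ bs) = hrec≡h p (suc t) bs
  hrec≡h p t (true ∷ bs)  = cong₂ _-_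
    (trans (∑L-cong′ (allFin m) (λ x → cong (guard ((ρ x ≡ᵇ t) ∧ le p x)) (hrec≡h x (suc t) bs)))
      (∑L-allFin (itv? p top t) (λ x → (ρ x ≡ᵇ t) ∧ le p x) (λ x → h x top (suc t) bs)
        (λ x eq → proj₂ (∧-true {ρ x ≡ᵇ t} eq) , top-max x , ≡ᵇ-sound (ρ x) t (proj₁ (∧-true eq)))
        (λ x (p⊑x , _ , ρx) → ∧-intro (≡ᵇ-complete ρx) p⊑x)))
    (hrec≡h p (suc t) bs)

  hrec-nothing : ∀ ts → hrec nothing ts ≡ hrec (just bot) ts
  hrec-nothing []       = refl
  hrec-nothing (t ∷ ts) = cong₂ _-_
    (∑L-cong′ (allFin m) (λ x → cong (λ b → guard ((ρ x ≡ᵇ t) ∧ b) (hrec (just x) ts)) (sym (bot-min x))))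
    (hrec-nothing ts)

  numAtoms≡at : + numAtoms ≡ at bot top
  numAtoms≡at = trans (length-filter-allFin (λ x → isAtomᵇ x Bool.≟ true))
    (∑-⇔ (λ x → isAtomᵇ x Bool.≟ true) (itv? bot top (suc (ρ bot))) to from (λ _ _ → refl))
    where
    test : Fin m → Fin m → Bool
    test a z = not (le bot z ∧ le z a) ∨ ⌊ z Fin.≟ bot ⌋ ∨ ⌊ z Fin.≟ a ⌋
    to : ∀ a → isAtomᵇ a ≡ true → AtomOf bot top a
    to a eq with ∧-true {le bot a} eq
    ... | bot⊑a , eq′ with ∧-true {not (⌊ bot Fin.≟ a ⌋)} eq′
    ...   | bot≢a , eq″ = bot⊑a , top-max a , ρ-cover bot a (bot⊑a , ne bot≢a , ends)
      where
      ne : not (⌊ bot Fin.≟ a ⌋) ≡ true → bot ≢ a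
      ne _ _ with bot Fin.≟ a
      ne () _ | yes _
      ne _ bot≡a | no bot≢a = bot≢a bot≡a
      ends : ∀ z → bot ⊑ z → z ⊑ a → z ≡ bot ⊎ z ≡ a
      ends z bot⊑z z⊑a with allᵇ⁻ (test a) eq″ z
      ... | tz rewrite bot⊑z | z⊑a with z Fin.≟ bot | z Fin.≟ a
      ...   | yes z≡bot | _       = inj₁ z≡bot
      ...   | no _      | yes z≡a = inj₂ z≡a
      ends z bot⊑z z⊑a | () | no _ | no _
    from : ∀ a → AtomOf bot top a → isAtomᵇ a ≡ true
    from a (bot⊑a , _ , ρa) = ∧-intro bot⊑a (∧-intro distinct (allᵇ⁺ (test a) passes))
      where
      bot≢a : bot ≢ a
      bot≢a eq = ℕ.1+n≢n (trans (sym ρa) (cong ρ (sym eq)))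
      distinct : not (⌊ bot Fin.≟ a ⌋) ≡ true
      distinct with bot Fin.≟ a
      ... | yes eq = ⊥-elim (bot≢a eq)
      ... | no _   = refl
      passes : ∀ z → test a z ≡ true
      passes z with le bot z ∧ le z a in eq
      ... | false = refl
      ... | true with z Fin.≟ bot | z Fin.≟ a
      ...   | yes _ | _     = refl
      ...   | no _  | yes _ = refl
      ...   | no z≢bot | no z≢a = ⊥-elim (ℕ.<⇒≱ (subst (ρ z ℕ.<_) ρa (ρ-strict z⊑a z≢a)) (ρ-strict bot⊑z (z≢bot ∘ sym)))
        where
        bot⊑z = proj₁ (∧-true {le bot z} eq)
        z⊑a   = proj₂ (∧-true {le bot z} eq)

-- The near pencil

bit : Bool → ℕ
bit true  = 1
bit false = 0

cF : ∀ {n} → (Fin n → Bool) → ℕ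
cF {zero}  p = 0
cF {suc n} p = bit (p zero) ℕ.+ cF (p ∘ suc)

countᵇ≡cF : ∀ {n} (p : Fin n → Bool) → countᵇ p (allFin n) ≡ cF p
countᵇ≡cF {n} p = go (λ i → i)
  where
  go : ∀ {k} (g : Fin k → Fin n) → countᵇ p (tabulate g) ≡ cF (p ∘ g)
  go {zero}  g = refl
  go {suc k} g with p (g zero)
  ... | true  = cong suc (go (g ∘ suc))
  ... | false = go (g ∘ suc)

cF-cong : ∀ {n} {p q : Fin n → Bool} → (∀ i → p i ≡ q i) → cF p ≡ cF q
cF-cong {zero}  eq = refl
cF-cong {suc n} eq = cong₂ (λ x y → bit x ℕ.+ y) (eq zero) (cF-cong (eq ∘ suc))

cF-mono : ∀ {n} {p q : Fin n → Bool} → (∀ i → p i ≡ true → q i ≡ true) → cF p ℕ.≤ cF q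
cF-mono {zero}  le = ℕ.z≤n
cF-mono {suc n} {p} {q} le = ℕ.+-mono-≤ (bit-mono (le zero)) (cF-mono (le ∘ suc))
  where
  bit-mono : ∀ {a b} → (a ≡ true → b ≡ true) → bit a ℕ.≤ bit b
  bit-mono {false} f = ℕ.z≤n
  bit-mono {true}  f = subst (λ b → 1 ℕ.≤ bit b) (sym (f refl)) ℕ.≤-refl

cF-update : ∀ {n} (p q : Fin n → Bool) i → p i ≡ false → q i ≡ true → (∀ k → k ≢ i → p k ≡ q k) → cF q ≡ suc (cF p)
cF-update p q zero pi qi eq = trans (cong₂ (λ b y → bit b ℕ.+ y) qi (cF-cong (λ k → sym (eq (suc k) λ ()))))
  (cong (λ b → suc (bit b ℕ.+ cF (p ∘ suc))) (sym pi))
cF-update p q (suc i) pi qi eq = trans (cong₂ (λ b y → bit b ℕ.+ y) (sym (eq zero λ ()))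
    (cF-update (p ∘ suc) (q ∘ suc) i pi qi (λ k k≢i → eq (suc k) (λ { refl → k≢i refl }))))
  (ℕ.+-suc (bit (p zero)) _)

cF-complement : ∀ {n} (p : Fin n → Bool) → cF p ℕ.+ cF (not ∘ p) ≡ n
cF-complement {zero}  p = refl
cF-complement {suc n} p with p zero
... | true  = cong suc (cF-complement (p ∘ suc))
... | false = trans (ℕ.+-suc _ _) (cong suc (cF-complement (p ∘ suc)))

cF-initial : ∀ n c → c ℕ.< n → cF {n} (λ i → toℕ i ≤ᵇ c) ≡ suc c
cF-initial (suc n) zero    _         = cong suc (none n)
  where
  none : ∀ n → cF {n} (λ _ → false) ≡ 0
  none zero    = refl
  none (suc n) = none n
cF-initial (suc n) (suc c) (ℕ.s≤s l) = cong suc (trans (cF-cong {n} (λ i → shift (toℕ i))) (cF-initial n c l))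
  where
  shift : ∀ x → (suc x ≤ᵇ suc c) ≡ (x ≤ᵇ c)
  shift zero    = refl
  shift (suc x) = refl

-- Counting supersets by their new elements

sub : ∀ {n} → Vec Bool n → Vec Bool n → Bool
sub []          []      = true
sub (true ∷ X)  (y ∷ Y) = y ∧ sub X Y
sub (false ∷ X) (y ∷ Y) = sub X Y

size : ∀ {n} → (Fin n → Bool) → Vec Bool n → ℕ
size on X = cF (λ i → lookup X i ∧ on i)

extra : ∀ {n} → (Fin n → Bool) → Vec Bool n → Vec Bool n → ℕ
extra on X Y = cF (λ i → (not (lookup X i) ∧ lookup Y i) ∧ on i)

free : ∀ {n} → (Fin n → Bool) → Vec Bool n → ℕ
free on X = cF (λ i → not (lookup X i) ∧ on i)

size-extra : ∀ {n} (on : Fin n → Bool) X Y → sub X Y ≡ true → size on Y ≡ size on X ℕ.+ extra on X Y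
size-extra on [] [] eq = refl
size-extra on (true ∷ X) (true ∷ Y) eq =
  trans (cong (bit (on zero) ℕ.+_) (size-extra (on ∘ suc) X Y eq)) (sym (ℕ.+-assoc (bit (on zero)) _ _))
size-extra on (false ∷ X) (false ∷ Y) eq = size-extra (on ∘ suc) X Y eq
size-extra on (false ∷ X) (true ∷ Y) eq = trans (cong (bit (on zero) ℕ.+_) (size-extra (on ∘ suc) X Y eq))
  (swap (bit (on zero)) (size (on ∘ suc) X) _)
  where
  swap : ∀ a b c → a ℕ.+ (b ℕ.+ c) ≡ b ℕ.+ (a ℕ.+ c)
  swap a b c = trans (sym (ℕ.+-assoc a b c)) (trans (cong (ℕ._+ c) (ℕ.+-comm a b)) (ℕ.+-assoc b a c))

size-free : ∀ {n} (on : Fin n → Bool) X → size on X ℕ.+ free on X ≡ cF on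
size-free on [] = refl
size-free on (true ∷ X) = trans (ℕ.+-assoc (bit (on zero)) _ _) (cong (bit (on zero) ℕ.+_) (size-free (on ∘ suc) X))
size-free on (false ∷ X) = trans (swap (size (on ∘ suc) X) (bit (on zero)) _) (cong (bit (on zero) ℕ.+_) (size-free (on ∘ suc) X))
  where
  swap : ∀ b a c → b ℕ.+ (a ℕ.+ c) ≡ a ℕ.+ (b ℕ.+ c)
  swap b a c = trans (sym (ℕ.+-assoc b a c)) (trans (cong (ℕ._+ c) (ℕ.+-comm b a)) (ℕ.+-assoc a b c))

-- The binomial coefficient (n choose k). Unlike `bin` it covers the vanishing case `k > n`, which
-- occurs when too few coloops are left.
ch : ℕ → ℕ → ℤ
ch n       zero    = 1ℤ
ch zero    (suc k) = 0ℤ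
ch (suc n) (suc k) = ch n (suc k) + ch n k

ch-large : ∀ n j → ch n (n ℕ.+ suc j) ≡ 0ℤ
ch-large zero    j = refl
ch-large (suc n) j = cong₂ _+_ (trans (cong (ch n) (sym (ℕ.+-suc n (suc j)))) (ch-large n (suc j))) (ch-large n j)

ch≡bin : ∀ x y → ch (x ℕ.+ y) x ≡ bin x y
ch≡bin zero    y       = refl
ch≡bin (suc x) zero    = trans (cong₂ _+_ (trans (cong (λ n → ch n (suc x)) (ℕ.+-identityʳ x))
  (trans (cong (ch x) (ℕ.+-comm 1 x)) (ch-large x 0))) (trans (ch≡bin x 0) (bin-zeroʳ x))) refl
ch≡bin (suc x) (suc y) = trans (ℤ.+-comm (ch (x ℕ.+ suc y) (suc x)) _) (cong₂ _+_ (ch≡bin x (suc y))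
  (trans (cong (λ n → ch n (suc x)) (ℕ.+-suc x y)) (ch≡bin (suc x) y)))

∑L-subsets : ∀ {n} (f : Subset (suc n) → ℤ)
  → ∑L f (allSubsets (suc n)) ≡ ∑L (λ Y → f (false ∷ Y)) (allSubsets n) + ∑L (λ Y → f (true ∷ Y)) (allSubsets n)
∑L-subsets {n} f = trans (∑L-++ f (map (false ∷_) (allSubsets n)) (map (true ∷_) (allSubsets n)))
  (cong₂ _+_ (∑L-map f (false ∷_) (allSubsets n)) (∑L-map f (true ∷_) (allSubsets n)))

ind : Bool → ℤ
ind b = guard b 1ℤ

extending : ∀ {n} → (Fin n → Bool) → Vec Bool n → ℕ → ℕ → Vec Bool n → ℤ
extending on X x y Y = ind (sub X Y ∧ ((extra on X Y ≡ᵇ x) ∧ (extra (not ∘ on) X Y ≡ᵇ y)))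

-- The new elements on the line and those off it are chosen independently, hence the product.
∑-extending : ∀ {n} (on : Fin n → Bool) X x y
  → ∑L (extending on X x y) (allSubsets n) ≡ ch (free on X) x * ch (free (not ∘ on) X) y
∑-extending on [] zero    zero    = refl
∑-extending on [] zero    (suc y) = refl
∑-extending on [] (suc x) zero    = refl
∑-extending on [] (suc x) (suc y) = refl
∑-extending {suc n} on (true ∷ X) x y = trans (∑L-subsets (extending on (true ∷ X) x y))
  (trans (cong (λ z → z + ∑L (extending (on ∘ suc) X x y) (allSubsets n)) (∑L-zero (allSubsets n)))
    (trans (+-identityˡ _) (∑-extending (on ∘ suc) X x y)))
∑-extending {suc n} on (false ∷ X) x y = trans (∑L-subsets (extending on (false ∷ X) x y))
  (trans (cong (λ z → z + ∑L (λ Y → extending on (false ∷ X) x y (true ∷ Y)) (allSubsets n)) (∑-extending (on ∘ suc) X x y))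
    (add (on zero) x y refl))
  where
  c₁ = free (on ∘ suc) X
  c₂ = free (not ∘ on ∘ suc) X
  vanish : {f : Subset n → ℤ} → (∀ Y → f Y ≡ 0ℤ) → ∑L f (allSubsets n) ≡ 0ℤ
  vanish eq = trans (∑L-cong′ (allSubsets n) eq) (∑L-zero (allSubsets n))
  dist₁ : ∀ a b c → a * c + b * c ≡ (a + b) * c
  dist₁ = solve-∀
  dist₂ : ∀ a b c → c * a + c * b ≡ c * (a + b)
  dist₂ = solve-∀
  add : ∀ b x y → on zero ≡ b
    → ch c₁ x * ch c₂ y + ∑L (λ Y → ind (sub X Y ∧ ((bit (on zero) ℕ.+ extra (on ∘ suc) X Y ≡ᵇ x)
        ∧ (bit (not (on zero)) ℕ.+ extra (not ∘ on ∘ suc) X Y ≡ᵇ y)))) (allSubsets n)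
    ≡ ch (bit (on zero) ℕ.+ c₁) x * ch (bit (not (on zero)) ℕ.+ c₂) y
  add true zero y eq rewrite eq = trans (cong (λ z → 1ℤ * ch c₂ y + z) (vanish (λ Y → cong ind (∧-zeroʳ (sub X Y))))) (+-identityʳ _)
  add true (suc x) y eq rewrite eq = trans (cong (λ z → ch c₁ (suc x) * ch c₂ y + z) (∑-extending (on ∘ suc) X x y))
    (dist₁ (ch c₁ (suc x)) (ch c₁ x) (ch c₂ y))
  add false x zero eq rewrite eq = trans (cong (λ z → ch c₁ x * 1ℤ + z)
    (vanish (λ Y → cong ind (trans (cong (sub X Y ∧_) (∧-zeroʳ _)) (∧-zeroʳ (sub X Y)))))) (+-identityʳ _)
  add false x (suc y) eq rewrite eq = trans (cong (λ z → ch c₁ x * ch c₂ (suc y) + z) (∑-extending (on ∘ suc) X x y))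
    (dist₂ (ch c₂ (suc y)) (ch c₂ y) (ch c₁ x))

private
  allF : ∀ {n} → (Fin n → Bool) → Bool
  allF {zero}  p = true
  allF {suc n} p = p zero ∧ allF (p ∘ suc)

  allᵇ-allF : ∀ {k n} (p : Fin n → Bool) (g : Fin k → Fin n) → allᵇ p (tabulate g) ≡ allF (p ∘ g)
  allᵇ-allF {zero}  p g = refl
  allᵇ-allF {suc k} p g = cong (p (g zero) ∧_) (allᵇ-allF p (g ∘ suc))

  allF-sub : ∀ {n} (X Y : Vec Bool n) → allF (λ i → not (lookup X i) ∨ lookup Y i) ≡ sub X Y
  allF-sub []          []      = refl
  allF-sub (true ∷ X)  (y ∷ Y) = cong (y ∧_) (allF-sub X Y)
  allF-sub (false ∷ X) (y ∷ Y) = allF-sub X Y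

bool-ext : ∀ {a b} → (a ≡ true → b ≡ true) → (b ≡ true → a ≡ true) → a ≡ b
bool-ext {true}          f g = sym (f refl)
bool-ext {false} {true}  f g = g refl
bool-ext {false} {false} f g = refl

≡ᵇ-false : ∀ {a b} → a ≢ b → (a ≡ᵇ b) ≡ false
≡ᵇ-false {a} {b} a≢b with a ≡ᵇ b in eq
... | true  = ⊥-elim (a≢b (≡ᵇ-sound a b eq))
... | false = refl

≡ᵇ-cancel : ∀ a {x y} → (a ℕ.+ x ≡ᵇ a ℕ.+ y) ≡ (x ≡ᵇ y)
≡ᵇ-cancel zero    = refl
≡ᵇ-cancel (suc a) = ≡ᵇ-cancel a

∑L-filter : {X : Set} (b : X → Bool) (f : X → ℤ) (xs : List X)
  → ∑L f (filter (λ x → b x Bool.≟ true) xs) ≡ ∑L (λ x → guard (b x) (f x)) xs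
∑L-filter b f [] = refl
∑L-filter b f (x ∷ xs) with b x
... | true  = cong (λ z → f x + z) (∑L-filter b f xs)
... | false = trans (∑L-filter b f xs) (sym (+-identityˡ _))

⊓2 : ∀ u → suc (suc u) ℕ.⊓ 2 ≡ 2
⊓2 u = cong (λ z → suc (suc z)) (ℕ.⊓-zeroʳ u)

-- Closedness depends only on the number `u` of line points contained: at most one or all `K` of
-- them. Coloops may be present or absent at will.
flatᵇ : ℕ → ℕ → Bool
flatᵇ K u = (u ≤ᵇ 1) ∨ (u ≡ᵇ K)

-- Flats and flags of the near pencil

module Pencils (r n K′ : ℕ) (line : cF (NearPencil.onLine r n) ≡ suc (suc K′)) where

  open NearPencil r n
  open Alternating nearPencil

  -- The numbers of line points and of coloops. The rank is `M + 2`, so `K′` is the excess of the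
  -- number of points over the rank.
  K M : ℕ
  K = suc (suc K′)
  M = cF (not ∘ onLine)

  lc cc : Subset n → ℕ
  lc = size onLine
  cc = size (not ∘ onLine)

  mrank≡ : ∀ X → mrank X ≡ (lc X ℕ.⊓ 2) ℕ.+ cc X
  mrank≡ X = cong₂ (λ x y → (x ℕ.⊓ 2) ℕ.+ y) (countᵇ≡cF (λ i → lookup X i ∧ onLine i)) (countᵇ≡cF (λ i → lookup X i ∧ not (onLine i)))

  private
    lookup-insert : ∀ X i k → lookup (insert X i) k ≡ lookup X k ∨ ⌊ i Fin.≟ k ⌋
    lookup-insert X i k = trans (lookup-zipWith _∨_ k X _) (cong (lookup X k ∨_)
      (trans (cong (λ v → lookup v k) (lookup∘tabulate (λ j → Vec.tabulate (λ k → ⌊ j Fin.≟ k ⌋)) i)) (lookup∘tabulate (λ k → ⌊ i Fin.≟ k ⌋) k)))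

    insert-self : ∀ X i → lookup (insert X i) i ≡ true
    insert-self X i = trans (lookup-insert X i i) (trans (cong (lookup X i ∨_) self) (∨-zeroʳ (lookup X i)))
      where
      self : ⌊ i Fin.≟ i ⌋ ≡ true
      self with i Fin.≟ i
      ... | yes _ = refl
      ... | no ¬p = ⊥-elim (¬p refl)

    insert-other : ∀ X i k → k ≢ i → lookup X k ≡ lookup (insert X i) k
    insert-other X i k k≢i = sym (trans (lookup-insert X i k) (trans (cong (lookup X k ∨_) other) (∨-identityʳ (lookup X k))))
      where
      other : ⌊ i Fin.≟ k ⌋ ≡ false
      other with i Fin.≟ k
      ... | yes i≡k = ⊥-elim (k≢i (sym i≡k))
      ... | no _    = refl

    size-insert : ∀ on X i → lookup X i ≡ false → on i ≡ true → size on (insert X i) ≡ suc (size on X)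
    size-insert on X i i∉X oni = cF-update _ _ i (cong (_∧ on i) i∉X) (trans (cong (_∧ on i) (insert-self X i)) oni)
      (λ k k≢i → cong (_∧ on k) (insert-other X i k k≢i))

    size-insert-off : ∀ on X i → on i ≡ false → size on (insert X i) ≡ size on X
    size-insert-off on X i offi = cF-cong same
      where
      same : ∀ k → lookup (insert X i) k ∧ on k ≡ lookup X k ∧ on k
      same k with k Fin.≟ i
      ... | no k≢i   = cong (_∧ on k) (sym (insert-other X i k k≢i))
      ... | yes refl = trans (cong (lookup (insert X i) i ∧_) offi) (trans (∧-zeroʳ _)
        (sym (trans (cong (lookup X i ∧_) offi) (∧-zeroʳ _))))

    newRank-line : ∀ X i → lookup X i ≡ false → onLine i ≡ true → mrank (insert X i) ≡ (suc (lc X) ℕ.⊓ 2) ℕ.+ cc X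
    newRank-line X i i∉X oni = trans (mrank≡ (insert X i)) (cong₂ (λ x y → (x ℕ.⊓ 2) ℕ.+ y) (size-insert onLine X i i∉X oni)
      (size-insert-off (not ∘ onLine) X i (cong not oni)))

    newRank-coloop : ∀ X i → lookup X i ≡ false → onLine i ≡ false → mrank (insert X i) ≡ suc (mrank X)
    newRank-coloop X i i∉X offi = trans (mrank≡ (insert X i)) (trans (cong₂ (λ x y → (x ℕ.⊓ 2) ℕ.+ y) (size-insert-off onLine X i offi)
      (size-insert (not ∘ onLine) X i i∉X (cong not offi))) (trans (ℕ.+-suc (lc X ℕ.⊓ 2) (cc X)) (cong suc (sym (mrank≡ X)))))

    test : Subset n → Fin n → Bool
    test X i = lookup X i ∨ not (mrank (insert X i) ≡ᵇ mrank X)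

    test-fails : ∀ X i → lookup X i ≡ false → mrank (insert X i) ≡ mrank X → test X i ≡ false
    test-fails X i i∉X eq rewrite i∉X = cong not (≡ᵇ-complete eq)

    test-passes : ∀ X i → (lookup X i ≡ false → mrank (insert X i) ≢ mrank X) → test X i ≡ true
    test-passes X i ne with lookup X i
    ... | true  = refl
    ... | false = cong not (≡ᵇ-false (ne refl))

    lineFull : ∀ X i → lc X ≡ K → lookup X i ≡ false → onLine i ≡ true → ⊥
    lineFull X i lcX i∉X oni = ℕ.<⇒≱ (ℕ.≤-reflexive (trans (cong suc line) (trans (cong suc (sym lcX)) (sym (size-insert onLine X i i∉X oni)))))
      (cF-mono {p = λ j → lookup (insert X i) j ∧ onLine j} {q = onLine} (λ j eq → proj₂ (∧-true {lookup (insert X i) j} eq)))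

  -- Adding a coloop always raises the rank. Adding a line point leaves it unchanged exactly if two
  -- are present already.
  isFlat≡ : ∀ X → isFlat X ≡ flatᵇ K (lc X)
  isFlat≡ X = bool-ext (λ eq → to (lc X) refl (allᵇ⁻ (test X) eq)) (λ eq → allᵇ⁺ (test X) (λ i → test-passes X i (from i eq)))
    where
    to : ∀ u → lc X ≡ u → (∀ i → test X i ≡ true) → flatᵇ K u ≡ true
    to zero          eq passes = refl
    to (suc zero)    eq passes = refl
    to (suc (suc u)) eq passes = ≡ᵇ-complete (trans (sym eq) (trans (cF-cong full) line))
      where
      full : ∀ i → lookup X i ∧ onLine i ≡ onLine i
      full i with onLine i in oni | lookup X i in Xi
      ... | false | b     = ∧-zeroʳ b
      ... | true  | true  = refl
      ... | true  | false = trans (sym (test-fails X i Xi (trans (newRank-line X i Xi oni) (trans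
          (cong (λ u → (suc u ℕ.⊓ 2) ℕ.+ cc X) eq) (sym (trans (mrank≡ X) (trans (cong (λ u → (u ℕ.⊓ 2) ℕ.+ cc X) eq)
            (cong (ℕ._+ cc X) (⊓2 u))))))))) (passes i)
    from : ∀ i → flatᵇ K (lc X) ≡ true → lookup X i ≡ false → mrank (insert X i) ≢ mrank X
    from i flat i∉X eq with onLine i in oni
    ... | false = ℕ.1+n≢n (trans (sym (newRank-coloop X i i∉X oni)) eq)
    ... | true  = clash (lc X) refl flat (trans (sym (newRank-line X i i∉X oni)) (trans eq (mrank≡ X)))
      where
      clash : ∀ u → lc X ≡ u → flatᵇ K u ≡ true → (suc (lc X) ℕ.⊓ 2) ℕ.+ cc X ≢ (lc X ℕ.⊓ 2) ℕ.+ cc X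
      clash zero          lcX _  e rewrite lcX = ℕ.1+n≢n e
      clash (suc zero)    lcX _  e rewrite lcX = ℕ.1+n≢n (ℕ.suc-injective e)
      clash (suc (suc u)) lcX fl e = lineFull X i (trans lcX (≡ᵇ-sound (suc (suc u)) K fl)) i∉X oni

  subset≡ : ∀ X Y → subsetᵇ X Y ≡ sub X Y
  subset≡ X Y = trans (allᵇ-allF (λ i → not (lookup X i) ∨ lookup Y i) (λ i → i)) (allF-sub X Y)

  private
    -- Two values suffice: above a flat without line points there is still a near pencil with the
    -- same line, while above any other flat the interval is Boolean.
    val : ℕ → ℤ → ℤ → ℤ
    val zero    ν₀ ν₁ = ν₀
    val (suc _) ν₀ ν₁ = ν₁

    both : ℕ → ℕ → ℕ → ℕ → ℤ
    both u w x y = ind ((u ≡ᵇ x) ∧ (w ≡ᵇ y))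

    both₋ : ℕ → ℕ → ℕ → ℕ → ℤ
    both₋ u w x zero    = 0ℤ
    both₋ u w x (suc y) = both u w x y

    guard-ind : ∀ b ν → guard b ν ≡ ind b * ν
    guard-ind true  ν = sym (*-identityˡ ν)
    guard-ind false ν = refl

    guard-zero : ∀ b → guard b 0ℤ ≡ 0ℤ
    guard-zero true  = refl
    guard-zero false = refl

    guard-guard : ∀ b c ν → guard b (guard c ν) ≡ ind (b ∧ c) * ν
    guard-guard true  c ν = guard-ind c ν
    guard-guard false c ν = refl

    -- The contribution of a flat with u line points and w coloops more than one with a line points and c coloops.
    contribution : ℕ → ℕ → ℕ → ℕ → ℕ → ℤ → ℤ → ℤ
    contribution a c γ u w ν₀ ν₁ =
      guard (flatᵇ K (a ℕ.+ u)) (guard ((((a ℕ.+ u) ℕ.⊓ 2) ℕ.+ (c ℕ.+ w)) ≡ᵇ (((a ℕ.⊓ 2) ℕ.+ c) ℕ.+ suc γ)) (val (a ℕ.+ u) ν₀ ν₁))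

    -- A flat without line points can acquire none, one or all `K` of them, which costs 0, 1 or 2
    -- ranks; coloops make up the rest of the rank difference `suc γ`. In the last case their number
    -- is γ - 1, whence the shift in `both₋`.
    contribution₀ : ∀ c γ u w ν₀ ν₁ → contribution 0 c γ u w ν₀ ν₁
      ≡ both u w 0 (suc γ) * ν₀ + (both u w 1 γ * ν₁ + both₋ u w K γ * ν₁)
    contribution₀ c γ zero w ν₀ ν₁ = trans (cong (λ b → guard b ν₀) (≡ᵇ-cancel c {w} {suc γ}))
      (trans (guard-ind (w ≡ᵇ suc γ) ν₀) (sym (trans (cong (λ z → ind (w ≡ᵇ suc γ) * ν₀ + (0ℤ + z)) (rest γ)) (+-identityʳ _))))
      where
      rest : ∀ γ → both₋ 0 w K γ * ν₁ ≡ 0ℤ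
      rest zero    = refl
      rest (suc γ) = refl
    contribution₀ c γ (suc zero) w ν₀ ν₁ = trans (cong (λ b → guard b ν₁) (trans (cong (suc (c ℕ.+ w) ≡ᵇ_) (ℕ.+-suc c γ)) (≡ᵇ-cancel c {w} {γ})))
      (trans (guard-ind (w ≡ᵇ γ) ν₁) (sym (trans (cong (λ z → 0ℤ + (ind (w ≡ᵇ γ) * ν₁ + z)) (rest γ)) (trans (+-identityˡ _) (+-identityʳ _)))))
      where
      rest : ∀ γ → both₋ 1 w K γ * ν₁ ≡ 0ℤ
      rest zero    = refl
      rest (suc γ) = refl
    contribution₀ c γ (suc (suc u)) w ν₀ ν₁ = trans (cong (λ b → guard (u ≡ᵇ K′) (guard b ν₁)) (trans
        (cong₂ _≡ᵇ_ (cong (ℕ._+ (c ℕ.+ w)) (⊓2 u)) (ℕ.+-suc c γ)) (trans (cong (_≡ᵇ (c ℕ.+ γ)) (sym (ℕ.+-suc c w))) (≡ᵇ-cancel c {suc w} {γ}))))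
      (sym (trans (+-identityˡ _) (trans (+-identityˡ _) (last γ))))
      where
      last : ∀ γ → both₋ (suc (suc u)) w K γ * ν₁ ≡ guard (u ≡ᵇ K′) (guard (suc w ≡ᵇ γ) ν₁)
      last zero    = sym (guard-zero (u ≡ᵇ K′))
      last (suc γ) = sym (guard-guard (u ≡ᵇ K′) (w ≡ᵇ γ) ν₁)

    contribution₁ : ∀ c γ u w ν₀ ν₁ → contribution 1 c γ u w ν₀ ν₁ ≡ both u w 0 (suc γ) * ν₁ + both u w (suc K′) γ * ν₁
    contribution₁ c γ zero w ν₀ ν₁ = trans (cong (λ b → guard b ν₁) (≡ᵇ-cancel c {w} {suc γ}))
      (trans (guard-ind (w ≡ᵇ suc γ) ν₁) (sym (+-identityʳ _)))
    contribution₁ c γ (suc u) w ν₀ ν₁ = trans (cong (λ b → guard (u ≡ᵇ K′) (guard b ν₁)) (trans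
        (cong₂ _≡ᵇ_ (cong (ℕ._+ (c ℕ.+ w)) (⊓2 u)) (cong suc (ℕ.+-suc c γ))) (≡ᵇ-cancel c {w} {γ})))
      (trans (guard-guard (u ≡ᵇ K′) (w ≡ᵇ γ) ν₁) (sym (+-identityˡ _)))

    contribution₂ : ∀ c γ u w ν₀ ν₁ → contribution K c γ u w ν₀ ν₁ ≡ both u w 0 (suc γ) * ν₁
    contribution₂ c γ zero w ν₀ ν₁ = trans (cong₂ (λ b b′ → guard b (guard b′ ν₁))
        (≡ᵇ-complete (ℕ.+-identityʳ K′))
        (trans (cong₂ (λ x y → (x ℕ.+ (c ℕ.+ w)) ≡ᵇ ((y ℕ.+ c) ℕ.+ suc γ)) (⊓2 (K′ ℕ.+ 0)) (⊓2 K′)) (≡ᵇ-cancel c {w} {suc γ})))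
      (guard-ind (w ≡ᵇ suc γ) ν₁)
    contribution₂ c γ (suc u) w ν₀ ν₁ = cong (λ b → guard b (guard ((((K ℕ.+ suc u) ℕ.⊓ 2) ℕ.+ (c ℕ.+ w)) ≡ᵇ (((K ℕ.⊓ 2) ℕ.+ c) ℕ.+ suc γ)) ν₁))
      (≡ᵇ-false {K′ ℕ.+ suc u} {K′} (ℕ.m+1+n≢m K′))

    extending₋ : Subset n → ℕ → ℕ → Subset n → ℤ
    extending₋ X x zero    Y = 0ℤ
    extending₋ X x (suc y) Y = extending onLine X x y Y

    ch₋ : ℕ → ℕ → ℤ
    ch₋ f zero    = 0ℤ
    ch₋ f (suc y) = ch f y

    ∑-extending₋ : ∀ X x y → ∑L (extending₋ X x y) (allSubsets n) ≡ ch (free onLine X) x * ch₋ (free (not ∘ onLine) X) y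
    ∑-extending₋ X x zero    = trans (∑L-zero (allSubsets n)) (sym (*-zeroʳ (ch (free onLine X) x)))
    ∑-extending₋ X x (suc y) = ∑-extending onLine X x y

    ∑L-*ʳ : (f : Subset n → ℤ) (ν : ℤ) → ∑L (λ Y → f Y * ν) (allSubsets n) ≡ ∑L f (allSubsets n) * ν
    ∑L-*ʳ f ν = trans (∑L-cong′ (allSubsets n) (λ Y → *-comm (f Y) ν)) (trans (∑L-* ν f (allSubsets n)) (*-comm ν _))

    module Sum (X : Subset n) (γ : ℕ) (ts : List ℕ) (ν₀ ν₁ : ℤ)
      (value : ∀ Y → isFlat Y ≡ true → mrank Y ≡ mrank X ℕ.+ suc γ → hrec (just Y) ts ≡ val (lc Y) ν₀ ν₁) where

      t f₁ f₂ : ℕ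
      t = mrank X ℕ.+ suc γ
      f₁ = free onLine X
      f₂ = free (not ∘ onLine) X

      total : ℤ
      total = ∑L (λ Y → guard ((mrank Y ≡ᵇ t) ∧ subsetᵇ X Y) (hrec (just Y) ts)) (FinRankedPoset.elems nearPencil)

      u w : Subset n → ℕ
      u Y = extra onLine X Y
      w Y = extra (not ∘ onLine) X Y

      C : Subset n → ℤ
      C Y = contribution (lc X) (cc X) γ (u Y) (w Y) ν₀ ν₁

      term : ∀ Y → guard (isFlat Y) (guard ((mrank Y ≡ᵇ t) ∧ subsetᵇ X Y) (hrec (just Y) ts)) ≡ guard (sub X Y) (C Y)
      term Y with sub X Y in eq
      ... | false = trans (cong (λ b → guard (isFlat Y) (guard b (hrec (just Y) ts)))
          (trans (cong ((mrank Y ≡ᵇ t) ∧_) (trans (subset≡ X Y) eq)) (∧-zeroʳ _))) (guard-zero (isFlat Y))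
      ... | true = begin
        guard (isFlat Y) (guard ((mrank Y ≡ᵇ t) ∧ subsetᵇ X Y) (hrec (just Y) ts))
          ≡⟨ cong (λ b → guard (isFlat Y) (guard ((mrank Y ≡ᵇ t) ∧ b) (hrec (just Y) ts))) (trans (subset≡ X Y) eq) ⟩
        guard (isFlat Y) (guard ((mrank Y ≡ᵇ t) ∧ true) (hrec (just Y) ts))
          ≡⟨ evaluate (isFlat Y) (mrank Y ≡ᵇ t) refl refl ⟩
        guard (isFlat Y) (guard (mrank Y ≡ᵇ t) (val (lc Y) ν₀ ν₁))
          ≡⟨ cong₂ (λ b b′ → guard b (guard b′ (val (lc Y) ν₀ ν₁))) (isFlat≡ Y)
               (cong₂ (λ x y → x ≡ᵇ (y ℕ.+ suc γ)) (mrank≡ Y) (mrank≡ X)) ⟩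
        guard (flatᵇ K (lc Y)) (guard (((lc Y ℕ.⊓ 2) ℕ.+ cc Y) ≡ᵇ (((lc X ℕ.⊓ 2) ℕ.+ cc X) ℕ.+ suc γ)) (val (lc Y) ν₀ ν₁))
          ≡⟨ cong₂ (λ l k → guard (flatᵇ K l) (guard (((l ℕ.⊓ 2) ℕ.+ k) ≡ᵇ (((lc X ℕ.⊓ 2) ℕ.+ cc X) ℕ.+ suc γ)) (val l ν₀ ν₁)))
               (size-extra onLine X Y eq) (size-extra (not ∘ onLine) X Y eq) ⟩
        C Y ∎
        where
        open ≡-Reasoning
        evaluate : ∀ b b′ → isFlat Y ≡ b → (mrank Y ≡ᵇ t) ≡ b′
          → guard b (guard (b′ ∧ true) (hrec (just Y) ts)) ≡ guard b (guard b′ (val (lc Y) ν₀ ν₁))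
        evaluate false b′    _ _ = refl
        evaluate true  false _ _ = refl
        evaluate true  true  e e′ = value Y e (≡ᵇ-sound (mrank Y) t e′)

      total≡ : total ≡ ∑L (λ Y → guard (sub X Y) (C Y)) (allSubsets n)
      total≡ = trans (∑L-filter isFlat (λ Y → guard ((mrank Y ≡ᵇ t) ∧ subsetᵇ X Y) (hrec (just Y) ts)) (allSubsets n))
        (∑L-cong′ (allSubsets n) term)

      guard-both : ∀ x y Y ν → guard (sub X Y) (both (u Y) (w Y) x y * ν) ≡ extending onLine X x y Y * ν
      guard-both x y Y ν with sub X Y
      ... | true  = refl
      ... | false = refl

      guard-both₋ : ∀ x y Y ν → guard (sub X Y) (both₋ (u Y) (w Y) x y * ν) ≡ extending₋ X x y Y * ν
      guard-both₋ x zero    Y ν = guard-zero (sub X Y)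
      guard-both₋ x (suc y) Y ν = guard-both x y Y ν

      guard-+ : ∀ b x y → guard b (x + y) ≡ guard b x + guard b y
      guard-+ true  x y = refl
      guard-+ false x y = refl

      total₀ : lc X ≡ 0 → total ≡ ch f₁ 0 * ch f₂ (suc γ) * ν₀ + (ch f₁ 1 * ch f₂ γ * ν₁ + ch f₁ K * ch₋ f₂ γ * ν₁)
      total₀ lcX = trans total≡ (trans (∑L-cong′ (allSubsets n) (λ Y → trans
          (cong (guard (sub X Y)) (trans (cong (λ a → contribution a (cc X) γ (u Y) (w Y) ν₀ ν₁) lcX) (contribution₀ (cc X) γ (u Y) (w Y) ν₀ ν₁)))
          (trans (guard-+ (sub X Y) _ _) (cong₂ _+_ (guard-both 0 (suc γ) Y ν₀)
            (trans (guard-+ (sub X Y) _ _) (cong₂ _+_ (guard-both 1 γ Y ν₁) (guard-both₋ K γ Y ν₁)))))))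
        (trans (∑L-+ (λ Y → extending onLine X 0 (suc γ) Y * ν₀) _ (allSubsets n))
          (cong₂ _+_ (trans (∑L-*ʳ (extending onLine X 0 (suc γ)) ν₀) (cong (λ z → z * ν₀) (∑-extending onLine X 0 (suc γ))))
            (trans (∑L-+ (λ Y → extending onLine X 1 γ Y * ν₁) _ (allSubsets n))
              (cong₂ _+_ (trans (∑L-*ʳ (extending onLine X 1 γ) ν₁) (cong (λ z → z * ν₁) (∑-extending onLine X 1 γ)))
                (trans (∑L-*ʳ (extending₋ X K γ) ν₁) (cong (λ z → z * ν₁) (∑-extending₋ X K γ))))))))

      total₁ : lc X ≡ 1 → total ≡ ch f₁ 0 * ch f₂ (suc γ) * ν₁ + ch f₁ (suc K′) * ch f₂ γ * ν₁
      total₁ lcX = trans total≡ (trans (∑L-cong′ (allSubsets n) (λ Y → trans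
          (cong (guard (sub X Y)) (trans (cong (λ a → contribution a (cc X) γ (u Y) (w Y) ν₀ ν₁) lcX) (contribution₁ (cc X) γ (u Y) (w Y) ν₀ ν₁)))
          (trans (guard-+ (sub X Y) _ _) (cong₂ _+_ (guard-both 0 (suc γ) Y ν₁) (guard-both (suc K′) γ Y ν₁)))))
        (trans (∑L-+ (λ Y → extending onLine X 0 (suc γ) Y * ν₁) _ (allSubsets n))
          (cong₂ _+_ (trans (∑L-*ʳ (extending onLine X 0 (suc γ)) ν₁) (cong (λ z → z * ν₁) (∑-extending onLine X 0 (suc γ))))
            (trans (∑L-*ʳ (extending onLine X (suc K′) γ) ν₁) (cong (λ z → z * ν₁) (∑-extending onLine X (suc K′) γ))))))

      total₂ : lc X ≡ K → total ≡ ch f₁ 0 * ch f₂ (suc γ) * ν₁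
      total₂ lcX = trans total≡ (trans (∑L-cong′ (allSubsets n) (λ Y → trans
          (cong (guard (sub X Y)) (trans (cong (λ a → contribution a (cc X) γ (u Y) (w Y) ν₀ ν₁) lcX) (contribution₂ (cc X) γ (u Y) (w Y) ν₀ ν₁)))
          (guard-both 0 (suc γ) Y ν₁)))
        (trans (∑L-*ʳ (extending onLine X 0 (suc γ)) ν₁) (cong (λ z → z * ν₁) (∑-extending onLine X 0 (suc γ)))))

  private
    κ : ℤ
    κ = + K′

    unitVal : ∀ u → val u (1ℤ + κ * 0ℤ) 1ℤ ≡ 1ℤ
    unitVal zero    = 1+x*0≡1 κ
    unitVal (suc u) = refl

    coloops : ∀ i c f γ l {M} → c ℕ.+ f ≡ M → (i ℕ.+ c) ℕ.+ (suc γ ℕ.+ suc l) ≡ M ℕ.+ 2 → i ℕ.+ (γ ℕ.+ l) ≡ f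
    coloops i c f γ l refl eq = ℕ.+-cancelˡ-≡ (c ℕ.+ 2) _ _ (trans (rearrange₁ i c γ l) (trans eq (rearrange₂ c f)))
      where
      rearrange₁ : ∀ i c γ l → c ℕ.+ 2 ℕ.+ (i ℕ.+ (γ ℕ.+ l)) ≡ (i ℕ.+ c) ℕ.+ (suc γ ℕ.+ suc l)
      rearrange₁ = ℕSolver.solve-∀
      rearrange₂ : ∀ c f → c ℕ.+ f ℕ.+ 2 ≡ c ℕ.+ 2 ℕ.+ f
      rearrange₂ = ℕSolver.solve-∀

    ch-bin↓ : ∀ γ l → ch (γ ℕ.+ l) (suc γ) ≡ bin↓ (suc γ) l
    ch-bin↓ γ zero    = trans (cong₂ ch (ℕ.+-identityʳ γ) (ℕ.+-comm 1 γ)) (ch-large γ 0)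
    ch-bin↓ γ (suc l) = trans (cong (λ f → ch f (suc γ)) (ℕ.+-suc γ l)) (ch≡bin (suc γ) l)

    ch-bin← : ∀ γ l → ch₋ (γ ℕ.+ l) γ ≡ bin← γ (suc l)
    ch-bin← zero    l = refl
    ch-bin← (suc γ) l = trans (cong (λ f → ch f γ) (sym (ℕ.+-suc γ l))) (ch≡bin γ (suc l))

    ch-all : ∀ f → ch f f ≡ 1ℤ
    ch-all f = trans (cong (λ g → ch g f) (sym (ℕ.+-identityʳ f))) (trans (ch≡bin f 0) (bin-zeroʳ f))

    ch-one : ∀ f → ch f 1 ≡ + f
    ch-one zero    = refl
    ch-one (suc f) = trans (cong (λ z → z + 1ℤ) (ch-one f)) (ℤ.+-comm (+ f) 1ℤ)

    lineCount : ∀ X → isFlat X ≡ true → lc X ≡ 0 ⊎ lc X ≡ 1 ⊎ lc X ≡ K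
    lineCount X flat = go (lc X) refl (trans (sym (isFlat≡ X)) flat)
      where
      go : ∀ u → lc X ≡ u → flatᵇ K u ≡ true → lc X ≡ 0 ⊎ lc X ≡ 1 ⊎ lc X ≡ K
      go zero          eq _  = inj₁ eq
      go (suc zero)    eq _  = inj₂ (inj₁ eq)
      go (suc (suc u)) eq fl = inj₂ (inj₂ (trans eq (≡ᵇ-sound (suc (suc u)) K fl)))

  -- Here `suc γ` is the distance from the rank of `X` to the first rank of the list, and `M + 2` is
  -- the rank of the lattice. The recursions of `hB` and `hC` are the constant part and the
  -- coefficient of `κ` of this one.
  hrec-flat : ∀ bs γ X → isFlat X ≡ true → mrank X ℕ.+ (suc γ ℕ.+ length bs) ≡ M ℕ.+ 2
    → hrec (just X) (ranksFrom (mrank X ℕ.+ suc γ) bs) ≡ val (lc X) (hB (suc γ) bs + κ * hC (suc γ) bs) (hB (suc γ) bs)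
  hrec-flat [] γ X flat eq = sym (unitVal (lc X))
  hrec-flat (false ∷ bs) γ X flat eq = trans (cong (λ t → hrec (just X) (ranksFrom t bs)) (sym (ℕ.+-suc (mrank X) (suc γ))))
    (hrec-flat bs (suc γ) X flat (trans (cong (λ k → mrank X ℕ.+ suc k) (sym (ℕ.+-suc γ (length bs)))) eq))
  hrec-flat (true ∷ bs) γ X flat eq = trans
    (cong (λ z → total - z) (trans (cong (λ t → hrec (just X) (ranksFrom t bs)) (sym (ℕ.+-suc (mrank X) (suc γ))))
      (hrec-flat bs (suc γ) X flat (trans (cong (λ k → mrank X ℕ.+ suc k) (sym (ℕ.+-suc γ (length bs)))) eq))))
    (finish (lineCount X flat))
    where
    open ≡-Reasoning
    l = length bs
    b c : ℕ → ℤ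
    b g = hB g bs
    c g = hC g bs
    value : ∀ Y → isFlat Y ≡ true → mrank Y ≡ mrank X ℕ.+ suc γ
      → hrec (just Y) (ranksFrom (suc (mrank X ℕ.+ suc γ)) bs) ≡ val (lc Y) (b 1 + κ * c 1) (b 1)
    value Y flatY eqY = trans (cong (λ t → hrec (just Y) (ranksFrom t bs)) (trans (cong suc (sym eqY)) (ℕ.+-comm 1 (mrank Y))))
      (hrec-flat bs 0 Y flatY (trans (cong (ℕ._+ suc l) eqY) (trans (ℕ.+-assoc (mrank X) (suc γ) (suc l)) eq)))
    open Sum X γ (ranksFrom (suc (mrank X ℕ.+ suc γ)) bs) (b 1 + κ * c 1) (b 1) value
    f₂≡ : ∀ {a} → lc X ≡ a → (a ℕ.⊓ 2) ℕ.+ (γ ℕ.+ l) ≡ f₂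
    f₂≡ {a} lcX = coloops (a ℕ.⊓ 2) (cc X) f₂ γ l (size-free (not ∘ onLine) X)
      (trans (cong (ℕ._+ (suc γ ℕ.+ suc l)) (sym (trans (mrank≡ X) (cong (λ a → (a ℕ.⊓ 2) ℕ.+ cc X) lcX)))) eq)
    f₁≡ : ∀ {a} → lc X ≡ a → a ℕ.+ f₁ ≡ K
    f₁≡ lcX = trans (cong (ℕ._+ f₁) (sym lcX)) (trans (size-free onLine X) line)
    one : ∀ x y → 1ℤ * x * y ≡ x * y
    one = solve-∀
    boolean : ∀ u → lc X ≡ suc u → total ≡ bin (suc γ) (suc l) * b 1
      → total - val (lc X) (b (suc (suc γ)) + κ * c (suc (suc γ))) (b (suc (suc γ)))
        ≡ val (lc X) (hB (suc γ) (true ∷ bs) + κ * hC (suc γ) (true ∷ bs)) (hB (suc γ) (true ∷ bs))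
    boolean u lcX tot rewrite lcX = cong (λ z → z - b (suc (suc γ))) tot
    finish : lc X ≡ 0 ⊎ lc X ≡ 1 ⊎ lc X ≡ K
      → total - val (lc X) (b (suc (suc γ)) + κ * c (suc (suc γ))) (b (suc (suc γ)))
        ≡ val (lc X) (hB (suc γ) (true ∷ bs) + κ * hC (suc γ) (true ∷ bs)) (hB (suc γ) (true ∷ bs))
    finish (inj₂ (inj₁ lcX)) = boolean 0 lcX (begin
      total                                                             ≡⟨ total₁ lcX ⟩
      1ℤ * ch f₂ (suc γ) * b 1 + ch f₁ (suc K′) * ch f₂ γ * b 1          ≡⟨ cong₂ (λ f g → 1ℤ * ch f (suc γ) * b 1 + g * ch f γ * b 1)
                                                                               (sym (f₂≡ lcX)) (trans (cong (λ f → ch f (suc K′)) (ℕ.suc-injective (f₁≡ lcX))) (ch-all (suc K′))) ⟩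
      1ℤ * ch (suc (γ ℕ.+ l)) (suc γ) * b 1 + 1ℤ * ch (suc (γ ℕ.+ l)) γ * b 1 ≡⟨ alg (ch (suc (γ ℕ.+ l)) (suc γ)) (ch (suc (γ ℕ.+ l)) γ) (b 1) ⟩
      ch (suc (suc (γ ℕ.+ l))) (suc γ) * b 1                             ≡⟨ cong (λ z → z * b 1) (trans (cong (λ f → ch (suc f) (suc γ)) (sym (ℕ.+-suc γ l))) (ch≡bin (suc γ) (suc l))) ⟩
      bin (suc γ) (suc l) * b 1 ∎)
      where
      alg : ∀ x y b → 1ℤ * x * b + 1ℤ * y * b ≡ (x + y) * b
      alg = solve-∀
    finish (inj₂ (inj₂ lcX)) = boolean (suc K′) lcX (begin
      total                                                             ≡⟨ total₂ lcX ⟩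
      1ℤ * ch f₂ (suc γ) * b 1                                          ≡⟨ one (ch f₂ (suc γ)) (b 1) ⟩
      ch f₂ (suc γ) * b 1                                               ≡⟨ cong (λ f → ch f (suc γ) * b 1) (trans (sym (f₂≡ lcX)) (trans (cong (ℕ._+ (γ ℕ.+ l)) (⊓2 K′)) (cong suc (sym (ℕ.+-suc γ l))))) ⟩
      ch (suc γ ℕ.+ suc l) (suc γ) * b 1                                ≡⟨ cong (λ z → z * b 1) (ch≡bin (suc γ) (suc l)) ⟩
      bin (suc γ) (suc l) * b 1 ∎)
    finish (inj₁ lcX) = trans (cong (λ u → total - val u (b (suc (suc γ)) + κ * c (suc (suc γ))) (b (suc (suc γ)))) lcX) (trans (begin
      total - (b (suc (suc γ)) + κ * c (suc (suc γ)))
        ≡⟨ cong (λ z → z - (b (suc (suc γ)) + κ * c (suc (suc γ)))) (total₀ lcX) ⟩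
      1ℤ * ch f₂ (suc γ) * (b 1 + κ * c 1) + (ch f₁ 1 * ch f₂ γ * b 1 + ch f₁ K * ch₋ f₂ γ * b 1) - (b (suc (suc γ)) + κ * c (suc (suc γ)))
        ≡⟨ cong₂ (λ f f′ → 1ℤ * ch f (suc γ) * (b 1 + κ * c 1) + (ch f′ 1 * ch f γ * b 1 + ch f′ K * ch₋ f γ * b 1) - (b (suc (suc γ)) + κ * c (suc (suc γ))))
             (sym (f₂≡ lcX)) (f₁≡ lcX) ⟩
      1ℤ * ch (γ ℕ.+ l) (suc γ) * (b 1 + κ * c 1) + (ch K 1 * ch (γ ℕ.+ l) γ * b 1 + ch K K * ch₋ (γ ℕ.+ l) γ * b 1) - (b (suc (suc γ)) + κ * c (suc (suc γ)))
        ≡⟨ cong₂ (λ x y → 1ℤ * x * (b 1 + κ * c 1) + y - (b (suc (suc γ)) + κ * c (suc (suc γ)))) (ch-bin↓ γ l)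
             (cong₂ _+_ (cong₂ (λ x y → x * y * b 1) (ch-one K) (ch≡bin γ l)) (cong₂ (λ x y → x * y * b 1) (ch-all K) (ch-bin← γ l))) ⟩
      1ℤ * x * (b 1 + κ * c 1) + ((1ℤ + (1ℤ + κ)) * y * b 1 + 1ℤ * z * b 1) - (b (suc (suc γ)) + κ * c (suc (suc γ)))
        -- `x`, `y` and `z` count the choices of coloops for next flats with no line point, a given
        -- one, and all of them. The part without `κ` has the coefficient `x + 2y + z`, a Boolean
        -- count by Pascal's rule; the coefficient of `κ` is the recursion of `hC`.
        ≡⟨ alg x y z (b 1) (c 1) (b (suc (suc γ))) (c (suc (suc γ))) κ ⟩
      ((z + y) + (y + x)) * b 1 - b (suc (suc γ)) + κ * (x * c 1 + y * b 1 - c (suc (suc γ)))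
        ≡⟨ cong₂ (λ p q → (p + q) * b 1 - b (suc (suc γ)) + κ * (x * c 1 + y * b 1 - c (suc (suc γ))))
             (sym (bin↓-bin← γ (suc l))) (sym (bin↓-bin← (suc γ) l)) ⟩
      hB (suc γ) (true ∷ bs) + κ * hC (suc γ) (true ∷ bs) ∎)
      (cong (λ u → val u (hB (suc γ) (true ∷ bs) + κ * hC (suc γ) (true ∷ bs)) (hB (suc γ) (true ∷ bs))) (sym lcX)))
      where
      x = bin↓ (suc γ) l
      y = bin γ l
      z = bin← γ (suc l)
      alg : ∀ x y z b c b′ c′ k → 1ℤ * x * (b + k * c) + ((1ℤ + (1ℤ + k)) * y * b + 1ℤ * z * b) - (b′ + k * c′)
        ≡ ((z + y) + (y + x)) * b - b′ + k * (x * c + y * b - c′)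
      alg = solve-∀

  hrec-pencil : ∀ bs → suc (length bs) ≡ M ℕ.+ 2 → hrec nothing (ranksFrom 1 bs) ≡ hB 1 bs + κ * hC 1 bs
  hrec-pencil bs eq = trans (start (ranksFrom 1 bs)) (trans (cong (λ t → hrec (just ∅) (ranksFrom t bs)) (sym rank₁))
    (trans (hrec-flat bs 0 ∅ (trans (isFlat≡ ∅) (cong (flatᵇ K) (size∅ onLine))) (trans (cong (ℕ._+ suc (length bs)) mrank∅) eq))
      (cong (λ u → val u (hB 1 bs + κ * hC 1 bs) (hB 1 bs)) (size∅ onLine))))
    where
    ∅ : Subset n
    ∅ = Vec.replicate n false
    size∅ : ∀ {n} (on : Fin n → Bool) → size on (Vec.replicate n false) ≡ 0
    size∅ {zero}  on = refl
    size∅ {suc n} on = size∅ (on ∘ suc)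
    sub∅ : ∀ {n} (Y : Vec Bool n) → sub (Vec.replicate n false) Y ≡ true
    sub∅ []      = refl
    sub∅ (_ ∷ Y) = sub∅ Y
    mrank∅ : mrank ∅ ≡ 0
    mrank∅ = trans (mrank≡ ∅) (cong₂ (λ x y → (x ℕ.⊓ 2) ℕ.+ y) (size∅ onLine) (size∅ (not ∘ onLine)))
    rank₁ : mrank ∅ ℕ.+ 1 ≡ 1
    rank₁ = cong (ℕ._+ 1) mrank∅
    start : ∀ ts → hrec nothing ts ≡ hrec (just ∅) ts
    start []       = refl
    start (t ∷ ts) = cong₂ _-_ (∑L-cong′ (FinRankedPoset.elems nearPencil) (λ Y → cong (λ b → guard ((mrank Y ≡ᵇ t) ∧ b) (hrec (just Y) ts))
      (sym (trans (subset≡ ∅ Y) (sub∅ Y))))) (start ts)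

-- Evaluation for the near pencil and comparison

hS-nearPencil : ∀ r n → suc r ≤ n → (S : Subset r)
  → hS (NearPencil.nearPencil r n) S ≡ hB 1 (toList S) + (+ n - + suc r) * hC 1 (toList S)
-- For `r = 0` all `n` elements satisfy `onLine`, one fewer than the general count of n - r + 1, so
-- this case is separate; no rank can be selected in it.
hS-nearPencil ℕ.zero n _ [] = sym (1+x*0≡1 (+ n - 1ℤ))
hS-nearPencil r@(suc r′) n r<n S = trans (hS≡hrec (NearPencil.nearPencil r n) S)
  (trans (hrec-pencil (toList S) len) (cong (λ z → hB 1 (toList S) + z * hC 1 (toList S)) K′≡))
  where
  K′ : ℕ
  K′ = n ℕ.∸ suc r
  n≡ : n ≡ K′ ℕ.+ suc r
  n≡ = sym (ℕ.m∸n+n≡m r<n)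
  line≡ : n ℕ.∸ r ≡ suc K′
  line≡ = trans (cong (ℕ._∸ r) (trans n≡ (ℕ.+-suc K′ r))) (ℕ.m+n∸n≡m (suc K′) r)
  line : cF (NearPencil.onLine r n) ≡ suc (suc K′)
  line = trans (cF-initial n (n ℕ.∸ r) (ℕ.∸-monoʳ-< (ℕ.s≤s ℕ.z≤n) (ℕ.<⇒≤ r<n))) (cong suc line≡)
  open Pencils r n K′ line
  M≡ : M ≡ r′
  M≡ = ℕ.+-cancelˡ-≡ (suc (suc K′)) M r′ (trans (cong (ℕ._+ M) (sym line)) (trans (cF-complement (NearPencil.onLine r n))
    (trans n≡ (trans (ℕ.+-suc K′ r) (cong suc (ℕ.+-suc K′ r′))))))
  len : suc (length (toList S)) ≡ M ℕ.+ 2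
  len = trans (cong suc (length-toList S)) (trans (ℕ.+-comm 2 r′) (cong (ℕ._+ 2) (sym M≡)))
  K′≡ : + K′ ≡ + n - + suc r
  K′≡ = sym (trans (ℤ.m-n≡m⊖n n (suc r)) (ℤ.⊖-≥ r<n))

theorem3p5 : (r n m : ℕ) → suc r ≤ n → (L : GeometricLattice m)
    → GeometricLattice.rank L ≡ suc r → GeometricLattice.numAtoms L ≡ n
    → (S : Subset r)
    → hS (NearPencil.nearPencil r n) S ≤ℤ hS (GeometricLattice.asPoset L) S
theorem3p5 r n m r<n L rank≡ atoms≡ S = subst₂ _≤ℤ_ (sym pencil) (sym lattice) (h-lower (toList S) (bot-min top) ρtop)
  where
  open Flags L
  open AtomCounts L
  open LowerBound L
  open LatticeChains L
  len : length (toList S) ≡ r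
  len = length-toList S
  ρtop : ρ top ≡ suc (length (toList S)) ℕ.+ ρ bot
  ρtop = trans rank≡ (sym (trans (cong₂ (λ x y → suc x ℕ.+ y) len ρ-bot) (ℕ.+-identityʳ (suc r))))
  pencil : hS (NearPencil.nearPencil r n) S ≡ hB 1 (toList S) + (at bot top - + suc (length (toList S))) * hC 1 (toList S)
  pencil = trans (hS-nearPencil r n r<n S) (cong₂ (λ x y → hB 1 (toList S) + (x - + suc y) * hC 1 (toList S))
    (trans (cong +_ (sym atoms≡)) numAtoms≡at) (sym len))
  lattice : hS (GeometricLattice.asPoset L) S ≡ h bot top (suc (ρ bot)) (toList S)
  lattice = trans (hS≡hrec (GeometricLattice.asPoset L) S) (trans (hrec-nothing (ranksFrom 1 (toList S)))
    (trans (hrec≡h bot 1 (toList S)) (cong (λ t → h bot top (suc t) (toList S)) (sym ρ-bot))))
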